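{- Let $\Delta$ be a positive integer and let $\mathcal{G}_\Delta$ be any family of graphs with $\mathcal{T}_\Delta \subseteq \mathcal{G}_\Delta \subseteq \mathcal{C}_\Delta$. Every positive integer $k$ is forcing for $\mathcal{G}_2$. For every $\Delta \ge 3$: (1) $k=1,2,3,4,6$ are forcing for $\mathcal{G}_\Delta$. (2) $k=5,8$ are weakly forcing for $\mathcal{G}_\Delta$, with $f_{\mathcal{G}_\Delta}(5)=-1$ and $f_{\mathcal{G}_\Delta}(8)=-1$. (3) $k=7$ and every $k\ge 9$ collapse for $\mathcal{G}_\Delta$. Furthermore, for every such $k$ and integer $m$: (a) if $k=4m+3$, then $-\frac{2m-1}{6m+5} \ge c_{\mathcal{G}_\Delta}(k) \ge -\frac{m}{3m+2}$; (b) if $k=4m+2$, then $-\frac{2m-3}{6m+3} \ge c_{\mathcal{G}_\Delta}(k) \ge -\frac{m-1}{3m+1}$; (c) if $k=4m+1$, then $-\frac{m-1}{3m+1} \ge c_{\mathcal{G}_\Delta}(k) \ge -\frac{2m-1}{6m+1}$; (d) if $k=4m$, then $-\frac{m-2}{3m} \ge c_{\mathcal{G}_\Delta}(k) \ge -\frac{2m-3}{6m-1}$.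
   Context: All graphs are finite and simple. For a graph $G$, a weighing is a function $w: E(G) \to \{ -1,1\}$, and for a subgraph $H$, $w(H)=\sum_{e\in E(H)} w(e)$. For a positive integer $k$, $w$ is $k$-local positive if $w(H)>0$ for every connected subgraph $H$ of $G$ with exactly $k$ edges. Let $\mathcal{G}$ be an infinite family of connected graphs. $k$ is forcing for $\mathcal{G}$ if for all but finitely many $G \in \mathcal{G}$, every $k$-local positive weighing $w$ of $G$ satisfies $w(G)>0$. If $k$ is not forcing, $k$ is weakly forcing for $\mathcal{G}$ if there is a constant $C$ (possibly negative) such that for all but finitely many $G\in\mathcal{G}$, every $k$-local positive weighing $w$ of $G$ has $w(G)\ge C$; then $f_{\mathcal{G}}(k)$ is the maximum such $C$. If $k$ is neither forcing nor weakly forcing, $k$ collapses for $\mathcal{G}$, and $c_{\mathcal{G}}(k)$ is the supremum of all $c \le 0$ such that $w(G) \ge c|E(G)| - o(|E(G)|)$ for all $G \in \mathcal{G}$ and all $k$-local positive weighings $w$ of $G$. $\mathcal{C}$ is the family of all connected graphs, $\mathcal{T}$ the family of all trees, and for a family $\mathcal{F}$, $\mathcal{F}_\Delta$ denotes its subfamily of members with maximum degree at most $\Delta$. -}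

module Defs where

open import Data.Nat as ℕ using (ℕ; zero; suc; _≤_)
open import Data.Integer as ℤ using (ℤ; +_)
open import Data.Rational as ℚ using (ℚ)
open import Data.Fin using (Fin; zero; suc; toℕ; inject₁; fromℕ)
open import Data.Bool using (Bool; true; false; T; _∧_; _∨_; if_then_else_)
open import Data.Sign using (Sign)
open import Data.Product using (Σ; ∃; _×_)
open import Data.Empty using (⊥)
open import Relation.Nullary using (¬_)
open import Relation.Binary.PropositionalEquality using (_≡_)
open import Relation.Binary.Construct.Closure.ReflexiveTransitive using (Star)
open import Function.Definitions using (Injective)

sumℕ : {n : ℕ} → (Fin n → ℕ) → ℕ
sumℕ {zero}  f = 0
sumℕ {suc n} f = f zero ℕ.+ sumℕ (λ i → f (suc i))

sumℤ : {n : ℕ} → (Fin n → ℤ) → ℤ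
sumℤ {zero}  f = + 0
sumℤ {suc n} f = f zero ℤ.+ sumℤ (λ i → f (suc i))

ℤtoℚ : ℤ → ℚ
ℤtoℚ z = z ℚ./ 1

ℕtoℚ : ℕ → ℚ
ℕtoℚ n = (+ n) ℚ./ 1

-- p // d is the rational p / d (only ever used with d ≠ 0; d = 0 gives 0)
_//_ : ℤ → ℕ → ℚ
p // zero  = ℚ.0ℚ
p // suc d = p ℚ./ suc d

record Graph (n : ℕ) : Set where
  field
    adj : Fin n → Fin n → Bool
    sym : ∀ i j → adj i j ≡ adj j i
    irr : ∀ i → adj i i ≡ false
open Graph public

-- A (spanning) subgraph is given by a set of edges S ⊆ E(G), encoded as a
-- Bool-valued function on pairs; an edge {i,j} with i < j lies in the
-- subgraph iff adj i j and S i j.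
EdgeSet : ℕ → Set
EdgeSet n = Fin n → Fin n → Bool

inE : {n : ℕ} → Graph n → EdgeSet n → Fin n → Fin n → Bool
inE G S i j = (toℕ i ℕ.<ᵇ toℕ j) ∧ adj G i j ∧ S i j

allEdges : {n : ℕ} → EdgeSet n
allEdges i j = true

numEdgesSub : {n : ℕ} → Graph n → EdgeSet n → ℕ
numEdgesSub G S = sumℕ (λ i → sumℕ (λ j → if inE G S i j then 1 else 0))

numEdges : {n : ℕ} → Graph n → ℕ
numEdges G = numEdgesSub G allEdges

adjSub : {n : ℕ} → Graph n → EdgeSet n → Fin n → Fin n → Set
adjSub G S u v = T (inE G S u v ∨ inE G S v u)

inVSub : {n : ℕ} → Graph n → EdgeSet n → Fin n → Set
inVSub G S v = ∃ λ u → adjSub G S u v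

ConnectedSub : {n : ℕ} → Graph n → EdgeSet n → Set
ConnectedSub G S = ∀ u v → inVSub G S u → inVSub G S v → Star (adjSub G S) u v

Connected : {n : ℕ} → Graph n → Set
Connected G = ∀ u v → Star (λ i j → T (adj G i j)) u v

HasCycle : {n : ℕ} → Graph n → Set
HasCycle {n} G =
  ∃ λ (l : ℕ) → Σ (Fin (3 ℕ.+ l) → Fin n) λ f →
    Injective _≡_ _≡_ f ×
    (∀ (i : Fin (2 ℕ.+ l)) → T (adj G (f (inject₁ i)) (f (suc i)))) ×
    T (adj G (f (fromℕ (2 ℕ.+ l))) (f zero))

IsTree : {n : ℕ} → Graph n → Set
IsTree G = Connected G × ¬ HasCycle G

degree : {n : ℕ} → Graph n → Fin n → ℕ
degree G v = sumℕ (λ j → if adj G v j then 1 else 0)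

MaxDegAtMost : ℕ → {n : ℕ} → Graph n → Set
MaxDegAtMost Δ G = ∀ v → degree G v ≤ Δ

Family : Set₁
Family = (n : ℕ) → Graph n → Set

Sandwiched : ℕ → Family → Set
Sandwiched Δ 𝒢 =
  (∀ n (G : Graph n) → IsTree G → MaxDegAtMost Δ G → 𝒢 n G) ×
  (∀ n (G : Graph n) → 𝒢 n G → Connected G × MaxDegAtMost Δ G)

-- a weighing assigns a sign (±1) to each pair; only the values w i j on
-- edges {i,j} with i < j are ever used
Weighing : ℕ → Set
Weighing n = Fin n → Fin n → Sign

weightSub : {n : ℕ} → Graph n → Weighing n → EdgeSet n → ℤ
weightSub G w S =
  sumℤ (λ i → sumℤ (λ j → if inE G S i j then w i j ℤ.◃ 1 else + 0))

weight : {n : ℕ} → Graph n → Weighing n → ℤ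
weight G w = weightSub G w allEdges

LocalPositive : ℕ → {n : ℕ} → Graph n → Weighing n → Set
LocalPositive k G w =
  ∀ (S : EdgeSet _) → numEdgesSub G S ≡ k → ConnectedSub G S →
    + 0 ℤ.< weightSub G w S

-- Forcing / weakly forcing / collapse
-- "for all but finitely many G ∈ 𝒢" is rendered as "for all G ∈ 𝒢 with at
-- least N vertices, for some N" (there are finitely many graphs on Fin n).

Forcing : ℕ → Family → Set
Forcing k 𝒢 =
  ∃ λ (N : ℕ) → ∀ n → N ≤ n → ∀ (G : Graph n) → 𝒢 n G →
    ∀ (w : Weighing n) → LocalPositive k G w → + 0 ℤ.< weight G w

WeakBound : ℕ → Family → ℚ → Set
WeakBound k 𝒢 C =
  ∃ λ (N : ℕ) → ∀ n → N ≤ n → ∀ (G : Graph n) → 𝒢 n G →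
    ∀ (w : Weighing n) → LocalPositive k G w → C ℚ.≤ ℤtoℚ (weight G w)

WeaklyForcing : ℕ → Family → Set
WeaklyForcing k 𝒢 = ¬ Forcing k 𝒢 × ∃ λ C → WeakBound k 𝒢 C

WeaklyForcingWithValue : ℕ → Family → ℚ → Set
WeaklyForcingWithValue k 𝒢 C =
  ¬ Forcing k 𝒢 × WeakBound k 𝒢 C × (∀ C' → C ℚ.< C' → ¬ WeakBound k 𝒢 C')

Collapses : ℕ → Family → Set
Collapses k 𝒢 = ¬ Forcing k 𝒢 × ¬ (∃ λ C → WeakBound k 𝒢 C)

CollapseAdmissible : ℕ → Family → ℚ → Set
CollapseAdmissible k 𝒢 c =
  ∃ λ (g : ℕ → ℚ) →
    (∀ (ε : ℚ) → ℚ.0ℚ ℚ.< ε → ∃ λ (N : ℕ) → ∀ m → N ≤ m →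
        ℚ.∣ g m ∣ ℚ.≤ ε ℚ.* ℕtoℚ m) ×
    (∀ n (G : Graph n) → 𝒢 n G → ∀ (w : Weighing n) → LocalPositive k G w →
        c ℚ.* ℕtoℚ (numEdges G) ℚ.- g (numEdges G) ℚ.≤ ℤtoℚ (weight G w))

-- c_𝒢(k) = sup { c ≤ 0 : c admissible }
-- "c_𝒢(k) ≤ a": every admissible c ≤ 0 is ≤ a
CollapseValueAtMost : ℕ → Family → ℚ → Set
CollapseValueAtMost k 𝒢 a =
  ∀ c → c ℚ.≤ ℚ.0ℚ → CollapseAdmissible k 𝒢 c → c ℚ.≤ a

CollapseValueAtLeast : ℕ → Family → ℚ → Set
CollapseValueAtLeast k 𝒢 b =
  ∀ c' → c' ℚ.< b → ∃ λ c → c ℚ.≤ ℚ.0ℚ × CollapseAdmissible k 𝒢 c × c' ℚ.< c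

CollapseValueBetween : ℕ → Family → ℚ → ℚ → Set
CollapseValueBetween k 𝒢 upper lower =
  CollapseValueAtMost k 𝒢 upper × CollapseValueAtLeast k 𝒢 lower

{-# OPTIONS --safe #-}
-- Put r = ⌈k/2⌉ - 1. A weighing is k-local positive iff every connected subgraph with k edges has at most r negative edges,
-- so, growing or pruning it to k edges, a connected subgraph with j edges has at most r + max(0, j - k) of them.
-- Lower bounds: the edges of a connected graph form a tree (split the vertices where cycles close), and from any large tree
-- one can cut a piece with between s and 2s - 2 edges so that a tree remains. For a suitable s every piece has the desired
-- ratio of negative edges. For k = 3, 4, 5, 6, 8 such pieces even have nonnegative weight, so only a bounded remainder
-- matters; for k = 3, 4, 6 bounded degrees yield an edge deep inside the tree, and cutting just above or just below it
-- leaves a part of odd size, whose weight is then positive. For Δ = 2 the pieces can be given exactly k edges.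
-- Upper bounds: hang from a positive path legs consisting of a positive stem followed by r negative edges, with stems just
-- so long that a connected subgraph meeting the negative edges of two legs has at least k - r positive edges.
module Submission where

open import Defs hiding (sym)
open import Data.Nat as ℕ using (ℕ; zero; suc; _+_; _*_; _∸_; _⊔_; _≤_; _<_; _≥_; z≤n; s≤s; _≤?_)
open import Data.Nat.Properties
open import Data.Nat.ListAction using (sum)
open import Data.Nat.ListAction.Properties using (sum-++; sum-↭)
open import Data.Nat.Tactic.RingSolver using (solve; solve-∀)
open import Data.Integer as ℤ using (ℤ; +_; -[1+_])
import Data.Integer.Properties as ℤₚ
open import Data.Rational as ℚ using (ℚ)
import Data.Rational.Properties as ℚₚ
open import Data.Rational.Unnormalised as ℚᵘ using (ℚᵘ; mkℚᵘ; *≤*; *≡*)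
import Data.Rational.Unnormalised.Properties as ℚᵘₚ
import Data.Rational.Solver
open import Data.Sign using (Sign)
open import Data.Bool using (Bool; true; false; T; T?; _∧_; _∨_; if_then_else_)
open import Data.Bool.Properties using (T-∧; T-∨; ∧-comm; ∨-comm)
open import Data.Fin as Fin using (Fin; zero; suc; toℕ; _↑ˡ_; _↑ʳ_; splitAt; inject₁; fromℕ)
import Data.Fin.Properties as Finₚ
open import Data.Fin.Relation.Unary.Top using (view; ‵fromℕ; ‵inject₁)
open import Data.List as List using (List; []; _∷_; _++_; [_]; map; length; tabulate; allFin; cartesianProduct; filter)
open import Data.List.Properties using (length-++; length-tabulate; ++-assoc; map-++; map-∘)
open import Data.List.Membership.Propositional using (_∈_; _∉_)
open import Data.List.Membership.Propositional.Properties
open import Data.List.Membership.DecPropositional using () renaming (_∈?_ to member?)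
open import Data.List.Relation.Unary.Any using (here; there)
open import Data.List.Relation.Unary.All as All using (All; []; _∷_)
import Data.List.Relation.Unary.All.Properties as Allₚ
open import Data.List.Relation.Unary.AllPairs using ([]; _∷_)
open import Data.List.Relation.Unary.Unique.Propositional using (Unique)
import Data.List.Relation.Unary.Unique.Propositional.Properties as Uniqueₚ
open import Data.List.Relation.Binary.Subset.Propositional using (_⊆_)
open import Data.List.Relation.Binary.Permutation.Propositional
  using (_↭_; ↭-refl; ↭-sym; ↭-trans; ↭-prep; ↭-swap; ↭-reflexive; ↭⇒↭ₛ; module PermutationReasoning)
open import Data.List.Relation.Binary.Permutation.Propositional.Properties
  using (map⁺; ↭-length; shift; shifts; ++⁺ˡ; ++⁺ʳ; ++-identityʳ; ∈-resp-↭)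
import Data.List.Relation.Binary.Permutation.Setoid.Properties as Permₛ
open import Data.Product using (∃; ∃₂; _×_; _,_; proj₁; proj₂; uncurry)
open import Data.Product.Properties using (≡-dec)
open import Data.Sum as Sum using (_⊎_; inj₁; inj₂; [_,_]′)
open import Data.Unit using (⊤; tt)
open import Data.Empty using (⊥; ⊥-elim)
open import Function using (_∘_; id; const; Equivalence)
open import Relation.Nullary using (¬_; Dec; yes; no; contradiction)
open import Relation.Nullary.Decidable
  using (isYes; True; False; toWitness; toWitnessFalse; fromWitness; _×-dec_; _⊎-dec_; _→-dec_)
open import Relation.Binary.Definitions using (tri<; tri≈; tri>)
open import Relation.Binary.PropositionalEquality hiding ([_]; J)
open import Relation.Binary.Construct.Closure.ReflexiveTransitive using (Star; ε; _◅_; _◅◅_; reverse; kleisliStar; gmap)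
open import Algebra.Properties.AbelianGroup ℤₚ.+-0-abelianGroup using (∙-cancelʳ)
import Algebra.Properties.CommutativeSemigroup

-- Counting edges

-- Everything turns on the sign of `k + 1 - 3r`. In a spine, two neighbouring stems and the spine
-- edge between them need `k - r` positive edges together, so a block of two legs and two spine
-- edges can have `k - r + 1` positive and `2r` negative edges: weight `k + 1 - 3r`. For the lower
-- bound, `2r` is the least size at which `r` negative edges cannot outweigh the rest; pieces then
-- have between `2r` and `4r - 2` edges, and the largest are harmless under the same condition
-- `k + 1 - 3r ≥ 0`. The value is positive for `k = 1, 2, 3, 4, 6`, zero for `k = 5, 8` (each block
-- has weight 0, and only the last leg tips the total to -1) and negative for all other `k`. For
-- negative values the smallest and the largest pieces compete: their ratios of negative edges are
-- at most `r / (s + 1)` and `(r + 2s - k) / 2s`, with `s` as in the code. Both are close to 2/3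
-- when `s` is about `3k/4`, and 2/3 is also the limit of the ratio `2r / (k + r + 1)` of a block.
-- Hence both bounds for the collapse value tend to -1/3.

sumEdges : ∀ {n} → Graph n → EdgeSet n → (Fin n → Fin n → ℕ) → ℕ
sumEdges G S h = sumℕ λ i → sumℕ λ j → if inE G S i j then h i j else 0

negBit : Sign → ℕ
negBit Sign.- = 1
negBit Sign.+ = 0

negSub : ∀ {n} → Graph n → Weighing n → EdgeSet n → ℕ
negSub G w S = sumEdges G S λ i j → negBit (w i j)

sumℕ-cong : ∀ {n} {f g : Fin n → ℕ} → (∀ i → f i ≡ g i) → sumℕ f ≡ sumℕ g
sumℕ-cong {zero}  f≗g = refl
sumℕ-cong {suc n} f≗g = cong₂ _+_ (f≗g zero) (sumℕ-cong (f≗g ∘ suc))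

sumℕ-zero : ∀ n → sumℕ {n} (λ _ → 0) ≡ 0
sumℕ-zero zero    = refl
sumℕ-zero (suc n) = sumℕ-zero n

sumℕ-+ : ∀ {n} (f g : Fin n → ℕ) → sumℕ (λ i → f i + g i) ≡ sumℕ f + sumℕ g
sumℕ-+ {zero}  f g = refl
sumℕ-+ {suc n} f g rewrite sumℕ-+ (f ∘ suc) (g ∘ suc) = interchange (f zero) _ _ _
  where
  interchange : ∀ a b c d → a + b + (c + d) ≡ (a + c) + (b + d)
  interchange = solve-∀

sumℤ-sumℕ : ∀ {n} {f : Fin n → ℤ} {a b : Fin n → ℕ} →
  (∀ i → f i ℤ.+ + (2 * b i) ≡ + a i) → sumℤ f ℤ.+ + (2 * sumℕ b) ≡ + sumℕ a
sumℤ-sumℕ {zero}  eq = refl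
sumℤ-sumℕ {suc n} {f} {a} {b} eq = begin
  (f zero ℤ.+ F) ℤ.+ + (2 * (b zero + B))      ≡⟨ cong (λ x → (f zero ℤ.+ F) ℤ.+ + x) (*-distribˡ-+ 2 (b zero) B) ⟩
  (f zero ℤ.+ F) ℤ.+ (+ (2 * b zero) ℤ.+ + (2 * B)) ≡⟨ interchange (f zero) F (+ (2 * b zero)) (+ (2 * B)) ⟩
  (f zero ℤ.+ + (2 * b zero)) ℤ.+ (F ℤ.+ + (2 * B)) ≡⟨ cong₂ ℤ._+_ (eq zero) (sumℤ-sumℕ (eq ∘ suc)) ⟩
  + a zero ℤ.+ + sumℕ (a ∘ suc) ∎
  where
  open ≡-Reasoning
  F = sumℤ (f ∘ suc)
  B = sumℕ (b ∘ suc)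
  open Algebra.Properties.CommutativeSemigroup ℤₚ.+-commutativeSemigroup using (interchange)

-- A negative edge gives -1 + 2 and a positive one 1 + 0. The additive form allows all estimates to
-- be made on natural numbers.
weightSub-negSub : ∀ {n} (G : Graph n) w S →
  weightSub G w S ℤ.+ + (2 * negSub G w S) ≡ + numEdgesSub G S
weightSub-negSub G w S = sumℤ-sumℕ λ i → sumℤ-sumℕ λ j → bit (inE G S i j) (w i j)
  where
  bit : ∀ e s → (if e then s ℤ.◃ 1 else + 0) ℤ.+ + (2 * (if e then negBit s else 0)) ≡ + (if e then 1 else 0)
  bit false s      = refl
  bit true  Sign.- = refl
  bit true  Sign.+ = refl

weightSub-pos⇒ : ∀ {n} (G : Graph n) w S → + 0 ℤ.< weightSub G w S → 2 * negSub G w S < numEdgesSub G S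
weightSub-pos⇒ G w S pos = ℤₚ.drop‿+<+ (subst (+ (2 * negSub G w S) ℤ.<_) (weightSub-negSub G w S)
  (ℤₚ.+-monoˡ-< (+ (2 * negSub G w S)) pos))

weightSub-pos⇐ : ∀ {n} (G : Graph n) w S → 2 * negSub G w S < numEdgesSub G S → + 0 ℤ.< weightSub G w S
weightSub-pos⇐ G w S lt = ℤₚ.≰⇒> λ le → ℤₚ.≤⇒≯
  (subst (ℤ._≤ + (2 * negSub G w S)) (weightSub-negSub G w S) (ℤₚ.+-monoˡ-≤ (+ (2 * negSub G w S)) le))
  (ℤ.+<+ lt)

sumL : ∀ {A : Set} → (A → ℕ) → List A → ℕ
sumL h xs = sum (map h xs)

sumL-++ : ∀ {A : Set} (h : A → ℕ) xs ys → sumL h (xs ++ ys) ≡ sumL h xs + sumL h ys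
sumL-++ h xs ys = trans (cong sum (map-++ h xs ys)) (sum-++ (map h xs) (map h ys))

sumL-↭ : ∀ {A : Set} (h : A → ℕ) {xs ys} → xs ↭ ys → sumL h xs ≡ sumL h ys
sumL-↭ h p = sum-↭ (map⁺ h p)

sumL-tabulate : ∀ {A : Set} {n} (h : A → ℕ) (f : Fin n → A) → sumL h (tabulate f) ≡ sumℕ (h ∘ f)
sumL-tabulate {n = zero}  h f = refl
sumL-tabulate {n = suc n} h f = cong₂ _+_ refl (sumL-tabulate h (f ∘ suc))

sumL-map : ∀ {A B : Set} (h : B → ℕ) (f : A → B) xs → sumL h (map f xs) ≡ sumL (h ∘ f) xs
sumL-map h f xs = cong sum (sym (map-∘ xs))

sumL-cartesianProduct : ∀ {A B : Set} (h : A × B → ℕ) xs ys →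
  sumL h (cartesianProduct xs ys) ≡ sumL (λ x → sumL (λ y → h (x , y)) ys) xs
sumL-cartesianProduct h []       ys = refl
sumL-cartesianProduct h (x ∷ xs) ys = trans (sumL-++ h (map (x ,_) ys) _)
  (cong₂ _+_ (sumL-map h (x ,_) ys) (sumL-cartesianProduct h xs ys))

sumL-filter : ∀ {A : Set} (h : A → ℕ) (b : A → Bool) xs →
  sumL h (filter (T? ∘ b) xs) ≡ sumL (λ x → if b x then h x else 0) xs
sumL-filter h b []       = refl
sumL-filter h b (x ∷ xs) with b x
... | true  = cong₂ _+_ refl (sumL-filter h b xs)
... | false = sumL-filter h b xs

sumL-allFin² : ∀ {n} (h : Fin n × Fin n → ℕ) →
  sumL h (cartesianProduct (allFin n) (allFin n)) ≡ sumℕ λ i → sumℕ λ j → h (i , j)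
sumL-allFin² {n} h = trans (sumL-cartesianProduct h (allFin n) (allFin n))
  (trans (sumL-tabulate {n = n} _ (λ i → i)) (sumℕ-cong {n} λ i → sumL-tabulate {n = n} (λ j → h (i , j)) (λ j → j)))

sumL-one : ∀ {A : Set} (xs : List A) → sumL (λ _ → 1) xs ≡ length xs
sumL-one []       = refl
sumL-one (x ∷ xs) = cong suc (sumL-one xs)

edgeList : ∀ {n} → Graph n → EdgeSet n → List (Fin n × Fin n)
edgeList {n} G S = filter (T? ∘ uncurry (inE G S)) (cartesianProduct (allFin n) (allFin n))

sumEdges-edgeList : ∀ {n} (G : Graph n) S h → sumEdges G S h ≡ sumL (uncurry h) (edgeList G S)
sumEdges-edgeList {n} G S h = sym (trans
  (sumL-filter (uncurry h) (uncurry (inE G S)) (cartesianProduct (allFin n) (allFin n)))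
  (sumL-allFin² (λ (i , j) → if inE G S i j then h i j else 0)))

-- Lists without repetitions

module _ {A : Set} where

  Unique-resp-↭ : {xs ys : List A} → xs ↭ ys → Unique xs → Unique ys
  Unique-resp-↭ p = Permₛ.Unique-resp-↭ (setoid A) (↭⇒↭ₛ p)

  Unique-++⁻ : ∀ (xs : List A) {ys} → Unique (xs ++ ys) → Unique xs × Unique ys
  Unique-++⁻ []       u        = [] , u
  Unique-++⁻ (x ∷ xs) (x∉ ∷ u) with Unique-++⁻ xs u
  ... | uxs , uys = Allₚ.++⁻ˡ xs x∉ ∷ uxs , uys

  ∈-remove : ∀ as {bs} {x y : A} → y ∈ as ++ x ∷ bs → y ≢ x → y ∈ as ++ bs
  ∈-remove as y∈ y≢x with ∈-++⁻ as y∈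
  ... | inj₁ y∈as         = ∈-++⁺ˡ y∈as
  ... | inj₂ (here y≡x)   = contradiction y≡x y≢x
  ... | inj₂ (there y∈bs) = ∈-++⁺ʳ as y∈bs

  -- `zs` is the complement of `xs` in `ys`; for a tree inside a graph it lists the edges not yet
  -- used.
  Unique-⊆⇒↭ : {xs ys : List A} → Unique xs → xs ⊆ ys → ∃ λ zs → xs ++ zs ↭ ys
  Unique-⊆⇒↭ {[]}     {ys} u        xs⊆ys = ys , ↭-refl
  Unique-⊆⇒↭ {x ∷ xs} {ys} (x∉ ∷ u) xs⊆ys with ∈-∃++ (xs⊆ys (here refl))
  ... | as , bs , refl with Unique-⊆⇒↭ {xs} {as ++ bs} u (λ y∈ → ∈-remove as (xs⊆ys (there y∈))
          (λ y≡x → Uniqueₚ.Unique[x∷xs]⇒x∉xs (x∉ ∷ u) (subst (_∈ xs) y≡x y∈)))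
  ... | zs , p = zs , ↭-trans (↭-prep x p) (↭-sym (shift x as bs))

  Unique-⊆⇒length≤ : {xs ys : List A} → Unique xs → xs ⊆ ys → length xs ≤ length ys
  Unique-⊆⇒length≤ {xs} u xs⊆ys with Unique-⊆⇒↭ u xs⊆ys
  ... | zs , p = subst (length xs ≤_) (trans (sym (length-++ xs)) (↭-length p)) (m≤m+n (length xs) (length zs))

  Unique-⊇⊆⇒↭ : {xs ys : List A} → Unique xs → Unique ys → xs ⊆ ys → ys ⊆ xs → xs ↭ ys
  Unique-⊇⊆⇒↭ {xs} {ys} uxs uys xs⊆ys ys⊆xs with Unique-⊆⇒↭ uxs xs⊆ys
  ... | []     , p = ↭-trans (↭-sym (++-identityʳ xs)) p
  ... | z ∷ zs , p = contradiction (Unique-⊆⇒length≤ uys ys⊆xs) (<⇒≱ (begin-strict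
    length xs                    ≡⟨ +-identityʳ _ ⟨
    length xs + 0                <⟨ +-monoʳ-< (length xs) (s≤s z≤n) ⟩
    length xs + length (z ∷ zs)  ≡⟨ length-++ xs ⟨
    length (xs ++ z ∷ zs)        ≡⟨ ↭-length p ⟩
    length ys                    ∎))
    where open ≤-Reasoning

edgeList-unique : ∀ {n} (G : Graph n) S → Unique (edgeList G S)
edgeList-unique {n} G S = Uniqueₚ.filter⁺ (T? ∘ uncurry (inE G S))
  (Uniqueₚ.cartesianProduct⁺ (Uniqueₚ.allFin⁺ n) (Uniqueₚ.allFin⁺ n))

∈-edgeList⁺ : ∀ {n} (G : Graph n) S {i j} → T (inE G S i j) → (i , j) ∈ edgeList G S
∈-edgeList⁺ G S {i} {j} = ∈-filter⁺ (T? ∘ uncurry (inE G S)) (∈-cartesianProduct⁺ (∈-allFin i) (∈-allFin j))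

∈-edgeList⁻ : ∀ {n} (G : Graph n) S {e} → e ∈ edgeList G S → T (uncurry (inE G S) e)
∈-edgeList⁻ {n} G S e∈ = proj₂ (∈-filter⁻ (T? ∘ uncurry (inE G S)) {xs = cartesianProduct (allFin n) (allFin n)} e∈)

degree-bound : ∀ {n} (G : Graph n) v {us} → Unique us → All (T ∘ adj G v) us → length us ≤ degree G v
degree-bound {n} G v {us} u adjs = subst (length us ≤_) eq
  (Unique-⊆⇒length≤ u λ x∈ → ∈-filter⁺ (T? ∘ adj G v) (∈-allFin _) (All.lookup adjs x∈))
  where
  eq : length (filter (T? ∘ adj G v) (allFin n)) ≡ degree G v
  eq = trans (sym (sumL-one (filter (T? ∘ adj G v) (allFin n))))
    (trans (sumL-filter (λ _ → 1) (adj G v) (allFin n)) (sumL-tabulate {n = n} _ (λ i → i)))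

-- Trees exhausting a connected graph

module _ {n : ℕ} where

  -- Puts the smaller endpoint first, as `inE` does, so that both directions of an edge become the
  -- same list entry.
  norm : Fin n → Fin n → Fin n × Fin n
  norm u v = if toℕ u ℕ.<ᵇ toℕ v then (u , v) else (v , u)

  norm-cases : ∀ u v → (norm u v ≡ (u , v) × T (toℕ u ℕ.<ᵇ toℕ v)) ⊎ (norm u v ≡ (v , u) × ¬ T (toℕ u ℕ.<ᵇ toℕ v))
  norm-cases u v with toℕ u ℕ.<ᵇ toℕ v
  ... | true  = inj₁ (refl , _)
  ... | false = inj₂ (refl , λ ())

  norm-< : ∀ {u v} → T (toℕ u ℕ.<ᵇ toℕ v) → norm u v ≡ (u , v)
  norm-< {u} {v} u<v with norm-cases u v
  ... | inj₁ (eq , _)   = eq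
  ... | inj₂ (_ , u≮v) = contradiction u<v u≮v

  norm-> : ∀ {u v} → T (toℕ u ℕ.<ᵇ toℕ v) → norm v u ≡ (u , v)
  norm-> {u} {v} u<v with norm-cases v u
  ... | inj₁ (_ , v<u) = contradiction (<ᵇ⇒< (toℕ v) (toℕ u) v<u) (<-asym (<ᵇ⇒< (toℕ u) (toℕ v) u<v))
  ... | inj₂ (eq , _)   = eq

  norm-sym : ∀ u v → norm u v ≡ norm v u
  norm-sym u v with <-cmp (toℕ u) (toℕ v)
  ... | tri< u<v _ _ = trans (norm-< (<⇒<ᵇ u<v)) (sym (norm-> (<⇒<ᵇ u<v)))
  ... | tri> _ _ v<u = trans (norm-> (<⇒<ᵇ v<u)) (sym (norm-< (<⇒<ᵇ v<u)))
  ... | tri≈ _ u≡v _ with refl ← Finₚ.toℕ-injective u≡v = refl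

module _ {n : ℕ} (G : Graph n) where

  adj-sym : ∀ {u v} → T (adj G u v) → T (adj G v u)
  adj-sym {u} {v} = subst T (Graph.sym G u v)

  inE⁻ : ∀ S i j → T (inE G S i j) → T (toℕ i ℕ.<ᵇ toℕ j) × T (adj G i j) × T (S i j)
  inE⁻ S i j t with p , q ← Equivalence.to (T-∧ {toℕ i ℕ.<ᵇ toℕ j}) t = p , Equivalence.to (T-∧ {adj G i j}) q

  inE⁺ : ∀ S i j → T (toℕ i ℕ.<ᵇ toℕ j) → T (adj G i j) → T (S i j) → T (inE G S i j)
  inE⁺ S i j p q r = Equivalence.from (T-∧ {toℕ i ℕ.<ᵇ toℕ j}) (p , Equivalence.from (T-∧ {adj G i j}) (q , r))

  adj⇒norm∈ : ∀ {u v} → T (adj G u v) → norm u v ∈ edgeList G allEdges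
  adj⇒norm∈ {u} {v} a with <-cmp (toℕ u) (toℕ v)
  ... | tri< u<v _ _ = subst (_∈ edgeList G allEdges) (sym (norm-< (<⇒<ᵇ u<v)))
    (∈-edgeList⁺ G allEdges (inE⁺ allEdges u v (<⇒<ᵇ u<v) a _))
  ... | tri> _ _ v<u = subst (_∈ edgeList G allEdges) (sym (norm-> (<⇒<ᵇ v<u)))
    (∈-edgeList⁺ G allEdges (inE⁺ allEdges v u (<⇒<ᵇ v<u) (adj-sym a) _))
  ... | tri≈ _ u≡v _ with refl ← Finₚ.toℕ-injective u≡v = ⊥-elim (subst T (irr G u) a)

  inE⇒norm : ∀ S i j → T (inE G S i j) → norm i j ≡ (i , j) × norm j i ≡ (i , j)
  inE⇒norm S i j t with i<j , _ ← inE⁻ S i j t = norm-< i<j , norm-> i<j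

  norm∈⇒adjSub : ∀ S u v → norm u v ∈ edgeList G S → adjSub G S u v
  norm∈⇒adjSub S u v e∈ with norm-cases u v | ∈-edgeList⁻ G S e∈
  ... | inj₁ (eq , _) | t = Equivalence.from (T-∨ {inE G S u v}) (inj₁ (subst (T ∘ uncurry (inE G S)) eq t))
  ... | inj₂ (eq , _) | t = Equivalence.from (T-∨ {inE G S u v}) (inj₂ (subst (T ∘ uncurry (inE G S)) eq t))

  adjSub⇒norm∈ : ∀ S u v → adjSub G S u v → norm u v ∈ edgeList G S
  adjSub⇒norm∈ S u v a with Equivalence.to (T-∨ {inE G S u v}) a
  ... | inj₁ t = subst (_∈ edgeList G S) (sym (proj₁ (inE⇒norm S _ _ t))) (∈-edgeList⁺ G S t)
  ... | inj₂ t = subst (_∈ edgeList G S) (sym (proj₂ (inE⇒norm S _ _ t))) (∈-edgeList⁺ G S t)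

  adjSub-sym : ∀ S u v → adjSub G S u v → adjSub G S v u
  adjSub-sym S u v a = Equivalence.from (T-∨ {inE G S v u}) ([ inj₂ , inj₁ ]′ (Equivalence.to (T-∨ {inE G S u v}) a))

-- A rooted tree of G-edges at v in first-child/next-sibling form: br u e S R
-- hangs the subtree S from the edge vu and leaves the further branches R at v.
data Tree {n : ℕ} (G : Graph n) (v : Fin n) : Set where
  leaf : Tree G v
  br   : (u : Fin n) → T (adj G v u) → Tree G u → Tree G v → Tree G v

module _ {n : ℕ} {G : Graph n} where

  es : ∀ {v} → Tree G v → List (Fin n × Fin n)
  es         leaf         = []
  es {v = v} (br u _ S R) = norm v u ∷ es S ++ es R

  -- The chain of branches at each copy of a vertex ends in exactly one `leaf`, so listing at leaves
  -- alone lists every copy once. A vertex of the graph may have several copies.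
  vs : ∀ {v} → Tree G v → List (Fin n)
  vs {v = v} leaf         = [ v ]
  vs         (br u _ S R) = vs S ++ vs R

  size : ∀ {v} → Tree G v → ℕ
  size leaf         = 0
  size (br _ _ S R) = suc (size S + size R)

  length-es : ∀ {v} (t : Tree G v) → length (es t) ≡ size t
  length-es leaf         = refl
  length-es (br u _ S R) = cong suc (trans (length-++ (es S)) (cong₂ _+_ (length-es S) (length-es R)))

  length-vs : ∀ {v} (t : Tree G v) → length (vs t) ≡ suc (size t)
  length-vs leaf         = refl
  length-vs (br u _ S R) = trans (length-++ (vs S))
    (trans (cong₂ _+_ (length-vs S) (length-vs R)) (cong suc (+-suc (size S) (size R))))

  root∈vs : ∀ {v} (t : Tree G v) → v ∈ vs t
  root∈vs leaf         = here refl
  root∈vs (br u _ S R) = ∈-++⁺ʳ (vs S) (root∈vs R)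

  es⊆E : ∀ {v} (t : Tree G v) → es t ⊆ edgeList G allEdges
  es⊆E (br u a S R) (here refl) = adj⇒norm∈ G a
  es⊆E (br u a S R) (there e∈)  = [ es⊆E S , es⊆E R ]′ (∈-++⁻ (es S) e∈)

  es-endpoints : ∀ {v} (t : Tree G v) {i j} → (i , j) ∈ es t → i ∈ vs t × j ∈ vs t
  es-endpoints {v} (br u a S R) (here eq) with norm-cases v u
  ... | inj₁ (eq′ , _) with refl ← trans eq eq′ = ∈-++⁺ʳ (vs S) (root∈vs R) , ∈-++⁺ˡ (root∈vs S)
  ... | inj₂ (eq′ , _) with refl ← trans eq eq′ = ∈-++⁺ˡ (root∈vs S) , ∈-++⁺ʳ (vs S) (root∈vs R)
  es-endpoints (br u a S R) (there e∈) with ∈-++⁻ (es S) e∈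
  ... | inj₁ p with i∈ , j∈ ← es-endpoints S p = ∈-++⁺ˡ i∈ , ∈-++⁺ˡ j∈
  ... | inj₂ p with i∈ , j∈ ← es-endpoints R p = ∈-++⁺ʳ (vs S) i∈ , ∈-++⁺ʳ (vs S) j∈

  norm-endpoints : ∀ {v} (t : Tree G v) {x y} → norm x y ∈ es t → x ∈ vs t × y ∈ vs t
  norm-endpoints t {x} {y} e∈ with norm-cases x y
  ... | inj₁ (eq , _) = es-endpoints t (subst (_∈ es t) eq e∈)
  ... | inj₂ (eq , _) with p , q ← es-endpoints t (subst (_∈ es t) eq e∈) = q , p

  star-to-root : ∀ S {v} (t : Tree G v) → es t ⊆ edgeList G S → ∀ {x} → x ∈ vs t → Star (adjSub G S) x v
  star-to-root S leaf         sub (here refl) = ε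
  star-to-root S {v} (br u a S₁ R) sub x∈ with ∈-++⁻ (vs S₁) x∈
  ... | inj₁ p = star-to-root S S₁ (sub ∘ there ∘ ∈-++⁺ˡ) p
                 ◅◅ adjSub-sym G S v u (norm∈⇒adjSub G S v u (sub (here refl))) ◅ ε
  ... | inj₂ p = star-to-root S R (sub ∘ there ∘ ∈-++⁺ʳ (es S₁)) p

  edgeSet : ∀ {v} → Tree G v → EdgeSet n
  edgeSet t i j = isYes (member? (≡-dec Finₚ._≟_ Finₚ._≟_) (i , j) (es t))

  edgeList-edgeSet : ∀ {v} (t : Tree G v) → Unique (es t) → edgeList G (edgeSet t) ↭ es t
  edgeList-edgeSet t u = Unique-⊇⊆⇒↭ (edgeList-unique G (edgeSet t)) u
    (λ {(i , j)} e∈ → toWitness (proj₂ (proj₂ (inE⁻ G (edgeSet t) i j (∈-edgeList⁻ G (edgeSet t) e∈)))))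
    (λ {(i , j)} e∈ → ∈-edgeList⁺ G (edgeSet t)
      (let i<j , a , _ = inE⁻ G allEdges i j (∈-edgeList⁻ G allEdges (es⊆E t e∈)) in inE⁺ G (edgeSet t) i j i<j a
          (fromWitness e∈)))

  edgeSet-connected : ∀ {v} (t : Tree G v) → Unique (es t) → ConnectedSub G (edgeSet t)
  edgeSet-connected t u x y x∈ y∈ = toRoot x∈ ◅◅ reverse (λ {u} {v} → adjSub-sym G (edgeSet t) u v) (toRoot y∈)
    where
    es↭ = edgeList-edgeSet t u
    toRoot : ∀ {x} → inVSub G (edgeSet t) x → Star (adjSub G (edgeSet t)) x _
    toRoot {x} (y , a) = star-to-root (edgeSet t) t (∈-resp-↭ (↭-sym es↭))
      (proj₂ (norm-endpoints t (∈-resp-↭ es↭ (adjSub⇒norm∈ G (edgeSet t) y x a))))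

  sumEdges-edgeSet : ∀ {v} (t : Tree G v) → Unique (es t) → ∀ h → sumEdges G (edgeSet t) h ≡ sumL (uncurry h) (es t)
  sumEdges-edgeSet t u h = trans (sumEdges-edgeList G (edgeSet t) h) (sumL-↭ (uncurry h) (edgeList-edgeSet t u))

  numEdges-edgeSet : ∀ {v} (t : Tree G v) → Unique (es t) → numEdgesSub G (edgeSet t) ≡ size t
  numEdges-edgeSet t u = trans (sumEdges-edgeSet t u (λ _ _ → 1)) (trans (sumL-one (es t)) (length-es t))

negs : ∀ {n} → Weighing n → List (Fin n × Fin n) → ℕ
negs w = sumL (λ (i , j) → negBit (w i j))

LocalPositive⇒negs : ∀ {n k} {G : Graph n} {w} → LocalPositive k G w →
  ∀ {v} (t : Tree G v) → Unique (es t) → size t ≡ k → 2 * negs w (es t) < k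
LocalPositive⇒negs {G = G} {w} lp t u refl = subst₂ _<_
  (cong (2 *_) (sumEdges-edgeSet t u (λ i j → negBit (w i j)))) (numEdges-edgeSet t u)
  (weightSub-pos⇒ G w (edgeSet t) (lp (edgeSet t) (numEdges-edgeSet t u) (edgeSet-connected t u)))

module _ {n : ℕ} {G : Graph n} where

  -- Nothing forbids that `y` already occurs in `t`: the new edge then leads to a fresh copy of `y`.
  -- This is how cycles are opened without losing an edge.
  insert : ∀ {v} (t : Tree G v) {x y} → x ∈ vs t → T (adj G x y) →
    ∃ λ (t′ : Tree G v) → es t′ ↭ norm x y ∷ es t
  insert leaf         {y = y} (here refl) a = br y a leaf leaf , ↭-refl
  insert {v} (br u e S R) {x} {y} x∈ a with ∈-++⁻ (vs S) x∈
  ... | inj₁ p with S′ , S′↭ ← insert S p a = br u e S′ R ,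
    ↭-trans (↭-prep (norm v u) (++⁺ʳ (es R) S′↭)) (↭-swap (norm v u) (norm x y) ↭-refl)
  ... | inj₂ p with R′ , R′↭ ← insert R p a = br u e S R′ ,
    ↭-trans (↭-prep (norm v u) (↭-trans (++⁺ˡ (es S) R′↭) (shift (norm x y) (es S) (es R))))
        (↭-swap (norm v u) (norm x y) ↭-refl)

  boundary : ∀ {v} (t : Tree G v) {M} → es t ++ M ↭ edgeList G allEdges → ∀ {i j} → (i , j) ∈ M →
    ∀ {x} → x ∈ vs t → Star (λ x y → T (adj G x y)) x i → ∃₂ λ x y → x ∈ vs t × T (adj G x y) × norm x y ∈ M
  boundary t {M} p {i} {j} ij∈M x∈ ε = i , j , x∈ , proj₁ (proj₂ (inE⁻ G allEdges i j ij)) , subst (_∈ M)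
      (sym (proj₁ (inE⇒norm G allEdges i j ij))) ij∈M
    where ij = ∈-edgeList⁻ G allEdges (∈-resp-↭ p (∈-++⁺ʳ (es t) ij∈M))
  boundary t p ij∈M {x} x∈ (_◅_ {j = y} a path) with ∈-++⁻ (es t) (∈-resp-↭ (↭-sym p) (adj⇒norm∈ G a))
  ... | inj₁ xy∈t = boundary t p ij∈M (proj₂ (norm-endpoints t xy∈t)) path
  ... | inj₂ xy∈M = x , y , x∈ , a , xy∈M

  grow : Connected G → ∀ d {v} (t : Tree G v) → Unique (es t) → size t + d ≤ numEdges G →
    ∃₂ λ (t′ : Tree G v) D → Unique (es t′) × length D ≡ d × es t′ ↭ D ++ es t
  grow conn zero    t u le = t , [] , u , refl , ↭-refl
  grow conn (suc d) {v} t u le with Unique-⊆⇒↭ u (es⊆E t)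
  ... | [] , p = contradiction le (<⇒≱ (begin-strict
    numEdges G                        ≡⟨ sumEdges-edgeList G allEdges _ ⟩
    sumL _ (edgeList G allEdges)      ≡⟨ sumL-one (edgeList G allEdges) ⟩
    length (edgeList G allEdges)      ≡⟨ ↭-length p ⟨
    length (es t ++ [])               ≡⟨ ↭-length (++-identityʳ (es t)) ⟩
    length (es t)                     ≡⟨ length-es t ⟩
    size t                            <⟨ m<m+n (size t) (s≤s z≤n) ⟩
    size t + suc d                    ∎))
    where open ≤-Reasoning
  ... | M@((i , j) ∷ _) , p with boundary t p (here refl) (root∈vs t) (conn v i)
  ... | x , y , x∈ , a , xy∈M with insert t x∈ a
  ... | t′ , t′↭ = finish (grow conn d t′ u′ (subst (_≤ numEdges G) eq le))
    where
    u′ : Unique (es t′)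
    u′ = Unique-resp-↭ (↭-sym t′↭) (Allₚ.¬Any⇒All¬ (es t) (λ xy∈t → Uniqueₚ-++ xy∈t xy∈M) ∷ u)
      where
      disjoint : ∀ {x} xs {ys : List (Fin n × Fin n)} → Unique (xs ++ ys) → x ∈ xs → x ∈ ys → ⊥
      disjoint (x ∷ xs) (x∉ ∷ _) (here refl) x∈ys = Allₚ.All¬⇒¬Any x∉ (∈-++⁺ʳ xs x∈ys)
      disjoint (x ∷ xs) (_ ∷ u)  (there x∈)  x∈ys = disjoint xs u x∈ x∈ys
      Uniqueₚ-++ = disjoint (es t) (Unique-resp-↭ (↭-sym p) (edgeList-unique G allEdges))
    eq : size t + suc d ≡ size t′ + d
    eq = begin
      size t + suc d            ≡⟨ +-suc (size t) d ⟩
      suc (size t) + d          ≡⟨ cong (λ l → suc l + d) (length-es t) ⟨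
      length (norm x y ∷ es t) + d ≡⟨ cong (_+ d) (↭-length t′↭) ⟨
      length (es t′) + d        ≡⟨ cong (_+ d) (length-es t′) ⟩
      size t′ + d               ∎
      where open ≡-Reasoning
    finish : (∃₂ λ (t″ : Tree G v) D → Unique (es t″) × length D ≡ d × es t″ ↭ D ++ es t′) →
      ∃₂ λ (t″ : Tree G v) D → Unique (es t″) × length D ≡ suc d × es t″ ↭ D ++ es t
    finish (t″ , D , u″ , refl , q) = t″ , norm x y ∷ D , u″ , refl ,
      ↭-trans q (↭-trans (++⁺ˡ D t′↭) (shift (norm x y) D (es t)))

  -- Growing a single vertex by all `numEdges G` edges leaves none over, and by connectedness every
  -- vertex then has a copy in the tree. The last component turns many vertices into many edges.
  spanning : Connected G → ∀ (v : Fin n) → ∃ λ (t : Tree G v) →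
    Unique (es t) × es t ↭ edgeList G allEdges × n ≤ suc (size t)
  spanning conn v with grow conn (numEdges G) (leaf {v = v}) [] ≤-refl
  ... | t , D , u , len , p = t , u , covers , subst (n ≤_) (length-vs t)
        (subst (_≤ length (vs t)) (length-tabulate {n = n} id)
          (Unique-⊆⇒length≤ (Uniqueₚ.allFin⁺ n) (λ {x} _ → reach (root∈vs t) (conn v x))))
    where
    covers : es t ↭ edgeList G allEdges
    covers with Unique-⊆⇒↭ u (es⊆E t)
    ... | []    , q = ↭-trans (↭-sym (++-identityʳ (es t))) q
    ... | z ∷ M , q = contradiction (begin-strict
      length (es t)                  <⟨ m<m+n (length (es t)) (s≤s z≤n) ⟩
      length (es t) + length (z ∷ M) ≡⟨ length-++ (es t) ⟨
      length (es t ++ z ∷ M)         ≡⟨ ↭-length q ⟩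
      length (edgeList G allEdges)   ≡⟨ sumL-one (edgeList G allEdges) ⟨
      sumL _ (edgeList G allEdges)   ≡⟨ sumEdges-edgeList G allEdges _ ⟨
      numEdges G                     ≡⟨ len ⟨
      length D                       ≡⟨ ↭-length (++-identityʳ D) ⟨
      length (D ++ [])               ≡⟨ ↭-length p ⟨
      length (es t)                  ∎) (<-irrefl refl)
      where open ≤-Reasoning
    reach : ∀ {x y} → x ∈ vs t → Star (λ x y → T (adj G x y)) x y → y ∈ vs t
    reach x∈ ε          = x∈
    reach x∈ (a ◅ path) = reach (proj₂ (norm-endpoints t (∈-resp-↭ (↭-sym covers) (adj⇒norm∈ G a)))) path

-- Cutting trees

module _ {A : Set} where

  ↭-cut-child : ∀ {x : A} {S P S′} R → S ↭ P ++ S′ → x ∷ S ++ R ↭ P ++ x ∷ S′ ++ R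
  ↭-cut-child {x} {S} {P} {S′} R p = ↭-trans
    (↭-prep x (↭-trans (++⁺ʳ R p) (↭-reflexive (++-assoc P S′ R))))
    (↭-sym (shift x P (S′ ++ R)))

  ↭-cut-sibling : ∀ {x : A} S {R P R′} → R ↭ P ++ R′ → x ∷ S ++ R ↭ P ++ x ∷ S ++ R′
  ↭-cut-sibling {x} S {R} {P} {R′} p = ↭-trans
    (↭-prep x (↭-trans (++⁺ˡ S p) (shifts S P)))
    (↭-sym (shift x P (S ++ R′)))

  ↭-cut-branch : ∀ {x : A} S R → x ∷ S ++ R ↭ (x ∷ S ++ []) ++ R
  ↭-cut-branch {x} S R = ↭-prep x (++⁺ʳ R (↭-sym (++-identityʳ S)))

module _ {n : ℕ} {G : Graph n} where

  size-↭ : ∀ {v} (t : Tree G v) {xs ys} → es t ↭ xs ++ ys → size t ≡ length xs + length ys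
  size-↭ t {xs} {ys} p = trans (sym (length-es t)) (trans (↭-length p) (length-++ xs))

  size-split : ∀ {u v x} (t : Tree G v) (p : Tree G u) (r : Tree G x) → es t ↭ es p ++ es r → size t ≡ size p + size r
  size-split t p r eq = trans (size-↭ t {es p} {es r} eq) (cong₂ _+_ (length-es p) (length-es r))

  Unique-split : ∀ {u v x} (t : Tree G v) (p : Tree G u) (r : Tree G x) → es t ↭ es p ++ es r →
    Unique (es t) → Unique (es p) × Unique (es r)
  Unique-split t p r eq u = Unique-++⁻ (es p) (Unique-resp-↭ eq u)

  -- Any initial part of the order "edge, its subtree, further branches" still hangs together at the
  -- root: if the subtree alone exhausts `k`, the further branches are dropped, otherwise the
  -- subtree is kept whole.
  prune : ∀ {v} (t : Tree G v) k → k ≤ size t → ∃₂ λ (t′ : Tree G v) D → size t′ ≡ k × es t ↭ es t′ ++ D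
  prune t             zero    _  = leaf , es t , refl , ↭-refl
  prune (br u e S R) (suc k) (s≤s le) with k ≤? size S
  ... | yes k≤S with S′ , D , refl , p ← prune S k k≤S =
    br u e S′ leaf , D ++ es R , cong suc (+-identityʳ _) , ↭-prep _ (begin
      es S ++ es R              ↭⟨ ++⁺ʳ (es R) p ⟩
      (es S′ ++ D) ++ es R      ≡⟨ ++-assoc (es S′) D (es R) ⟩
      es S′ ++ D ++ es R        ↭⟨ ++⁺ʳ (D ++ es R) (++-identityʳ (es S′)) ⟨
      (es S′ ++ []) ++ D ++ es R ∎)
    where open PermutationReasoning
  ... | no k≰S with R′ , D , eq , p ← prune R (k ∸ size S) (m≤n+o⇒m∸n≤o k (size S) le) =
    br u e S R′ , D , cong suc (trans (cong (λ z → size S + z) eq) (m+[n∸m]≡n (≰⇒≥ k≰S))) ,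
    ↭-prep _ (↭-trans (++⁺ˡ (es S) p) (↭-reflexive (sym (++-assoc (es S) (es R′) D))))

  -- Cutting at a lowest vertex above at least s edges: every branch there has at most s edges, so one branch
  -- of exactly s edges or several of fewer edges each make up the piece.
  peel : ∀ s {v} (t : Tree G v) → suc s ≤ size t →
    ∃ λ u → ∃₂ λ (p : Tree G u) (r : Tree G v) →
      es t ↭ es p ++ es r × suc s ≤ size p × size p ≤ suc s ⊔ (s + s)
  peel s {v} t@(br u e S R) le with suc s ≤? size S
  ... | yes s≤S with x , p , S′ , eq , bounds ← peel s S s≤S =
    x , p , br u e S′ R , ↭-cut-child (es R) eq , bounds
  ... | no s≰S with suc s ≤? suc (size S)
  ... | yes s≤1+S = v , br u e S leaf , R , ↭-cut-branch (es S) (es R) ,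
    subst (suc s ≤_) (cong suc (sym (+-identityʳ (size S)))) s≤1+S ,
    ≤-trans (≤-reflexive (cong suc (+-identityʳ (size S)))) (≤-trans (≰⇒> s≰S) (m≤m⊔n (suc s) (s + s)))
  ... | no s≰1+S with suc s ≤? size R
  ... | yes s≤R with x , p , R′ , eq , bounds ← peel s R s≤R =
    x , p , br u e S R′ , ↭-cut-sibling (es S) eq , bounds
  ... | no s≰R = v , t , leaf , ↭-sym (++-identityʳ (es t)) , le ,
    ≤-trans (+-mono-≤ (≤-pred (≰⇒> s≰1+S)) (≤-pred (≰⇒> s≰R))) (m≤n⊔m (suc s) (s + s))

negs≤length : ∀ {n} (w : Weighing n) xs → negs w xs ≤ length xs
negs≤length w []             = z≤n
negs≤length w ((i , j) ∷ xs) = +-mono-≤ (bit (w i j)) (negs≤length w xs)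
  where
  bit : ∀ s → negBit s ≤ 1
  bit Sign.- = s≤s z≤n
  bit Sign.+ = z≤n

module _ {n : ℕ} {G : Graph n} (w : Weighing n) where

  negs-split : ∀ {v} (t : Tree G v) xs {ys} → es t ↭ xs ++ ys → negs w (es t) ≡ negs w xs + negs w ys
  negs-split t xs {ys} p = trans (sumL-↭ _ p) (sumL-++ _ xs ys)

  negs≤r : ∀ {k r} → LocalPositive k G w → k ≤ 2 * suc r →
    ∀ {v} (t : Tree G v) → Unique (es t) → size t ≡ k → negs w (es t) ≤ r
  negs≤r lp k≤2r+2 t u eq = ≤-pred (*-cancelˡ-< 2 _ _ (<-≤-trans (LocalPositive⇒negs lp t u eq) k≤2r+2))

  piece-bound : Connected G → ∀ {k r} → LocalPositive k G w → k ≤ 2 * suc r → k ≤ numEdges G →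
    ∀ {v} (t : Tree G v) → Unique (es t) → negs w (es t) ≤ r + (size t ∸ k)
  piece-bound conn {k} {r} lp k≤2r+2 k≤E t u with ≤-total (size t) k
  ... | inj₁ t≤k with t′ , D , u′ , len , p ← grow conn (k ∸ size t) t u (subst (_≤ numEdges G) (sym (m+[n∸m]≡n t≤k)) k≤E) = begin
    negs w (es t)                 ≤⟨ m≤n+m _ (negs w D) ⟩
    negs w D + negs w (es t)      ≡⟨ negs-split t′ D p ⟨
    negs w (es t′)
      ≤⟨ negs≤r lp k≤2r+2 t′ u′ (trans (size-↭ t′ {D} {es t} p) (trans (cong₂ _+_ len (length-es t)) (m∸n+n≡m t≤k))) ⟩
    r                             ≤⟨ m≤m+n r _ ⟩
    r + (size t ∸ k)              ∎
    where
    open ≤-Reasoning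
  ... | inj₂ k≤t with t′ , D , refl , p ← prune t k k≤t = begin
    negs w (es t)                 ≡⟨ negs-split t (es t′) p ⟩
    negs w (es t′) + negs w D
      ≤⟨ +-mono-≤ (negs≤r lp k≤2r+2 t′ (proj₁ (Unique-++⁻ (es t′) (Unique-resp-↭ p u))) refl) (negs≤length w D) ⟩
    r + length D                  ≡⟨ cong (λ z → r + z) (m+n∸m≡n (size t′) (length D)) ⟨
    r + (size t′ + length D ∸ size t′)
      ≡⟨ cong (λ x → r + (x ∸ size t′)) (trans (size-↭ t {es t′} p) (cong (_+ length D) (length-es t′))) ⟨
    r + (size t ∸ size t′)        ∎
    where open ≤-Reasoning

-- Bounds from pieces

module _ {n : ℕ} {G : Graph n} (w : Weighing n) where

  -- The remainder of a cut is not a subterm of the tree, so repeated peeling recurses on a bound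
  -- for the size; this lemma lowers that bound.
  cut-length : ∀ {u v} (t : Tree G v) (p : Tree G u) (r : Tree G v) {s m} → es t ↭ es p ++ es r →
    suc s ≤ size p → size t ≤ suc m → size r ≤ m
  cut-length t p r {s} eq s<p t≤m = ≤-pred (≤-trans (≤-trans (+-monoˡ-≤ (size r) (≤-trans (s≤s z≤n) s<p))
    (≤-reflexive (sym (size-split t p r eq)))) t≤m)

  -- Every peeled piece obeys the ratio `C / A`. Only the last remainder can violate it, and having
  -- at most `s` edges it costs at most `A * s`.
  ratio-bound : ∀ {β : ℕ → ℕ} → (∀ {v} (t : Tree G v) → Unique (es t) → negs w (es t) ≤ β (size t)) →
    ∀ s A C → (∀ j → suc s ≤ j → j ≤ suc s ⊔ (s + s) → A * β j ≤ C * j) →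
    ∀ {v} (t : Tree G v) → Unique (es t) → A * negs w (es t) ≤ C * size t + A * s
  ratio-bound {β} bound s A C piece t = go (size t) t ≤-refl
    where
    open ≤-Reasoning
    go : ∀ m {v} (t : Tree G v) → size t ≤ m → Unique (es t) → A * negs w (es t) ≤ C * size t + A * s
    go m t t≤m u with suc s ≤? size t
    ... | no s≰t = begin
      A * negs w (es t)
        ≤⟨ *-monoʳ-≤ A (≤-trans (negs≤length w (es t)) (≤-trans (≤-reflexive (length-es t)) (≤-pred (≰⇒> s≰t)))) ⟩
      A * s                 ≤⟨ m≤n+m (A * s) _ ⟩
      C * size t + A * s    ∎
    go zero    t t≤m u | yes s≤t = contradiction (≤-trans s≤t t≤m) λ ()
    go (suc m) t t≤m u | yes s≤t with x , p , r , eq , s≤p , p≤ ← peel s t s≤t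
      with up , ur ← Unique-split t p r eq u = begin
      A * negs w (es t)                           ≡⟨ cong (A *_) (negs-split w t (es p) eq) ⟩
      A * (negs w (es p) + negs w (es r))         ≡⟨ *-distribˡ-+ A (negs w (es p)) _ ⟩
      A * negs w (es p) + A * negs w (es r)
        ≤⟨ +-mono-≤ (≤-trans (*-monoʳ-≤ A (bound p up)) (piece (size p) s≤p p≤)) (go m r (cut-length t p r eq s≤p t≤m) ur) ⟩
      C * size p + (C * size r + A * s)           ≡⟨ +-assoc (C * size p) _ _ ⟨
      C * size p + C * size r + A * s             ≡⟨ cong (_+ A * s) (*-distribˡ-+ C (size p) (size r)) ⟨
      C * (size p + size r) + A * s               ≡⟨ cong (λ x → C * x + A * s) (size-split t p r eq) ⟨
      C * size t + A * s                          ∎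

  -- c is the allowed deficit: 0 for forcing, 1 for a lower bound of -1.
  Balanced : ℕ → ∀ {v} → Tree G v → Set
  Balanced c t = 2 * negs w (es t) ≤ size t + c

  balanced-join : ∀ {c u v} (t : Tree G v) (p : Tree G u) (r : Tree G v) → es t ↭ es p ++ es r →
    Balanced 0 p → Balanced c r → Balanced c t
  balanced-join {c} t p r eq p-bal r-bal = begin
    2 * negs w (es t)                      ≡⟨ cong (2 *_) (negs-split w t (es p) eq) ⟩
    2 * (negs w (es p) + negs w (es r))    ≡⟨ *-distribˡ-+ 2 (negs w (es p)) _ ⟩
    2 * negs w (es p) + 2 * negs w (es r)  ≤⟨ +-mono-≤ p-bal r-bal ⟩
    (size p + 0) + (size r + c)            ≡⟨ cong (_+ (size r + c)) (+-identityʳ (size p)) ⟩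
    size p + (size r + c)                  ≡⟨ +-assoc (size p) _ _ ⟨
    size p + size r + c                    ≡⟨ cong (_+ c) (size-split t p r eq) ⟨
    size t + c                             ∎
    where open ≤-Reasoning

  module _ {β : ℕ → ℕ} (bound : ∀ {v} (t : Tree G v) → Unique (es t) → negs w (es t) ≤ β (size t)) where

    balanced-peel : ∀ s c {v} (t : Tree G v) → Unique (es t) → suc s ≤ size t →
      (∀ {j} → j < suc (suc s ⊔ (s + s)) → suc s ≤ j → 2 * (β j + β (size t ∸ j)) ≤ size t + c) → Balanced c t
    balanced-peel s c t u s≤t table with x , p , r , eq , s≤p , p≤ ← peel s t s≤t
      with up , ur ← Unique-split t p r eq u = begin
      2 * negs w (es t)                      ≡⟨ cong (2 *_) (negs-split w t (es p) eq) ⟩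
      2 * (negs w (es p) + negs w (es r))    ≤⟨ *-monoʳ-≤ 2 (+-mono-≤ (bound p up) (bound r ur)) ⟩
      2 * (β (size p) + β (size r))
        ≡⟨ cong (λ x → 2 * (β (size p) + β x)) (trans (cong (_∸ size p) (size-split t p r eq)) (m+n∸m≡n (size p) (size r))) ⟨
      2 * (β (size p) + β (size t ∸ size p)) ≤⟨ table (s≤s p≤) s≤p ⟩
      size t + c                             ∎
      where open ≤-Reasoning

    -- A remainder with fewer than `lo` edges may be out of balance. Peeling therefore goes on only
    -- while there are at least `top` edges, which leaves at least `lo`; the sizes from `lo` up to
    -- `top` are left to `base`. Peeled pieces have deficit 0, so the deficit `c` is spent only
    -- once.
    balanced-large : ∀ s lo top c → lo + (suc s ⊔ (s + s)) ≤ top →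
      (∀ {j} → j < suc (suc s ⊔ (s + s)) → suc s ≤ j → 2 * β j ≤ j) → suc s ≤ top →
      (∀ {v} (t : Tree G v) → Unique (es t) → lo ≤ size t → size t < top → Balanced c t) →
      ∀ {v} (t : Tree G v) → Unique (es t) → lo ≤ size t → Balanced c t
    balanced-large s lo top c top≥ piece s≤top base t = go (size t) t ≤-refl
      where
      go : ∀ m {v} (t : Tree G v) → size t ≤ m → Unique (es t) → lo ≤ size t → Balanced c t
      go m t t≤m u lo≤t with suc (size t) ≤? top
      ... | yes t<top = base t u lo≤t t<top
      go zero    t t≤m u lo≤t | no t≮top = contradiction (≤-trans s≤top (≤-trans (≤-pred (≰⇒> t≮top)) t≤m)) λ ()
      go (suc m) t t≤m u lo≤t | no t≮top
        with x , p , r , eq , s≤p , p≤ ← peel s t (≤-trans s≤top (≤-pred (≰⇒> t≮top)))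
        with up , ur ← Unique-split t p r eq u
        = balanced-join t p r eq
          (≤-trans (*-monoʳ-≤ 2 (bound p up)) (≤-trans (piece (s≤s p≤) s≤p) (m≤m+n (size p) 0)))
          (go m r (cut-length t p r eq s≤p t≤m) ur lo≤r)
        where
        open ≤-Reasoning
        lo≤r : lo ≤ size r
        lo≤r = +-cancelʳ-≤ (size p) lo (size r) (begin
          lo + size p                ≤⟨ +-monoʳ-≤ lo p≤ ⟩
          lo + (suc s ⊔ (s + s))     ≤⟨ top≥ ⟩
          top                        ≤⟨ ≤-pred (≰⇒> t≮top) ⟩
          size t                     ≡⟨ size-split t p r eq ⟩
          size p + size r            ≡⟨ +-comm (size p) (size r) ⟩
          size r + size p            ∎)

-- Finite tables for small `k`

excess : ℕ → ℕ → ℕ → ℕ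
excess r k j = r + (j ∸ k)

PieceTable : ℕ → ℕ → ℕ → Set
PieceTable r k s = ∀ {j} → j < suc (suc s ⊔ (s + s)) → suc s ≤ j → 2 * excess r k j ≤ j

-- Beyond `k` edges, `excess` counts every further edge as negative. Where this is too much, one
-- more cut, now with threshold `s`, bounds both parts afresh; the second alternative tests all
-- sizes that the cut-off part can have.
BaseEntry : ℕ → ℕ → ℕ → ℕ → ℕ → Set
BaseEntry r k s c q = 2 * excess r k q ≤ q + c ⊎
  suc s ≤ q × (∀ {j} → j < suc (suc s ⊔ (s + s)) → suc s ≤ j → 2 * (excess r k j + excess r k (q ∸ j)) ≤ q + c)

BaseTable : ℕ → ℕ → ℕ → ℕ → ℕ → ℕ → Set
BaseTable r k s c lo top = ∀ {q} → q < top → lo ≤ q → BaseEntry r k s c q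

pieceTable? : ∀ r k s → Dec (PieceTable r k s)
pieceTable? r k s = allUpTo? (λ j → (suc s ≤? j) →-dec (2 * excess r k j ≤? j)) _

baseTable? : ∀ r k s c lo top → Dec (BaseTable r k s c lo top)
baseTable? r k s c lo top = allUpTo? (λ q → (lo ≤? q) →-dec ((2 * excess r k q ≤? q + c) ⊎-dec
  ((suc s ≤? q) ×-dec allUpTo? (λ j → (suc s ≤? j) →-dec (2 * (excess r k j + excess r k (q ∸ j)) ≤? q + c)) _))) top

module _ {n : ℕ} {G : Graph n} (w : Weighing n) where

  balanced-base : ∀ r k s c → (∀ {v} (t : Tree G v) → Unique (es t) → negs w (es t) ≤ excess r k (size t)) →
    ∀ {v} (t : Tree G v) → Unique (es t) → BaseEntry r k s c (size t) → Balanced w c t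
  balanced-base r k s c bound t u (inj₁ le)            = ≤-trans (*-monoʳ-≤ 2 (bound t u)) le
  balanced-base r k s c bound t u (inj₂ (s≤t , table)) = balanced-peel w {excess r k} bound s c t u s≤t table

  -- Balance in all sizes from `lo` on is reduced to two finite tables, which are decided by
  -- evaluation once the numbers are given. `s` is the threshold for peeling large trees, `s₀` the
  -- one for the extra cut of a remainder.
  balanced : ∀ r k s s₀ c lo → let top = lo + (suc s ⊔ (s + s)) in
    True (pieceTable? r k s) → True (baseTable? r k s₀ c lo top) →
    Connected G → LocalPositive k G w → k ≤ 2 * suc r → k ≤ numEdges G →
    ∀ {v} (t : Tree G v) → Unique (es t) → lo ≤ size t → Balanced w c t
  balanced r k s s₀ c lo pieces base conn lp k≤ k≤E =
    balanced-large w {excess r k} bound s lo _ c ≤-refl (toWitness pieces) (≤-trans (m≤m⊔n (suc s) (s + s)) (m≤n+m _ lo))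
      λ t u lo≤t t<top → balanced-base r k s₀ c bound t u (toWitness base t<top lo≤t)
    where
    bound : ∀ {v} (t : Tree G v) → Unique (es t) → negs w (es t) ≤ excess r k (size t)
    bound = piece-bound w conn lp k≤ k≤E

-- Bounded degree

module _ {n : ℕ} {G : Graph n} where

  kids : ∀ {v} → Tree G v → List (Fin n)
  kids leaf         = []
  kids (br u _ _ R) = u ∷ kids R

  kids-adj : ∀ {v} (t : Tree G v) → All (T ∘ adj G v) (kids t)
  kids-adj leaf         = []
  kids-adj (br _ e _ R) = e ∷ kids-adj R

  ∈-kids⇒∈-es : ∀ {v x} (t : Tree G v) → x ∈ kids t → norm v x ∈ es t
  ∈-kids⇒∈-es (br u _ S R) (here refl) = here refl
  ∈-kids⇒∈-es (br u _ S R) (there x∈)  = there (∈-++⁺ʳ (es S) (∈-kids⇒∈-es R x∈))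

  kids-unique : ∀ {v} (t : Tree G v) → Unique (es t) → Unique (kids t)
  kids-unique leaf         u        = []
  kids-unique {v} (br x e S R) (x∉ ∷ u) =
    Allₚ.¬Any⇒All¬ (kids R) (λ x∈ → Allₚ.All¬⇒¬Any x∉ (∈-++⁺ʳ (es S) (∈-kids⇒∈-es R x∈)))
    ∷ kids-unique R (proj₂ (Unique-++⁻ (es S) u))

  -- An edge of `t` with the subtree `S` below it and both ways to cut there. The cut-off parts, `S`
  -- without and with the edge, differ in size by one, so a part of odd size is always available.
  record Cut (lo hi : ℕ) {v} (t : Tree G v) : Set where
    field
      {x u}          : Fin n
      e              : T (adj G x u)
      S              : Tree G u
      with-edge      : Tree G v
      without-edge   : Tree G v
      below          : es t ↭ es S ++ es with-edge
      below-and-edge : es t ↭ es (br u e S leaf) ++ es without-edge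
      lo≤S           : lo ≤ size S
      S≤hi           : size S ≤ hi

  Cut-child : ∀ {lo hi v u} {e : T (adj G v u)} {S : Tree G u} R → Cut lo hi S → Cut lo hi (br u e S R)
  Cut-child {e = e} R c = record
    { e = Cut.e c ; S = Cut.S c
    ; with-edge = br _ e (Cut.with-edge c) R ; without-edge = br _ e (Cut.without-edge c) R
    ; below = ↭-cut-child {P = es (Cut.S c)} (es R) (Cut.below c)
    ; below-and-edge = ↭-cut-child {P = es (br _ (Cut.e c) (Cut.S c) leaf)} (es R) (Cut.below-and-edge c)
    ; lo≤S = Cut.lo≤S c ; S≤hi = Cut.S≤hi c }

  Cut-sibling : ∀ {lo hi v u} {e : T (adj G v u)} (S : Tree G u) {R} → Cut lo hi R → Cut lo hi (br u e S R)
  Cut-sibling {e = e} S c = record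
    { e = Cut.e c ; S = Cut.S c
    ; with-edge = br _ e S (Cut.with-edge c) ; without-edge = br _ e S (Cut.without-edge c)
    ; below = ↭-cut-sibling (es S) {P = es (Cut.S c)} (Cut.below c)
    ; below-and-edge = ↭-cut-sibling (es S) {P = es (br _ (Cut.e c) (Cut.S c) leaf)} (Cut.below-and-edge c)
    ; lo≤S = Cut.lo≤S c ; S≤hi = Cut.S≤hi c }

  -- As long as no cut is found, every branch has at most `lo` edges including its top edge, so a
  -- vertex with at most `Δ` branches carries at most `lo * Δ` edges. The search is bottom-up, so a
  -- subtree that reaches `lo` edges still obeys this upper bound and is cut at the edge above it.
  find-cut : ∀ {Δ} → MaxDegAtMost Δ G → ∀ lo {v} (t : Tree G v) → Unique (es t) →
    Cut lo (lo * Δ) t ⊎ size t ≤ lo * length (kids t)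
  find-cut         maxdeg lo leaf         uniq     = inj₂ z≤n
  find-cut {Δ} maxdeg lo {v} (br u e S R) (x∉ ∷ uniq) with Unique-++⁻ (es S) uniq
  ... | uS , uR with find-cut maxdeg lo S uS
  ... | inj₁ c = inj₁ (Cut-child R c)
  ... | inj₂ S≤ with lo ≤? size S
  ... | yes lo≤S = inj₁ (record
    { e = e ; S = S ; with-edge = br u e leaf R ; without-edge = R
    ; below = ↭-sym (shift (norm v u) (es S) (es R))
    ; below-and-edge = ↭-cut-branch (es S) (es R)
    ; lo≤S = lo≤S
    ; S≤hi = ≤-trans S≤ (*-monoʳ-≤ lo (≤-trans (degree-bound G u (kids-unique S uS) (kids-adj S)) (maxdeg u))) })
  ... | no lo≰S with find-cut maxdeg lo R uR
  ... | inj₁ c = inj₁ (Cut-sibling S c)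
  ... | inj₂ R≤ = inj₂ (≤-trans (+-mono-≤ (≰⇒> lo≰S) R≤) (≤-reflexive (sym (*-suc lo (length (kids R))))))

parity : ∀ n → ∃ λ m → n ≡ 2 * m ⊎ n ≡ suc (2 * m)
parity zero = 0 , inj₁ refl
parity (suc n) with parity n
... | m , inj₁ refl = m , inj₂ refl
... | m , inj₂ refl = suc m , inj₁ (sym (*-suc 2 m))

module _ {n : ℕ} {G : Graph n} (w : Weighing n) where

  odd-balanced : ∀ {v} (t : Tree G v) m → size t ≡ suc (2 * m) → Balanced w 0 t → 2 * negs w (es t) < size t
  odd-balanced t m odd bal = ≤∧≢⇒< (subst (2 * negs w (es t) ≤_) (+-identityʳ (size t)) bal)
    λ eq → even≢odd (negs w (es t)) m (trans eq odd)

  odd-split : ∀ lo → (∀ {v} (t : Tree G v) → Unique (es t) → lo ≤ size t → Balanced w 0 t) →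
    ∀ {u v} (t : Tree G v) (p : Tree G u) (r : Tree G v) → es t ↭ es p ++ es r → Unique (es t) →
    ∀ m → size p ≡ suc (2 * m) → lo ≤ size p → size p + lo ≤ size t → 2 * negs w (es t) < size t
  odd-split lo bal t p r eq u m odd lo≤p lo≤r with up , ur ← Unique-split t p r eq u = begin-strict
    2 * negs w (es t)                      ≡⟨ cong (2 *_) (negs-split w t (es p) eq) ⟩
    2 * (negs w (es p) + negs w (es r))    ≡⟨ *-distribˡ-+ 2 (negs w (es p)) _ ⟩
    2 * negs w (es p) + 2 * negs w (es r)  <⟨ +-mono-<-≤ (odd-balanced p m odd (bal p up lo≤p))
      (subst (2 * negs w (es r) ≤_) (+-identityʳ (size r))
        (bal r ur (+-cancelˡ-≤ (size p) lo (size r) (subst (size p + lo ≤_) (size-split t p r eq) lo≤r)))) ⟩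
    size p + size r                        ≡⟨ size-split t p r eq ⟨
    size t                                 ∎
    where open ≤-Reasoning

  -- Of the two pieces below an edge, without it and with it, one has an odd number of edges, hence positive weight.
  balanced⇒positive : ∀ {Δ} → MaxDegAtMost Δ G → ∀ lo →
    (∀ {v} (t : Tree G v) → Unique (es t) → lo ≤ size t → Balanced w 0 t) →
    ∀ {v} (t : Tree G v) → Unique (es t) → suc (lo * Δ) + lo ≤ size t → 2 * negs w (es t) < size t
  balanced⇒positive {Δ} maxdeg lo bal {v} t u large with find-cut maxdeg lo t u
  ... | inj₂ t≤ = contradiction (≤-trans t≤ (*-monoʳ-≤ lo (≤-trans (degree-bound G v (kids-unique t u) (kids-adj t))
      (maxdeg v))))
    (<⇒≱ (≤-trans (m≤m+n _ lo) large))
  ... | inj₁ c with parity (size (Cut.S c))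
  ... | m , inj₂ odd = odd-split lo bal t (Cut.S c) (Cut.with-edge c) (Cut.below c) u m odd (Cut.lo≤S c)
    (≤-trans (+-monoˡ-≤ lo (≤-trans (Cut.S≤hi c) (n≤1+n _))) large)
  ... | m , inj₁ even = odd-split lo bal t (br _ (Cut.e c) (Cut.S c) leaf) (Cut.without-edge c) (Cut.below-and-edge c) u m
    (cong suc (trans (+-identityʳ _) even))
    (≤-trans (Cut.lo≤S c) (m≤n⇒m≤1+n (m≤m+n _ 0)))
    (≤-trans (+-monoˡ-≤ lo (s≤s (≤-trans (≤-reflexive (+-identityʳ _)) (Cut.S≤hi c)))) large)

-- Maximum degree two

module _ {n : ℕ} {G : Graph n} where

  data Linear : ∀ {v} → Tree G v → Set where
    leaf : ∀ {v} → Linear {v} leaf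
    br   : ∀ {v u e} {S : Tree G u} → Linear S → Linear (br {v = v} u e S leaf)

  -- With two branches, `u` would have three distinct neighbours: the two children and `v`, which is
  -- not among the children since the edge `norm v u` does not recur in `S`.
  degree2⇒Linear : MaxDegAtMost 2 G → ∀ {v u} (S : Tree G u) → T (adj G v u) → Unique (norm v u ∷ es S) → Linear S
  degree2⇒Linear maxdeg leaf e u = leaf
  degree2⇒Linear maxdeg {v} {u} (br x a S leaf) e (_ ∷ uS) =
    br (degree2⇒Linear maxdeg S a (Unique-resp-↭ (↭-prep _ (++-identityʳ (es S))) uS))
  degree2⇒Linear maxdeg {v} {u} t@(br x a S (br y b S′ R)) e (vu∉ ∷ ut) =
    contradiction (≤-trans (degree-bound G u {v ∷ kids t} (Allₚ.¬Any⇒All¬ (kids t) v∉ ∷ kids-unique t ut) (_∷_ {P = T ∘ adj G u} {x = v} (adj-sym G {v} {u} e) (kids-adj t))) (maxdeg u))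
      λ { (s≤s (s≤s ())) }
    where
    v∉ : v ∉ kids t
    v∉ v∈ = Allₚ.All¬⇒¬Any vu∉ (subst (_∈ es t) (norm-sym u v) (∈-kids⇒∈-es t v∈))

module _ {n : ℕ} {G : Graph n} (w : Weighing n) where

  module _ {k : ℕ} (positive : ∀ {v} (t : Tree G v) → Unique (es t) → size t ≡ suc k → 2 * negs w (es t) < suc k) where

    -- Blocks of exactly `suc k` edges are completed from the far end towards the root. `p` is the
    -- incomplete block at the root and `D` collects the `c` complete ones; each has weight at least
    -- 1, so `D` has weight at least `c`.
    linear-chop : ∀ {v} {t : Tree G v} → Linear t → Unique (es t) →
      ∃ λ (p : Tree G v) → ∃₂ λ D c → es t ↭ es p ++ D × size p ≤ k × length D ≡ c * suc k × 2 * negs w D + c ≤ length D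
    linear-chop leaf u = leaf , [] , 0 , ↭-refl , z≤n , refl , z≤n
    linear-chop {v} (br {u = x} {e = e} {S = S} lin) (x∉ ∷ u) with linear-chop lin (proj₁ (Unique-++⁻ (es S) u))
    ... | p , D , c , eq , p≤k , len , pos = finish (suc (size p) ≤? k)
      where
      t = br {v = v} x e S leaf
      q = br {v = v} x e p leaf
      split : es t ↭ es q ++ D
      split = ↭-prep _ (↭-trans (++-identityʳ (es S)) (↭-trans eq (++⁺ʳ D (↭-sym (++-identityʳ (es p))))))
      finish : Dec (size p ℕ.< k) → _
      finish (yes p<k) = q , D , c , split , subst (λ s → suc s ≤ k) (sym (+-identityʳ (size p))) p<k , len , pos
      finish (no p≮k)  = leaf , es q ++ D , suc c , split , z≤n , len′ , pos′
        where
        q-size : size q ≡ suc k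
        q-size = cong suc (trans (+-identityʳ (size p)) (≤-antisym p≤k (≤-pred (≰⇒> p≮k))))
        len′ : length (es q ++ D) ≡ suc c * suc k
        len′ = trans (length-++ (es q)) (cong₂ _+_ (trans (length-es q) q-size) len)
        q-pos : suc (2 * negs w (es q)) ≤ length (es q)
        q-pos = subst (2 * negs w (es q) <_) (sym (trans (length-es q) q-size))
          (positive q (proj₁ (Unique-++⁻ (es q) (Unique-resp-↭ split (x∉ ∷ u)))) q-size)
        rearrange : ∀ a b c → 2 * (a + b) + suc c ≡ suc (2 * a) + (2 * b + c)
        rearrange = solve-∀
        open ≤-Reasoning
        pos′ : 2 * negs w (es q ++ D) + suc c ≤ length (es q ++ D)
        pos′ = begin
          2 * negs w (es q ++ D) + suc c
            ≡⟨ cong (λ x → 2 * x + suc c) (sumL-++ (λ (i , j) → negBit (w i j)) (es q) D) ⟩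
          2 * (negs w (es q) + negs w D) + suc c      ≡⟨ rearrange (negs w (es q)) (negs w D) c ⟩
          suc (2 * negs w (es q)) + (2 * negs w D + c) ≤⟨ +-mono-≤ q-pos pos ⟩
          length (es q) + length D                    ≡⟨ length-++ (es q) ⟨
          length (es q ++ D)                          ∎

    -- At worst the incomplete block is entirely negative, which costs at most `k` against the gain
    -- `c` from the complete blocks.
    linear-bound : ∀ {v} {t : Tree G v} → Linear t → Unique (es t) →
      ∃ λ c → size t < suc c * suc k × 2 * negs w (es t) + c ≤ size t + k
    linear-bound {t = t} lin u with p , D , c , eq , p≤k , len , pos ← linear-chop lin u = c , small , (begin
      2 * negs w (es t) + c                        ≡⟨ cong (λ x → 2 * x + c) (negs-split w t (es p) eq) ⟩
      2 * (negs w (es p) + negs w D) + c           ≡⟨ rearrange (negs w (es p)) (negs w D) c ⟩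
      (negs w (es p) + negs w (es p)) + (2 * negs w D + c) ≤⟨ +-mono-≤ (+-mono-≤ np (≤-trans np p≤k)) pos ⟩
      (size p + k) + length D                      ≡⟨ swap (size p) k (length D) ⟩
      (size p + length D) + k                      ≡⟨ cong (_+ k) t-size ⟨
      size t + k                                   ∎)
      where
      open ≤-Reasoning
      np : negs w (es p) ≤ size p
      np = subst (negs w (es p) ≤_) (length-es p) (negs≤length w (es p))
      t-size : size t ≡ size p + length D
      t-size = trans (size-↭ t {es p} eq) (cong (_+ length D) (length-es p))
      rearrange : ∀ a b c → 2 * (a + b) + c ≡ (a + a) + (2 * b + c)
      rearrange = solve-∀
      swap : ∀ a b c → (a + b) + c ≡ (a + c) + b
      swap = solve-∀
      small : size t < suc c * suc k
      small = subst₂ _<_ (sym t-size) refl (+-mono-<-≤ (s≤s p≤k) (≤-reflexive len))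

    -- The root divides the tree into at most two linear branches. Together they lose at most
    -- `2 * k` in incomplete blocks and gain one per complete block; `(2 * k + 2) * suc k` edges
    -- contain more than `2 * k` complete blocks, even after the two incomplete ones are taken off.
    path-positive : MaxDegAtMost 2 G → ∀ {v} (t : Tree G v) → Unique (es t) →
      (2 * k + 2) * suc k ≤ size t → 2 * negs w (es t) < size t
    path-positive maxdeg leaf u large = contradiction large λ le → <⇒≱ (s≤s z≤n) (≤-trans (≤-reflexive (expand k)) le)
      where
      expand : ∀ k → suc (2 * k * k + 4 * k + 1) ≡ (2 * k + 2) * suc k
      expand = solve-∀
    path-positive maxdeg {v} t@(br x e S R) u large = finish (linear-bound
        (br {e = e} (degree2⇒Linear maxdeg S e uS)) uS′) (linear-bound (lin-R R refl) uR)
      where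
      open ≤-Reasoning
      eq : es t ↭ es (br {v = v} x e S leaf) ++ es R
      eq = ↭-cut-branch (es S) (es R)
      uS′ : Unique (es (br {v = v} x e S leaf))
      uS′ = proj₁ (Unique-split t (br {v = v} x e S leaf) R eq u)
      uR  : Unique (es R)
      uR  = proj₂ (Unique-split t (br {v = v} x e S leaf) R eq u)
      uS  : Unique (norm v x ∷ es S)
      uS  = Unique-resp-↭ (↭-prep _ (++-identityʳ (es S))) uS′
      lin-R : ∀ R′ → R ≡ R′ → Linear R′
      lin-R leaf refl = leaf
      lin-R (br y a S′ leaf) refl = br (degree2⇒Linear maxdeg S′ a (Unique-resp-↭ (↭-prep _ (++-identityʳ (es S′))) uR))
      lin-R (br y a S′ (br z b S″ R″)) refl = contradiction
        (≤-trans (degree-bound G v (kids-unique t u) (kids-adj t)) (maxdeg v)) λ { (s≤s (s≤s ())) }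
      finish : (∃ λ c → suc (size S + 0) < suc c * suc k × 2 * negs w (es (br {v = v} x e S leaf)) + c ≤ suc
          (size S + 0) + k) →
               (∃ λ c → size R < suc c * suc k × 2 * negs w (es R) + c ≤ size R + k) → 2 * negs w (es t) < size t
      finish (c , S< , S≤) (d , R< , R≤) = +-cancelʳ-< (c + d) _ _ (begin-strict
        2 * negs w (es t) + (c + d)  ≡⟨ cong (λ x → 2 * x + (c + d)) (negs-split w t (es (br {v = v} x e S leaf)) eq) ⟩
        2 * (negs w (es (br {v = v} x e S leaf)) + negs w (es R)) + (c + d)
          ≡⟨ rearrange (negs w (es (br {v = v} x e S leaf))) (negs w (es R)) c d ⟩
        (2 * negs w (es (br {v = v} x e S leaf)) + c) + (2 * negs w (es R) + d) ≤⟨ +-mono-≤ S≤ R≤ ⟩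
        (suc (size S + 0) + k) + (size R + k) ≡⟨ regroup (size S) (size R) k ⟩
        size t + 2 * k               <⟨ +-monoʳ-< (size t) 2k< ⟩
        size t + (c + d)             ∎)
        where
        rearrange : ∀ a b c d → 2 * (a + b) + (c + d) ≡ (2 * a + c) + (2 * b + d)
        rearrange = solve-∀
        regroup : ∀ a b k → (suc (a + 0) + k) + (b + k) ≡ suc (a + b) + 2 * k
        regroup = solve-∀
        sum≡ : ∀ c d k → suc c * suc k + suc d * suc k ≡ (c + d + 2) * suc k
        sum≡ = solve-∀
        2k< : 2 * k < c + d
        2k< = +-cancelʳ-< 2 _ _ (*-cancelʳ-< (suc k) _ _ (begin-strict
          (2 * k + 2) * suc k             ≤⟨ large ⟩
          suc (size S + size R)           ≡⟨ cong (λ x → suc (x + size R)) (+-identityʳ (size S)) ⟨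
          suc (size S + 0) + size R       <⟨ +-mono-< S< R< ⟩
          suc c * suc k + suc d * suc k   ≡⟨ sum≡ c d k ⟩
          (c + d + 2) * suc k             ∎))

-- Rational bounds

toℚᵘ-ℤtoℚ : ∀ z → ℚ.toℚᵘ (ℤtoℚ z) ℚᵘ.≃ mkℚᵘ z 0
toℚᵘ-ℤtoℚ z = ℚₚ.toℚᵘ-fromℚᵘ (mkℚᵘ z 0)

ℤtoℚ-mono-≤ : ∀ {a b} → a ℤ.≤ b → ℤtoℚ a ℚ.≤ ℤtoℚ b
ℤtoℚ-mono-≤ {a} {b} a≤b = ℚₚ.toℚᵘ-cancel-≤ (begin
  ℚ.toℚᵘ (ℤtoℚ a) ≃⟨ toℚᵘ-ℤtoℚ a ⟩
  mkℚᵘ a 0        ≤⟨ *≤* (ℤₚ.*-monoʳ-≤-nonNeg (+ 1) a≤b) ⟩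
  mkℚᵘ b 0        ≃⟨ toℚᵘ-ℤtoℚ b ⟨
  ℚ.toℚᵘ (ℤtoℚ b) ∎)
  where open ℚᵘₚ.≤-Reasoning

ℤtoℚ-* : ∀ a b → ℤtoℚ (a ℤ.* b) ≡ ℤtoℚ a ℚ.* ℤtoℚ b
ℤtoℚ-* a b = ℚₚ.toℚᵘ-injective (begin-equality
  ℚ.toℚᵘ (ℤtoℚ (a ℤ.* b))                 ≃⟨ toℚᵘ-ℤtoℚ (a ℤ.* b) ⟩
  mkℚᵘ a 0 ℚᵘ.* mkℚᵘ b 0                  ≃⟨ ℚᵘₚ.*-cong (toℚᵘ-ℤtoℚ a) (toℚᵘ-ℤtoℚ b) ⟨
  ℚ.toℚᵘ (ℤtoℚ a) ℚᵘ.* ℚ.toℚᵘ (ℤtoℚ b)    ≃⟨ ℚₚ.toℚᵘ-homo-* (ℤtoℚ a) (ℤtoℚ b) ⟨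
  ℚ.toℚᵘ (ℤtoℚ a ℚ.* ℤtoℚ b)              ∎)
  where open ℚᵘₚ.≤-Reasoning

ℤtoℚ-+ : ∀ a b → ℤtoℚ (a ℤ.+ b) ≡ ℤtoℚ a ℚ.+ ℤtoℚ b
ℤtoℚ-+ a b = ℚₚ.toℚᵘ-injective (begin-equality
  ℚ.toℚᵘ (ℤtoℚ (a ℤ.+ b))                 ≃⟨ toℚᵘ-ℤtoℚ (a ℤ.+ b) ⟩
  mkℚᵘ (a ℤ.+ b) 0
    ≃⟨ ℚᵘₚ.≃-reflexive (cong₂ (λ x y → mkℚᵘ (x ℤ.+ y) 0) (ℤₚ.*-identityʳ a) (ℤₚ.*-identityʳ b)) ⟨
  mkℚᵘ a 0 ℚᵘ.+ mkℚᵘ b 0                  ≃⟨ ℚᵘₚ.+-cong (toℚᵘ-ℤtoℚ a) (toℚᵘ-ℤtoℚ b) ⟨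
  ℚ.toℚᵘ (ℤtoℚ a) ℚᵘ.+ ℚ.toℚᵘ (ℤtoℚ b)    ≃⟨ ℚₚ.toℚᵘ-homo-+ (ℤtoℚ a) (ℤtoℚ b) ⟨
  ℚ.toℚᵘ (ℤtoℚ a ℚ.+ ℤtoℚ b)              ∎)
  where open ℚᵘₚ.≤-Reasoning

//-*-cancel : ∀ p d → (p // suc d) ℚ.* ℕtoℚ (suc d) ≡ ℤtoℚ p
//-*-cancel p d = ℚₚ.toℚᵘ-injective (begin-equality
  ℚ.toℚᵘ ((p // suc d) ℚ.* ℕtoℚ (suc d))                  ≃⟨ ℚₚ.toℚᵘ-homo-* (p // suc d) (ℕtoℚ (suc d)) ⟩
  ℚ.toℚᵘ (p // suc d) ℚᵘ.* ℚ.toℚᵘ (ℕtoℚ (suc d))          ≃⟨ ℚᵘₚ.*-cong (ℚₚ.toℚᵘ-fromℚᵘ (mkℚᵘ p d)) (toℚᵘ-ℤtoℚ (+ suc d)) ⟩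
  mkℚᵘ p d ℚᵘ.* mkℚᵘ (+ suc d) 0                          ≃⟨ *≡* (ℤₚ.*-assoc p (+ suc d) (+ 1)) ⟩
  mkℚᵘ p 0                                                ≃⟨ toℚᵘ-ℤtoℚ p ⟨
  ℚ.toℚᵘ (ℤtoℚ p)                                         ∎)
  where open ℚᵘₚ.≤-Reasoning

ℤtoℚ-neg : ∀ a → ℤtoℚ (ℤ.- a) ≡ ℚ.- ℤtoℚ a
ℤtoℚ-neg a = ℚₚ.toℚᵘ-injective (begin-equality
  ℚ.toℚᵘ (ℤtoℚ (ℤ.- a))      ≃⟨ toℚᵘ-ℤtoℚ (ℤ.- a) ⟩
  ℚᵘ.- mkℚᵘ a 0              ≃⟨ ℚᵘₚ.-‿cong (toℚᵘ-ℤtoℚ a) ⟨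
  ℚᵘ.- ℚ.toℚᵘ (ℤtoℚ a)       ≃⟨ ℚₚ.toℚᵘ-homo‿- (ℤtoℚ a) ⟨
  ℚ.toℚᵘ (ℚ.- ℤtoℚ a)        ∎)
  where open ℚᵘₚ.≤-Reasoning

ℕtoℚ-pos : ∀ d → ℚ.Positive (ℕtoℚ (suc d))
ℕtoℚ-pos d = ℚ.positive (ℚₚ.toℚᵘ-cancel-< (ℚᵘₚ.<-respʳ-≃ (ℚᵘₚ.≃-sym (toℚᵘ-ℤtoℚ (+ suc d)))
    (ℚᵘₚ.positive⁻¹ (mkℚᵘ (+ suc d) 0))))

archimedean : ∀ κ δ → ℚ.0ℚ ℚ.< δ → ∃ λ N → ∀ m → N ≤ m → ℕtoℚ κ ℚ.≤ δ ℚ.* ℕtoℚ m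
archimedean κ δ 0<δ = bound δ (ℚ.positive 0<δ)
  where
  bound : ∀ δ → ℚ.Positive δ → ∃ λ N → ∀ m → N ≤ m → ℕtoℚ κ ℚ.≤ δ ℚ.* ℕtoℚ m
  bound δ@(ℚ.mkℚ (+ suc a) d _) _ = κ * suc d , λ m N≤m → ℚₚ.toℚᵘ-cancel-≤ (begin
    ℚ.toℚᵘ (ℕtoℚ κ)                    ≃⟨ toℚᵘ-ℤtoℚ (+ κ) ⟩
    mkℚᵘ (+ κ) 0                       ≤⟨ *≤* (le m N≤m) ⟩
    mkℚᵘ (+ suc a) d ℚᵘ.* mkℚᵘ (+ m) 0 ≃⟨ ℚᵘₚ.*-congˡ {mkℚᵘ (+ suc a) d} (toℚᵘ-ℤtoℚ (+ m)) ⟨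
    ℚ.toℚᵘ δ ℚᵘ.* ℚ.toℚᵘ (ℕtoℚ m)      ≃⟨ ℚₚ.toℚᵘ-homo-* δ (ℕtoℚ m) ⟨
    ℚ.toℚᵘ (δ ℚ.* ℕtoℚ m)              ∎)
    where
    open ℚᵘₚ.≤-Reasoning
    le : ∀ m → κ * suc d ≤ m → + κ ℤ.* + suc (d * 1) ℤ.≤ (+ suc a ℤ.* + m) ℤ.* + 1
    le m N≤m = subst₂ ℤ._≤_ (trans (ℤₚ.pos-* κ (suc d)) (cong (λ x → + κ ℤ.* + suc x) (sym (*-identityʳ d))))
      (trans (ℤₚ.pos-* (suc a) m) (sym (ℤₚ.*-identityʳ (+ suc a ℤ.* + m))))
      (ℤ.+≤+ (≤-trans N≤m (m≤m+n m (a * m))))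

module _ (W : ℤ) {E N : ℕ} (total : W ℤ.+ + (2 * N) ≡ + E) where

  scaled-total : ∀ Q → W ℤ.* + Q ℤ.+ + (2 * Q * N) ≡ + (Q * E)
  scaled-total Q = begin
    W ℤ.* + Q ℤ.+ + (2 * Q * N)          ≡⟨ cong (λ x → W ℤ.* + Q ℤ.+ + x) (rearrange Q N) ⟩
    W ℤ.* + Q ℤ.+ + (2 * N * Q)          ≡⟨ cong (λ x → W ℤ.* + Q ℤ.+ x) (ℤₚ.pos-* (2 * N) Q) ⟩
    W ℤ.* + Q ℤ.+ + (2 * N) ℤ.* + Q      ≡⟨ ℤₚ.*-distribʳ-+ (+ Q) W (+ (2 * N)) ⟨
    (W ℤ.+ + (2 * N)) ℤ.* + Q            ≡⟨ cong (λ x → x ℤ.* + Q) total ⟩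
    + E ℤ.* + Q                          ≡⟨ ℤₚ.pos-* E Q ⟨
    + (E * Q)                            ≡⟨ cong (λ x → + x) (*-comm E Q) ⟩
    + (Q * E)                            ∎
    where
    open ≡-Reasoning
    rearrange : ∀ q n → 2 * q * n ≡ 2 * n * q
    rearrange = solve-∀

  weight-≥ : ∀ P Q L → 2 * Q * N ≤ (P + Q) * E + L → ℤ.- + (P * E + L) ℤ.≤ W ℤ.* + Q
  weight-≥ P Q L le = begin
    ℤ.- + X                              ≡⟨ ℤₚ.+-identityʳ _ ⟨
    ℤ.- + X ℤ.+ + 0                      ≤⟨ ℤₚ.+-monoʳ-≤ (ℤ.- + X) nonneg ⟩
    ℤ.- + X ℤ.+ (+ X ℤ.+ W ℤ.* + Q)      ≡⟨ ℤₚ.+-assoc (ℤ.- + X) (+ X) _ ⟨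
    (ℤ.- + X ℤ.+ + X) ℤ.+ W ℤ.* + Q      ≡⟨ cong (λ x → x ℤ.+ W ℤ.* + Q) (ℤₚ.+-inverseˡ (+ X)) ⟩
    + 0 ℤ.+ W ℤ.* + Q                    ≡⟨ ℤₚ.+-identityˡ _ ⟩
    W ℤ.* + Q                            ∎
    where
    open ℤₚ.≤-Reasoning
    X = P * E + L
    rearrange : ∀ p q e l → (p + q) * e + l ≡ (p * e + l) + q * e
    rearrange = solve-∀
    nonneg : + 0 ℤ.≤ + X ℤ.+ W ℤ.* + Q
    nonneg = ℤₚ.≮⇒≥ λ neg → ℤₚ.≤⇒≯ (begin
      + (2 * Q * N)                        ≤⟨ ℤ.+≤+ le ⟩
      + ((P + Q) * E + L)                  ≡⟨ cong (λ x → + x) (rearrange P Q E L) ⟩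
      + X ℤ.+ + (Q * E)                    ≡⟨ cong (λ x → + X ℤ.+ x) (scaled-total Q) ⟨
      + X ℤ.+ (W ℤ.* + Q ℤ.+ + (2 * Q * N)) ≡⟨ ℤₚ.+-assoc (+ X) (W ℤ.* + Q) (+ (2 * Q * N)) ⟨
      (+ X ℤ.+ W ℤ.* + Q) ℤ.+ + (2 * Q * N) ∎)
      (subst (λ z → (+ X ℤ.+ W ℤ.* + Q) ℤ.+ + (2 * Q * N) ℤ.< z) (ℤₚ.+-identityˡ (+ (2 * Q * N)))
          (ℤₚ.+-monoˡ-< (+ (2 * Q * N)) neg))

  weight-≤ : ∀ P Q → (P + Q) * E ≤ 2 * Q * N → W ℤ.* + Q ℤ.≤ ℤ.- + (P * E)
  weight-≤ P Q le = begin
    W ℤ.* + Q                            ≡⟨ ℤₚ.+-identityˡ _ ⟨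
    + 0 ℤ.+ W ℤ.* + Q                    ≡⟨ cong (λ x → x ℤ.+ W ℤ.* + Q) (ℤₚ.+-inverseˡ (+ X)) ⟨
    (ℤ.- + X ℤ.+ + X) ℤ.+ W ℤ.* + Q      ≡⟨ ℤₚ.+-assoc (ℤ.- + X) (+ X) _ ⟩
    ℤ.- + X ℤ.+ (+ X ℤ.+ W ℤ.* + Q)      ≤⟨ ℤₚ.+-monoʳ-≤ (ℤ.- + X) nonpos ⟩
    ℤ.- + X ℤ.+ + 0                      ≡⟨ ℤₚ.+-identityʳ _ ⟩
    ℤ.- + X                              ∎
    where
    open ℤₚ.≤-Reasoning
    X = P * E
    nonpos : + X ℤ.+ W ℤ.* + Q ℤ.≤ + 0
    nonpos = ℤₚ.≮⇒≥ λ pos → ℤₚ.≤⇒≯ (begin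
      (+ X ℤ.+ W ℤ.* + Q) ℤ.+ + (2 * Q * N) ≡⟨ ℤₚ.+-assoc (+ X) (W ℤ.* + Q) (+ (2 * Q * N)) ⟩
      + X ℤ.+ (W ℤ.* + Q ℤ.+ + (2 * Q * N)) ≡⟨ cong (λ x → + X ℤ.+ x) (scaled-total Q) ⟩
      + X ℤ.+ + (Q * E)                    ≡⟨ cong (λ x → + x) (*-distribʳ-+ E P Q) ⟨
      + ((P + Q) * E)                      ≤⟨ ℤ.+≤+ le ⟩
      + (2 * Q * N)                        ∎)
      (subst (λ z → z ℤ.< (+ X ℤ.+ W ℤ.* + Q) ℤ.+ + (2 * Q * N)) (ℤₚ.+-identityˡ (+ (2 * Q * N)))
          (ℤₚ.+-monoˡ-< (+ (2 * Q * N)) pos))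

-- As the weight is |E| - 2 negSub, these say w(G) ≥ -(P/Q)|E| - 2K and w(G) ≤ -(P/Q)|E|, without subtraction.
LowerRatio : ℕ → Family → ℕ → ℕ → ℕ → Set
LowerRatio k 𝒢 P Q K = ∀ n (G : Graph n) → 𝒢 n G → ∀ w → LocalPositive k G w →
  2 * Q * negSub G w allEdges ≤ (P + Q) * numEdges G + 2 * Q * K

UpperRatio : ℕ → Family → ℕ → ℕ → Set
UpperRatio k 𝒢 P Q = ∀ t → ∃₂ λ n (G : Graph n) → 𝒢 n G × ∃ λ w → LocalPositive k G w ×
  t ≤ n × t ≤ numEdges G × (P + Q) * numEdges G ≤ 2 * Q * negSub G w allEdges

slope-scaled : ∀ P d E → ℚ.- ((+ P) // suc d) ℚ.* ℕtoℚ E ℚ.* ℕtoℚ (suc d) ≡ ℤtoℚ (ℤ.- + (P * E))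
slope-scaled P d E = begin
  ℚ.- r ℚ.* e ℚ.* q          ≡⟨ rearrange r e q ⟩
  ℚ.- ((r ℚ.* q) ℚ.* e)      ≡⟨ cong (λ x → ℚ.- (x ℚ.* e)) (//-*-cancel (+ P) d) ⟩
  ℚ.- (ℤtoℚ (+ P) ℚ.* e)     ≡⟨ cong ℚ.-_ (ℤtoℚ-* (+ P) (+ E)) ⟨
  ℚ.- ℤtoℚ (+ P ℤ.* + E)     ≡⟨ ℤtoℚ-neg (+ P ℤ.* + E) ⟨
  ℤtoℚ (ℤ.- (+ P ℤ.* + E))   ≡⟨ cong (λ x → ℤtoℚ (ℤ.- x)) (ℤₚ.pos-* P E) ⟨
  ℤtoℚ (ℤ.- + (P * E))       ∎
  where
  open ≡-Reasoning
  r = (+ P) // suc d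
  e = ℕtoℚ E
  q = ℕtoℚ (suc d)
  open Data.Rational.Solver.+-*-Solver renaming (solve to solveℚ)
  rearrange : ∀ r e q → ℚ.- r ℚ.* e ℚ.* q ≡ ℚ.- ((r ℚ.* q) ℚ.* e)
  rearrange = solveℚ 3 (λ r e q → :- r :* e :* q := :- ((r :* q) :* e)) refl

slope-nonPos : ∀ P d → ℚ.- ((+ P) // suc d) ℚ.≤ ℚ.0ℚ
slope-nonPos P d = ℚₚ.neg-antimono-≤ (ℚₚ.nonNegative⁻¹ ((+ P) // suc d) {{ℚₚ.normalize-nonNeg P (suc d)}})

-- The slope itself is admissible, with the constant error `2 * K`, and so it serves as the witness
-- for every `c′` below it. The inequality is verified after multiplication by the denominator.
LowerRatio⇒CollapseValueAtLeast : ∀ {k 𝒢} P d K → LowerRatio k 𝒢 P (suc d) K →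
  CollapseValueAtLeast k 𝒢 (ℚ.- ((+ P) // suc d))
LowerRatio⇒CollapseValueAtLeast {k} {𝒢} P d K lower c′ c′<c =
  c , slope-nonPos P d , ((λ _ → g) , sublinear , admissible) , c′<c
  where
  c = ℚ.- ((+ P) // suc d)
  g = ℕtoℚ (2 * K)
  q = ℕtoℚ (suc d)
  sublinear : ∀ δ → ℚ.0ℚ ℚ.< δ → ∃ λ N → ∀ m → N ≤ m → ℚ.∣ g ∣ ℚ.≤ δ ℚ.* ℕtoℚ m
  sublinear δ 0<δ rewrite ℚₚ.0≤p⇒∣p∣≡p (ℤtoℚ-mono-≤ {+ 0} {+ (2 * K)} (ℤ.+≤+ z≤n)) = archimedean (2 * K) δ 0<δ
  admissible : ∀ n (G : Graph n) → 𝒢 n G → ∀ w → LocalPositive k G w →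
    c ℚ.* ℕtoℚ (numEdges G) ℚ.- g ℚ.≤ ℤtoℚ (weight G w)
  admissible n G G∈ w lp = ℚₚ.*-cancelʳ-≤-pos q {{ℕtoℚ-pos d}} (begin
    (c ℚ.* e ℚ.- g) ℚ.* q                              ≡⟨ ℚₚ.*-distribʳ-+ q (c ℚ.* e) (ℚ.- g) ⟩
    c ℚ.* e ℚ.* q ℚ.+ (ℚ.- g) ℚ.* q                    ≡⟨ cong₂ ℚ._+_ (slope-scaled P d E) (sym (ℚₚ.neg-distribˡ-* g q)) ⟩
    ℤtoℚ (ℤ.- + (P * E)) ℚ.- g ℚ.* q
      ≡⟨ cong (λ x → ℤtoℚ (ℤ.- + (P * E)) ℚ.- x) (ℤtoℚ-* (+ (2 * K)) (+ suc d)) ⟨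
    ℤtoℚ (ℤ.- + (P * E)) ℚ.- ℤtoℚ (+ (2 * K) ℤ.* + suc d)
      ≡⟨ cong (λ x → ℤtoℚ (ℤ.- + (P * E)) ℚ.+ x) (ℤtoℚ-neg (+ (2 * K) ℤ.* + suc d)) ⟨
    ℤtoℚ (ℤ.- + (P * E)) ℚ.+ ℤtoℚ (ℤ.- (+ (2 * K) ℤ.* + suc d)) ≡⟨ ℤtoℚ-+ (ℤ.- + (P * E)) _ ⟨
    ℤtoℚ (ℤ.- + (P * E) ℤ.- + (2 * K) ℤ.* + suc d)     ≡⟨ cong ℤtoℚ regroup ⟩
    ℤtoℚ (ℤ.- + (P * E + 2 * suc d * K))
      ≤⟨ ℤtoℚ-mono-≤ (weight-≥ W (weightSub-negSub G w allEdges) P (suc d) _ (lower n G G∈ w lp)) ⟩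
    ℤtoℚ (W ℤ.* + suc d)                               ≡⟨ ℤtoℚ-* W (+ suc d) ⟩
    ℤtoℚ W ℚ.* q                                       ∎)
    where
    open ℚₚ.≤-Reasoning
    E = numEdges G
    e = ℕtoℚ E
    W = weight G w
    swap : ∀ a b → 2 * a * b ≡ 2 * b * a
    swap = solve-∀
    regroup : ℤ.- + (P * E) ℤ.- + (2 * K) ℤ.* + suc d ≡ ℤ.- + (P * E + 2 * suc d * K)
    regroup = trans (cong (λ x → ℤ.- + (P * E) ℤ.- x) (trans (sym (ℤₚ.pos-* (2 * K) (suc d)))
        (cong (λ x → + x) (swap K (suc d)))))
      (sym (ℤₚ.neg-distrib-+ (+ (P * E)) (+ (2 * suc d * K))))

-- Were an admissible `c` above the slope `a`, choose `b` strictly between them. For large `E` the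
-- error is at most `(c - b) * E`, so a graph of the family with `E` edges and weight `W` gives
-- `b * E ≤ W ≤ a * E`, which is absurd as `E` is positive.
UpperRatio⇒CollapseValueAtMost : ∀ {k 𝒢} P d → UpperRatio k 𝒢 P (suc d) →
  CollapseValueAtMost k 𝒢 (ℚ.- ((+ P) // suc d))
UpperRatio⇒CollapseValueAtMost {k} {𝒢} P d upper c c≤0 (g , sublinear , admissible) = ℚₚ.≮⇒≥ λ a<c →
  let b , a<b , b<c = ℚₚ.<-dense a<c
      N , small = sublinear (c ℚ.- b) (subst (ℚ._< c ℚ.- b) (ℚₚ.+-inverseʳ b) (ℚₚ.+-monoˡ-< (ℚ.- b) b<c))
  in absurd b a<b N small (upper (suc N))
  where
  a = ℚ.- ((+ P) // suc d)
  absurd : ∀ b → a ℚ.< b → ∀ N → (∀ m → N ≤ m → ℚ.∣ g m ∣ ℚ.≤ (c ℚ.- b) ℚ.* ℕtoℚ m) →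
    ¬ (∃₂ λ n (G : Graph n) → 𝒢 n G × ∃ λ w → LocalPositive k G w ×
      suc N ≤ n × suc N ≤ numEdges G × (P + suc d) * numEdges G ≤ 2 * suc d * negSub G w allEdges)
  absurd b a<b N small (n , G , G∈ , w , lp , _ , N<E , le) with numEdges G in eq
  ... | suc E = ℚₚ.<-irrefl refl (ℚₚ.<-≤-trans a<b b≤a)
    where
    open ℚₚ.≤-Reasoning
    e = ℕtoℚ (suc E)
    q = ℕtoℚ (suc d)
    W = weight G w
    open Data.Rational.Solver.+-*-Solver renaming (solve to solveℚ)
    rearrange : ∀ c b e → b ℚ.* e ≡ c ℚ.* e ℚ.- (c ℚ.- b) ℚ.* e
    rearrange = solveℚ 3 (λ c b e → b :* e := c :* e :- (c :- b) :* e) refl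
    W≤ : ℤtoℚ W ℚ.≤ a ℚ.* e
    W≤ = ℚₚ.*-cancelʳ-≤-pos q {{ℕtoℚ-pos d}} (begin
      ℤtoℚ W ℚ.* q               ≡⟨ ℤtoℚ-* W (+ suc d) ⟨
      ℤtoℚ (W ℤ.* + suc d)
        ≤⟨ ℤtoℚ-mono-≤ (weight-≤ W (trans (weightSub-negSub G w allEdges) (cong (λ x → + x) eq)) P (suc d) le) ⟩
      ℤtoℚ (ℤ.- + (P * suc E))   ≡⟨ slope-scaled P d (suc E) ⟨
      a ℚ.* e ℚ.* q              ∎)
    b≤a : b ℚ.≤ a
    b≤a = ℚₚ.*-cancelʳ-≤-pos e {{ℕtoℚ-pos E}} (begin
      b ℚ.* e                            ≡⟨ rearrange c b e ⟩
      c ℚ.* e ℚ.- (c ℚ.- b) ℚ.* e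
        ≤⟨ ℚₚ.+-monoʳ-≤ (c ℚ.* e) (ℚₚ.neg-antimono-≤ (ℚₚ.≤-trans (p≤∣p∣ (g (suc E))) (small (suc E) (≤-trans (n≤1+n N) N<E)))) ⟩
      c ℚ.* e ℚ.- g (suc E)              ≤⟨ subst (λ m → c ℚ.* ℕtoℚ m ℚ.- g m ℚ.≤ ℤtoℚ W) eq (admissible n G G∈ w lp) ⟩
      ℤtoℚ W                             ≤⟨ W≤ ⟩
      a ℚ.* e                            ∎)
      where
      p≤∣p∣ : ∀ p → p ℚ.≤ ℚ.∣ p ∣
      p≤∣p∣ p@(ℚ.mkℚ (+ _) _ _)    = ℚₚ.≤-refl
      p≤∣p∣ p@(ℚ.mkℚ -[1+ _ ] _ _) = ℚₚ.≤-trans (ℚₚ.<⇒≤ (ℚₚ.negative⁻¹ p)) (ℚₚ.0≤∣p∣ p)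

-- The numerator is positive, so `suc d` times the weight is at most minus the number of edges;
-- graphs with at least `t * suc d` edges suffice.
UpperRatio⇒weight≤ : ∀ {k 𝒢} P d → UpperRatio k 𝒢 (suc P) (suc d) → ∀ t →
  ∃₂ λ n (G : Graph n) → 𝒢 n G × ∃ λ w → LocalPositive k G w × t ≤ n × weight G w ℤ.≤ ℤ.- + t
UpperRatio⇒weight≤ P d upper t with upper (t * suc d)
... | n , G , G∈ , w , lp , n≥ , E≥ , le = n , G , G∈ , w , lp , ≤-trans (m≤m*n t (suc d)) n≥ ,
  ℤₚ.*-cancelʳ-≤-pos (weight G w) (ℤ.- + t) (+ suc d) (begin
    weight G w ℤ.* + suc d         ≤⟨ weight-≤ (weight G w) (weightSub-negSub G w allEdges) (suc P) (suc d) le ⟩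
    ℤ.- + (suc P * numEdges G)     ≤⟨ ℤₚ.neg-mono-≤ (ℤ.+≤+ (≤-trans E≥ (m≤m+n (numEdges G) (P * numEdges G)))) ⟩
    ℤ.- + (t * suc d)              ≡⟨ cong ℤ.-_ (ℤₚ.pos-* t (suc d)) ⟩
    ℤ.- (+ t ℤ.* + suc d)          ≡⟨ ℤₚ.neg-distribˡ-* (+ t) (+ suc d) ⟩
    (ℤ.- + t) ℤ.* + suc d          ∎)
  where open ℤₚ.≤-Reasoning

archimedean-below : ∀ C → ∃ λ t → ℤtoℚ (ℤ.- + t) ℚ.< C
archimedean-below C@(ℚ.mkℚ a d _) = suc ℤ.∣ a ∣ , ℚₚ.toℚᵘ-cancel-< (begin-strict
  ℚ.toℚᵘ (ℤtoℚ (ℤ.- + suc ℤ.∣ a ∣)) ≃⟨ toℚᵘ-ℤtoℚ (ℤ.- + suc ℤ.∣ a ∣) ⟩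
  mkℚᵘ (ℤ.- + suc ℤ.∣ a ∣) 0        <⟨ ℚᵘ.*<* (lt a) ⟩
  mkℚᵘ a d                          ∎)
  where
  open ℚᵘₚ.≤-Reasoning
  lt : ∀ a → (ℤ.- + suc ℤ.∣ a ∣) ℤ.* + suc d ℤ.< a ℤ.* + 1
  lt (+ m) = subst (λ z → -[1+ d + m * suc d ] ℤ.< z) (ℤₚ.pos-* m 1) ℤ.-<+
  lt -[1+ m ] = subst (λ z → -[1+ d + suc m * suc d ] ℤ.< z) (sym (ℤₚ.*-identityʳ -[1+ m ]))
    (ℤ.-<- (≤-trans (m≤m*n (suc m) (suc d)) (m≤n+m (suc m * suc d) d)))

UpperRatio⇒Collapses : ∀ {k 𝒢} P d → UpperRatio k 𝒢 (suc P) (suc d) → Collapses k 𝒢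
UpperRatio⇒Collapses {k} {𝒢} P d upper = not-forcing , not-weak
  where
  family = UpperRatio⇒weight≤ P d upper
  not-forcing : ¬ Forcing k 𝒢
  not-forcing (N , forced) with family N
  ... | n , G , G∈ , w , lp , N≤n , le = ℤₚ.<-irrefl refl
    (ℤₚ.<-≤-trans (forced n N≤n G G∈ w lp) (ℤₚ.≤-trans le (ℤₚ.neg-mono-≤ (ℤ.+≤+ z≤n))))
  not-weak : ¬ (∃ λ C → WeakBound k 𝒢 C)
  not-weak (C , N , bounded) with archimedean-below C
  ... | t , t<C with family (N ℕ.⊔ t)
  ... | n , G , G∈ , w , lp , n≥ , le = ℚₚ.<-irrefl refl (begin-strict
    C                        ≤⟨ bounded n (≤-trans (m≤m⊔n N t) n≥) G G∈ w lp ⟩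
    ℤtoℚ (weight G w)        ≤⟨ ℤtoℚ-mono-≤ (ℤₚ.≤-trans le (ℤₚ.neg-mono-≤ (ℤ.+≤+ (m≤n⊔m N t)))) ⟩
    ℤtoℚ (ℤ.- + t)           <⟨ t<C ⟩
    C                        ∎)
    where open ℚₚ.≤-Reasoning

WeightAttained : ℕ → Family → Set
WeightAttained k 𝒢 = ∀ t → ∃₂ λ n (G : Graph n) → 𝒢 n G × ∃ λ w → LocalPositive k G w ×
  t ≤ n × weight G w ≡ ℤ.- + 1

WeightAttained⇒WeaklyForcing : ∀ {k 𝒢} → WeightAttained k 𝒢 → WeakBound k 𝒢 (ℚ.- ℚ.1ℚ) →
  WeaklyForcingWithValue k 𝒢 (ℚ.- ℚ.1ℚ)
WeightAttained⇒WeaklyForcing {k} {𝒢} attained weak = not-forcing , weak , optimal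
  where
  not-forcing : ¬ Forcing k 𝒢
  not-forcing (N , forced) with attained N
  ... | n , G , G∈ , w , lp , N≤n , eq = contradiction (subst (+ 0 ℤ.<_) eq (forced n N≤n G G∈ w lp)) λ ()
  optimal : ∀ C → ℚ.- ℚ.1ℚ ℚ.< C → ¬ WeakBound k 𝒢 C
  optimal C -1<C (N , bounded) with attained N
  ... | n , G , G∈ , w , lp , N≤n , eq = ℚₚ.<-irrefl refl (ℚₚ.<-≤-trans -1<C
    (subst (λ W → C ℚ.≤ ℤtoℚ W) eq (bounded n N≤n G G∈ w lp)))

-- Lower bounds for local positive weighings

module _ {n : ℕ} {G : Graph n} (conn : Connected G) where

  whole-tree : ∀ {N} → N < n → ∃₂ λ v (t : Tree G v) →
    Unique (es t) × N ≤ size t × numEdges G ≡ size t × (∀ w → negSub G w allEdges ≡ negs w (es t))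
  whole-tree N<n with t , u , p , n≤ ← spanning conn (Fin.fromℕ< N<n) =
    _ , t , u , ≤-pred (≤-trans N<n n≤) ,
    trans (total (λ _ _ → 1)) (trans (sumL-one (es t)) (length-es t)) , λ w → total (λ i j → negBit (w i j))
    where
    total : ∀ h → sumEdges G allEdges h ≡ sumL (uncurry h) (es t)
    total h = trans (sumEdges-edgeList G allEdges h) (sumL-↭ (uncurry h) (↭-sym p))

-- More than `k + N` vertices give a tree with at least `k + N` edges: enough for `positive`, and
-- enough for small pieces to be grown to `k` edges inside the graph.
forcing-by-trees : ∀ {Δ k 𝒢} → Sandwiched Δ 𝒢 → ∀ N →
  (∀ {n} {G : Graph n} → Connected G → MaxDegAtMost Δ G → ∀ w → LocalPositive k G w → k ≤ numEdges G →
    ∀ {v} (t : Tree G v) → Unique (es t) → N ≤ size t → 2 * negs w (es t) < size t) → Forcing k 𝒢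
forcing-by-trees {k = k} (_ , upper) N positive = suc (k + N) , λ n N<n G G∈ w lp →
  let conn , maxdeg = upper n G G∈
      v , t , u , N≤ , edges , negatives = whole-tree {G = G} conn N<n
  in weightSub-pos⇐ G w allEdges (subst₂ (λ a b → 2 * a < b) (sym (negatives w)) (sym edges)
       (positive conn maxdeg w lp (subst (k ≤_) (sym edges) (≤-trans (m≤m+n k N) N≤)) t u (≤-trans (m≤n+m N k) N≤)))

forcing-2-path : ∀ {𝒢} → Sandwiched 2 𝒢 → ∀ k → 1 ≤ k → Forcing k 𝒢
forcing-2-path sw (suc k) _ = forcing-by-trees sw _ λ _ maxdeg w lp _ t u →
  path-positive w (LocalPositive⇒negs lp) maxdeg t u

-- For `k ≤ 2` one has `r = 0`. With threshold 0 the pieces are single edges, and none of them is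
-- negative since each lies in a connected subgraph with `k` edges.
forcing-all-positive : ∀ {Δ k 𝒢} → 1 ≤ k → k ≤ 2 → Sandwiched Δ 𝒢 → Forcing k 𝒢
forcing-all-positive {k = k} 1≤k k≤2 sw = forcing-by-trees sw 1 λ conn _ w lp k≤E t u 1≤t →
  let no-negs = ratio-bound w {excess 0 k} (piece-bound w conn lp k≤2 k≤E) 0 1 0 edge t u
  in ≤-<-trans (*-monoʳ-≤ 2 (≤-trans (≤-reflexive (sym (*-identityˡ _))) no-negs)) 1≤t
  where
  edge : ∀ j → 1 ≤ j → j ≤ 1 → 1 * excess 0 k j ≤ 0
  edge (suc zero) _ _ = ≤-reflexive (trans (+-identityʳ _) (m≤n⇒m∸n≡0 1≤k))
  edge (suc (suc j)) _ (s≤s ())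

forcing-balanced : ∀ {Δ k 𝒢} lo →
  (∀ {n} {G : Graph n} w → Connected G → LocalPositive k G w → k ≤ numEdges G →
    ∀ {v} (t : Tree G v) → Unique (es t) → lo ≤ size t → Balanced w 0 t) →
  Sandwiched Δ 𝒢 → Forcing k 𝒢
forcing-balanced lo bal sw = forcing-by-trees sw _ λ conn maxdeg w lp k≤E t u →
  balanced⇒positive w maxdeg lo (bal w conn lp k≤E) t u

weak-bound-balanced : ∀ {Δ k 𝒢} lo →
  (∀ {n} {G : Graph n} w → Connected G → LocalPositive k G w → k ≤ numEdges G →
    ∀ {v} (t : Tree G v) → Unique (es t) → lo ≤ size t → Balanced w 1 t) →
  Sandwiched Δ 𝒢 → WeakBound k 𝒢 (ℚ.- ℚ.1ℚ)
weak-bound-balanced {k = k} lo bal (_ , upper) = suc (k + lo) , λ n N<n G G∈ w lp →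
  let conn , maxdeg = upper n G G∈
      v , t , u , N≤ , edges , negatives = whole-tree {G = G} conn N<n
      b = bal w conn lp (subst (k ≤_) (sym edges) (≤-trans (m≤m+n k lo) N≤)) t u (≤-trans (m≤n+m lo k) N≤)
  in ℤtoℚ-mono-≤ {ℤ.- + 1} (subst (ℤ.- + 1 ℤ.≤_) (ℤₚ.*-identityʳ (weight G w))
       (weight-≥ (weight G w) {N = negSub G w allEdges} (weightSub-negSub G w allEdges) 0 1 1
         (subst₂ (λ a e → 2 * a ≤ 1 * e + 1) (sym (negatives w)) (sym edges)
           (≤-trans b (≤-reflexive (cong (_+ 1) (sym (*-identityˡ (size t)))))))))

-- Piece sizes range from `suc s` to `s + s`. Up to `k` edges the bound on negative edges is the
-- constant `r`, so the smallest piece is the worst: hypothesis `small`. Beyond `k` it grows by one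
-- per edge, faster than the allowed ratio, so the largest piece is the worst: hypothesis `large`.
-- `R` stands for `Q - P`.
lower-ratio : ∀ {Δ k 𝒢} r s P R {Q} → P + R ≡ Q → k ≤ 2 * suc r → 1 ≤ s →
  2 * Q * r ≤ (P + Q) * suc s → R * (s + s) + 2 * Q * r ≤ 2 * Q * k →
  Sandwiched Δ 𝒢 → LowerRatio k 𝒢 P Q (s + k)
lower-ratio {k = k} r s P R refl k≤ 1≤s small large (_ , upper) = bound
  where
  open ≤-Reasoning
  Q = P + R
  rearrange₁ : ∀ p r k d → 2 * (p + r) * (k + d) ≡ (p + (p + r)) * (k + d) + r * (k + d)
  rearrange₁ = solve-∀
  rearrange₂ : ∀ p r a k d → 2 * (p + r) * (a + d) + r * (k + d) ≡ r * (k + d) + 2 * (p + r) * a + 2 * (p + r) * d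
  rearrange₂ = solve-∀
  piece : ∀ j → suc s ≤ j → j ≤ suc s ⊔ (s + s) → 2 * Q * excess r k j ≤ (P + Q) * j
  piece j s<j j≤ with ≤-total j k
  ... | inj₁ j≤k = begin
    2 * Q * (r + (j ∸ k))      ≡⟨ cong (λ x → 2 * Q * (r + x)) (m≤n⇒m∸n≡0 j≤k) ⟩
    2 * Q * (r + 0)            ≡⟨ cong (2 * Q *_) (+-identityʳ r) ⟩
    2 * Q * r                  ≤⟨ small ⟩
    (P + Q) * suc s            ≤⟨ *-monoʳ-≤ (P + Q) s<j ⟩
    (P + Q) * j                ∎
  ... | inj₂ k≤j with d , refl ← m≤n⇒∃[o]m+o≡n k≤j = +-cancelʳ-≤ (R * (k + d)) _ _ (begin
    2 * Q * (r + (k + d ∸ k)) + R * (k + d)       ≡⟨ cong (λ x → 2 * Q * (r + x) + R * (k + d)) (m+n∸m≡n k d) ⟩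
    2 * Q * (r + d) + R * (k + d)                 ≡⟨ rearrange₂ P R r k d ⟩
    R * (k + d) + 2 * Q * r + 2 * Q * d
      ≤⟨ +-monoˡ-≤ (2 * Q * d) (+-monoˡ-≤ (2 * Q * r) (*-monoʳ-≤ R (≤-trans j≤ (≤-reflexive (m≤n⇒m⊔n≡n (+-monoˡ-≤ s 1≤s)))))) ⟩
    R * (s + s) + 2 * Q * r + 2 * Q * d           ≤⟨ +-monoˡ-≤ (2 * Q * d) large ⟩
    2 * Q * k + 2 * Q * d                         ≡⟨ *-distribˡ-+ (2 * Q) k d ⟨
    2 * Q * (k + d)                               ≡⟨ rearrange₁ P R k d ⟩
    (P + Q) * (k + d) + R * (k + d)               ∎)
  bound : LowerRatio _ _ P Q (s + k)
  -- A graph without vertices has no root for a tree.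
  bound zero    G G∈ w lp = ≤-trans (≤-reflexive (*-zeroʳ (2 * Q))) z≤n
  bound (suc n) G G∈ w lp with conn ← proj₁ (upper (suc n) G G∈)
    with v , t , u , _ , edges , negatives ← whole-tree {G = G} conn {0} (s≤s z≤n)
    with ≤-total k (numEdges G)
  ... | inj₁ k≤E = begin
    2 * Q * negSub G w allEdges                  ≡⟨ cong (2 * Q *_) (negatives w) ⟩
    2 * Q * negs w (es t)
      ≤⟨ ratio-bound w {excess r k} (piece-bound w conn lp k≤ k≤E) s (2 * Q) (P + Q) piece t u ⟩
    (P + Q) * size t + 2 * Q * s                 ≤⟨ +-monoʳ-≤ _ (*-monoʳ-≤ (2 * Q) (m≤m+n s k)) ⟩
    (P + Q) * size t + 2 * Q * (s + k)           ≡⟨ cong (λ x → (P + Q) * x + 2 * Q * (s + k)) edges ⟨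
    (P + Q) * numEdges G + 2 * Q * (s + k)       ∎
  -- With at most `k` edges, pieces cannot be grown; the summand `k` of the constant absorbs these
  -- graphs entirely.
  ... | inj₂ E≤k = begin
    2 * Q * negSub G w allEdges                  ≡⟨ cong (2 * Q *_) (negatives w) ⟩
    2 * Q * negs w (es t)
      ≤⟨ *-monoʳ-≤ (2 * Q) (≤-trans (negs≤length w (es t)) (≤-reflexive (trans (length-es t) (sym edges)))) ⟩
    2 * Q * numEdges G                           ≤⟨ *-monoʳ-≤ (2 * Q) (≤-trans E≤k (m≤n+m k s)) ⟩
    2 * Q * (s + k)                              ≤⟨ m≤n+m _ _ ⟩
    (P + Q) * numEdges G + 2 * Q * (s + k)       ∎

-- Giving the slack `c` explicitly turns an inequality of polynomials into an identity for the ring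
-- solver.
≤-by : ∀ {a b} c → a + c ≡ b → a ≤ b
≤-by {a} c eq = subst (a ≤_) eq (m≤m+n a c)

-- Joining graphs at their roots

sumℕ-↑ : ∀ m {n} (f : Fin (m + n) → ℕ) → sumℕ f ≡ sumℕ (λ i → f (i ↑ˡ n)) + sumℕ (λ j → f (m ↑ʳ j))
sumℕ-↑ zero    f = refl
sumℕ-↑ (suc m) f = trans (cong (λ z → f zero + z) (sumℕ-↑ m (f ∘ suc))) (sym (+-assoc (f zero) _ _))

sumℕ-head : ∀ {n} (f : Fin (suc n) → ℕ) → (∀ i → f (suc i) ≡ 0) → sumℕ f ≡ f zero
sumℕ-head {n} f tail≡0 = trans (cong (λ z → f zero + z) (trans (sumℕ-cong tail≡0) (sumℕ-zero n))) (+-identityʳ (f zero))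

isZero : ∀ {n} → Fin n → Bool
isZero zero    = true
isZero (suc _) = false

joinAdj : ∀ {a b} → Graph (suc a) → Graph (suc b) → (x y : Fin (suc a) ⊎ Fin (suc b)) → Bool
joinAdj G H (inj₁ i) (inj₁ j) = adj G i j
joinAdj G H (inj₂ i) (inj₂ j) = adj H i j
joinAdj G H (inj₁ i) (inj₂ j) = isZero i ∧ isZero j
joinAdj G H (inj₂ i) (inj₁ j) = isZero i ∧ isZero j

joinAdj-sym : ∀ {a b} (G : Graph (suc a)) (H : Graph (suc b)) x y → joinAdj G H x y ≡ joinAdj G H y x
joinAdj-sym G H (inj₁ i) (inj₁ j) = Graph.sym G i j
joinAdj-sym G H (inj₂ i) (inj₂ j) = Graph.sym H i j
joinAdj-sym G H (inj₁ i) (inj₂ j) = ∧-comm (isZero i) (isZero j)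
joinAdj-sym G H (inj₂ i) (inj₁ j) = ∧-comm (isZero i) (isZero j)

joinAdj-irr : ∀ {a b} (G : Graph (suc a)) (H : Graph (suc b)) x → joinAdj G H x x ≡ false
joinAdj-irr G H (inj₁ i) = irr G i
joinAdj-irr G H (inj₂ i) = irr H i

-- The root of a graph is always the vertex zero.
join : ∀ {a b} → Graph (suc a) → Graph (suc b) → Graph (suc a + suc b)
join {a} G H = record
  { adj = λ i j → joinAdj G H (splitAt (suc a) i) (splitAt (suc a) j)
  ; sym = λ i j → joinAdj-sym G H (splitAt (suc a) i) (splitAt (suc a) j)
  ; irr = λ i → joinAdj-irr G H (splitAt (suc a) i) }

joinSign : ∀ {a b} → Sign → Weighing (suc a) → Weighing (suc b) → (x y : Fin (suc a) ⊎ Fin (suc b)) → Sign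
joinSign σ w v (inj₁ i) (inj₁ j) = w i j
joinSign σ w v (inj₂ i) (inj₂ j) = v i j
joinSign σ w v _        _        = σ

joinWeighing : ∀ {a b} → Sign → Weighing (suc a) → Weighing (suc b) → Weighing (suc a + suc b)
joinWeighing {a} σ w v i j = joinSign σ w v (splitAt (suc a) i) (splitAt (suc a) j)

data Side m {n} : Fin (m + n) → Set where
  left  : ∀ i → Side m (i ↑ˡ n)
  right : ∀ j → Side m (m ↑ʳ j)

side : ∀ m {n} (x : Fin (m + n)) → Side m x
side zero    x       = right x
side (suc m) zero    = left zero
side (suc m) (suc x) with side m x
... | left i  = left (suc i)
... | right j = right j

m+<ᵇ : ∀ m a b → (m + a ℕ.<ᵇ m + b) ≡ (a ℕ.<ᵇ b)
m+<ᵇ zero    a b = refl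
m+<ᵇ (suc m) a b = m+<ᵇ m a b

<ᵇ-left-right : ∀ {m} (i : Fin m) b → (toℕ i ℕ.<ᵇ m + b) ≡ true
<ᵇ-left-right zero    b = refl
<ᵇ-left-right (suc i) b = <ᵇ-left-right i b

<ᵇ-right-left : ∀ {m} (i : Fin m) b → (m + b ℕ.<ᵇ toℕ i) ≡ false
<ᵇ-right-left zero    b = refl
<ᵇ-right-left (suc i) b = <ᵇ-right-left i b

module Join {a b : ℕ} (G : Graph (suc a)) (H : Graph (suc b)) where

  J : Graph (suc a + suc b)
  J = join G H

  ιL : Fin (suc a) → Fin (suc a + suc b)
  ιL i = i ↑ˡ suc b

  ιR : Fin (suc b) → Fin (suc a + suc b)
  ιR j = suc a ↑ʳ j

  split-L : ∀ i → splitAt (suc a) (ιL i) ≡ inj₁ i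
  split-L i = Finₚ.splitAt-↑ˡ (suc a) i (suc b)

  split-R : ∀ j → splitAt (suc a) (ιR j) ≡ inj₂ j
  split-R j = Finₚ.splitAt-↑ʳ (suc a) (suc b) j

  adj-LL : ∀ i j → adj J (ιL i) (ιL j) ≡ adj G i j
  adj-LL i j = cong₂ (joinAdj G H) (split-L i) (split-L j)

  adj-RR : ∀ i j → adj J (ιR i) (ιR j) ≡ adj H i j
  adj-RR i j = cong₂ (joinAdj G H) (split-R i) (split-R j)

  adj-LR : ∀ i j → adj J (ιL i) (ιR j) ≡ isZero i ∧ isZero j
  adj-LR i j = cong₂ (joinAdj G H) (split-L i) (split-R j)

  adj-RL : ∀ i j → adj J (ιR i) (ιL j) ≡ isZero i ∧ isZero j
  adj-RL i j = cong₂ (joinAdj G H) (split-R i) (split-L j)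

  module _ (S : EdgeSet (suc a + suc b)) where

    SL : EdgeSet (suc a)
    SL i j = S (ιL i) (ιL j)

    SR : EdgeSet (suc b)
    SR i j = S (ιR i) (ιR j)

    bridge : Bool
    bridge = S (ιL zero) (ιR zero)

    inE-LL : ∀ i j → inE J S (ιL i) (ιL j) ≡ inE G SL i j
    inE-LL i j rewrite Finₚ.toℕ-↑ˡ i (suc b) | Finₚ.toℕ-↑ˡ j (suc b) | adj-LL i j = refl

    inE-RR : ∀ i j → inE J S (ιR i) (ιR j) ≡ inE H SR i j
    inE-RR i j rewrite Finₚ.toℕ-↑ʳ a i | Finₚ.toℕ-↑ʳ a j | adj-RR i j | m+<ᵇ a (toℕ i) (toℕ j) = refl

    inE-LR : ∀ i j → inE J S (ιL i) (ιR j) ≡ (isZero i ∧ isZero j) ∧ S (ιL i) (ιR j)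
    inE-LR i j rewrite Finₚ.toℕ-↑ˡ i (suc b) | Finₚ.toℕ-↑ʳ a j | adj-LR i j | <ᵇ-left-right i (toℕ j) = refl

    inE-RL : ∀ i j → inE J S (ιR i) (ιL j) ≡ false
    inE-RL i j rewrite Finₚ.toℕ-↑ˡ j (suc b) | Finₚ.toℕ-↑ʳ a i | <ᵇ-right-left j (toℕ i) = refl

    adjSub-LL : ∀ i j → adjSub J S (ιL i) (ιL j) ≡ adjSub G SL i j
    adjSub-LL i j = cong₂ (λ p q → T (p ∨ q)) (inE-LL i j) (inE-LL j i)

    adjSub-RR : ∀ i j → adjSub J S (ιR i) (ιR j) ≡ adjSub H SR i j
    adjSub-RR i j = cong₂ (λ p q → T (p ∨ q)) (inE-RR i j) (inE-RR j i)

    cross : Fin (suc a) → Fin (suc b) → Bool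
    cross i j = (isZero i ∧ isZero j) ∧ S (ιL i) (ιR j)

    cross⁻ : ∀ i j → T (cross i j ∨ false) → i ≡ zero × j ≡ zero × T bridge
    cross⁻ zero zero t with S (ιL zero) (ιR zero)
    ... | true = refl , refl , tt

    adjSub-LR⁻ : ∀ i j → adjSub J S (ιL i) (ιR j) → i ≡ zero × j ≡ zero × T bridge
    adjSub-LR⁻ i j e = cross⁻ i j (subst T (cong₂ _∨_ (inE-LR i j) (inE-RL j i)) e)

    adjSub-RL⁻ : ∀ i j → adjSub J S (ιR j) (ιL i) → i ≡ zero × j ≡ zero × T bridge
    adjSub-RL⁻ i j e = adjSub-LR⁻ i j (subst T (∨-comm (inE J S (ιR j) (ιL i)) (inE J S (ιL i) (ιR j))) e)

    bridge⇒adjSub : T bridge → adjSub J S (ιL zero) (ιR zero)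
    bridge⇒adjSub t with S (ιL zero) (ιR zero) | inE-LR zero zero
    ... | true | eq = subst (λ p → T (p ∨ inE J S (ιR zero) (ιL zero))) (sym eq) tt

    πL : Fin (suc a + suc b) → Fin (suc a)
    πL x = [ id , const zero ]′ (splitAt (suc a) x)

    πR : Fin (suc a + suc b) → Fin (suc b)
    πR x = [ const zero , id ]′ (splitAt (suc a) x)

    πL-L : ∀ i → πL (ιL i) ≡ i
    πL-L i = cong [ id , const zero ]′ (split-L i)

    πL-R : ∀ j → πL (ιR j) ≡ zero
    πL-R j = cong [ id , const zero ]′ (split-R j)

    πR-L : ∀ i → πR (ιL i) ≡ zero
    πR-L i = cong [ const zero , id ]′ (split-L i)

    πR-R : ∀ j → πR (ιR j) ≡ j
    πR-R j = cong [ const zero , id ]′ (split-R j)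

    Star-≡ : ∀ {n} {P : Fin n → Fin n → Set} {x y x′ y′} → x′ ≡ x → y′ ≡ y → Star P x y → Star P x′ y′
    Star-≡ refl refl path = path

    -- Contract the right part to the root of the left one. The bridge joins the two roots, so it
    -- becomes a stationary step, and a path of the join becomes a path of the left part.
    project-L : ∀ {x y} → Star (adjSub J S) x y → Star (adjSub G SL) (πL x) (πL y)
    project-L = kleisliStar πL λ {x} {y} → step (side (suc a) x) (side (suc a) y)
      where
      step : ∀ {x y} → Side (suc a) x → Side (suc a) y → adjSub J S x y → Star (adjSub G SL) (πL x) (πL y)
      step (left i)  (left j)  e = Star-≡ (πL-L i) (πL-L j) (subst id (adjSub-LL i j) e ◅ ε)
      step (left i)  (right j) e with refl , refl , _ ← adjSub-LR⁻ i j e = Star-≡ (πL-L i) (πL-R j) ε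
      step (right j) (left i)  e with refl , refl , _ ← adjSub-RL⁻ i j e = Star-≡ (πL-R j) (πL-L i) ε
      step (right i) (right j) e = Star-≡ (πL-R i) (πL-R j) ε

    project-R : ∀ {x y} → Star (adjSub J S) x y → Star (adjSub H SR) (πR x) (πR y)
    project-R = kleisliStar πR λ {x} {y} → step (side (suc a) x) (side (suc a) y)
      where
      step : ∀ {x y} → Side (suc a) x → Side (suc a) y → adjSub J S x y → Star (adjSub H SR) (πR x) (πR y)
      step (left i)  (left j)  e = Star-≡ (πR-L i) (πR-L j) ε
      step (left i)  (right j) e with refl , refl , _ ← adjSub-LR⁻ i j e = Star-≡ (πR-L i) (πR-R j) ε
      step (right j) (left i)  e with refl , refl , _ ← adjSub-RL⁻ i j e = Star-≡ (πR-R j) (πR-L i) ε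
      step (right i) (right j) e = Star-≡ (πR-R i) (πR-R j) (subst id (adjSub-RR i j) e ◅ ε)

    L-R-bridge : ∀ i j → Star (adjSub J S) (ιL i) (ιR j) → T bridge
    L-R-bridge i j path = go (side (suc a) (ιL i)) (split-L i) path
      where
      go : ∀ {x i} → Side (suc a) x → splitAt (suc a) x ≡ inj₁ i → Star (adjSub J S) x (ιR j) → T bridge
      go sx eq ε with trans (sym eq) (split-R j)
      ... | ()
      go (right x) eq (_ ◅ _) with trans (sym eq) (split-R x)
      ... | ()
      go (left x) eq (_◅_ {j = y} e path) with side (suc a) y
      ... | left y′  = go (left y′) (split-L y′) path
      ... | right y′ = proj₂ (proj₂ (adjSub-LR⁻ x y′ e))

    R-L-bridge : ∀ i j → Star (adjSub J S) (ιR j) (ιL i) → T bridge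
    R-L-bridge i j path = go (side (suc a) (ιR j)) (split-R j) path
      where
      go : ∀ {x j} → Side (suc a) x → splitAt (suc a) x ≡ inj₂ j → Star (adjSub J S) x (ιL i) → T bridge
      go sx eq ε with trans (sym eq) (split-L i)
      ... | ()
      go (left x) eq (_ ◅ _) with trans (sym eq) (split-L x)
      ... | ()
      go (right x) eq (_◅_ {j = y} e path) with side (suc a) y
      ... | right y′ = go (right y′) (split-R y′) path
      ... | left y′  = proj₂ (proj₂ (adjSub-RL⁻ y′ x e))

    inV-L : ∀ {i} → inVSub G SL i → inVSub J S (ιL i)
    inV-L {i} (j , e) = ιL j , subst id (sym (adjSub-LL j i)) e

    inV-R : ∀ {i} → inVSub H SR i → inVSub J S (ιR i)
    inV-R {i} (j , e) = ιR j , subst id (sym (adjSub-RR j i)) e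

    sumEdges-join : ∀ h → sumEdges J S h ≡ sumEdges G SL (λ i j → h (ιL i) (ιL j)) +
      sumEdges H SR (λ i j → h (ιR i) (ιR j)) + (if bridge then h (ιL zero) (ιR zero) else 0)
    sumEdges-join h = begin
      sumEdges J S h                                           ≡⟨ sumℕ-↑ (suc a) row ⟩
      sumℕ (λ i → row (ιL i)) + sumℕ (λ i → row (ιR i))          ≡⟨ cong₂ _+_ (sumℕ-cong row-L) (sumℕ-cong row-R) ⟩
      sumℕ (λ i → rowG i + rowX i) + sumℕ rowH                 ≡⟨ cong (_+ sumℕ rowH) (sumℕ-+ rowG rowX) ⟩
      (sumℕ rowG + sumℕ rowX) + sumℕ rowH
        ≡⟨ cong (λ x → (sumℕ rowG + x) + sumℕ rowH) (sumℕ-head rowX λ i → sumℕ-zero (suc b)) ⟩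
      (sumℕ rowG + rowX zero) + sumℕ rowH
        ≡⟨ cong (λ x → (sumℕ rowG + x) + sumℕ rowH) (sumℕ-head {b} (λ j → if cross zero j then h (ιL zero) (ιR j) else 0) λ j → refl) ⟩
      (sumℕ rowG + entry) + sumℕ rowH                          ≡⟨ swap (sumℕ rowG) entry (sumℕ rowH) ⟩
      (sumℕ rowG + sumℕ rowH) + entry                          ∎
      where
      open ≡-Reasoning
      row : Fin (suc a + suc b) → ℕ
      row x = sumℕ (λ y → if inE J S x y then h x y else 0)
      rowG : Fin (suc a) → ℕ
      rowG i = sumℕ (λ j → if inE G SL i j then h (ιL i) (ιL j) else 0)
      rowH : Fin (suc b) → ℕ
      rowH i = sumℕ (λ j → if inE H SR i j then h (ιR i) (ιR j) else 0)
      rowX : Fin (suc a) → ℕ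
      rowX i = sumℕ (λ j → if cross i j then h (ιL i) (ιR j) else 0)
      entry : ℕ
      entry = if bridge then h (ιL zero) (ιR zero) else 0
      swap : ∀ x y z → (x + y) + z ≡ (x + z) + y
      swap = solve-∀
      row-L : ∀ i → row (ιL i) ≡ rowG i + rowX i
      row-L i = trans (sumℕ-↑ (suc a) (λ y → if inE J S (ιL i) y then h (ιL i) y else 0)) (cong₂ _+_
        (sumℕ-cong λ j → cong (if_then h (ιL i) (ιL j) else 0) (inE-LL i j))
        (sumℕ-cong λ j → cong (if_then h (ιL i) (ιR j) else 0) (inE-LR i j)))
      row-R : ∀ i → row (ιR i) ≡ rowH i
      row-R i = trans (sumℕ-↑ (suc a) (λ y → if inE J S (ιR i) y then h (ιR i) y else 0)) (cong₂ _+_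
        (trans (sumℕ-cong λ j → cong (if_then h (ιR i) (ιL j) else 0) (inE-RL i j)) (sumℕ-zero (suc a)))
        (sumℕ-cong λ j → cong (if_then h (ιR i) (ιR j) else 0) (inE-RR i j)))

-- Acyclicity, connectedness and degrees of joins

argmax : ∀ {n} (g : Fin (suc n) → ℕ) → ∃ λ i → ∀ j → g j ≤ g i
argmax {zero}  g = zero , λ { zero → ≤-refl }
argmax {suc n} g with argmax (g ∘ suc)
... | i , max with ≤-total (g zero) (g (suc i))
... | inj₁ le = suc i , λ { zero → le ; (suc j) → max j }
... | inj₂ ge = zero , λ { zero → ≤-refl ; (suc j) → ≤-trans (max j) ge }

cycle-neighbours : ∀ {n} (G : Graph n) {l} (f : Fin (3 + l) → Fin n) →
  (∀ (i : Fin (2 + l)) → T (adj G (f (inject₁ i)) (f (suc i)))) → T (adj G (f (fromℕ (2 + l))) (f zero)) →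
  ∀ i → ∃₂ λ j k → j ≢ k × T (adj G (f i) (f j)) × T (adj G (f i) (f k))
cycle-neighbours G f edges closing zero = suc zero , fromℕ _ , (λ ()) , edges zero , subst T (Graph.sym G _ _) closing
cycle-neighbours G {l} f edges closing (suc i) with view i
... | ‵fromℕ     = inject₁ (fromℕ (suc l)) , zero , (λ ()) , subst T (Graph.sym G _ _) (edges (fromℕ (suc l))) , closing
... | ‵inject₁ j = inject₁ (inject₁ j) , suc (suc j) ,
  (λ eq → m≢1+m+n (toℕ j) {1} (trans (sym (trans (Finₚ.toℕ-inject₁ (inject₁ j)) (Finₚ.toℕ-inject₁ j)))
      (trans (cong toℕ eq) (cong suc (+-comm 1 (toℕ j)))))) ,
  subst T (Graph.sym G _ _) (edges (inject₁ j)) , edges (suc j)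

-- Only one neighbour of each vertex is not above it: a highest vertex of a cycle would have two.
record Ranking {n} (G : Graph (suc n)) : Set where
  field
    rank       : Fin (suc n) → ℕ
    rank-root  : rank zero ≡ 0
    above-root : ∀ v → T (adj G zero v) → 0 < rank v
    unique     : ∀ v {x y} → T (adj G v x) → T (adj G v y) → rank x ≤ rank v → rank y ≤ rank v → x ≡ y

Ranking⇒acyclic : ∀ {n} {G : Graph (suc n)} → Ranking G → ¬ HasCycle G
Ranking⇒acyclic {G = G} ranking (l , f , f-inj , edges , closing) with argmax (Ranking.rank ranking ∘ f)
... | i , max with cycle-neighbours G f edges closing i
... | j , k , j≢k , ij , ik = j≢k (f-inj (Ranking.unique ranking (f i) ij ik (max j) (max k)))

module _ {a b : ℕ} {G : Graph (suc a)} {H : Graph (suc b)} where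
  open Join G H

  adj-cross⁻ : ∀ i j → T (isZero {suc a} i ∧ isZero {suc b} j) → i ≡ zero × j ≡ zero
  adj-cross⁻ zero zero _ = refl , refl

  -- Ranks on the right are raised by one, so the rank is the depth below the common root. The
  -- bridge leads upwards from the left root, and it is the only edge at the right root that does
  -- not: `above-root` in `H` excludes the others.
  join-ranking : Ranking G → Ranking H → Ranking J
  join-ranking rG rH = record { rank = rank ; rank-root = RG.rank-root ; above-root = above ; unique = uniq }
    where
    module RG = Ranking rG
    module RH = Ranking rH
    rank : Fin (suc a + suc b) → ℕ
    rank x = [ RG.rank , suc ∘ RH.rank ]′ (splitAt (suc a) x)
    rank-L : ∀ i → rank (ιL i) ≡ RG.rank i
    rank-L i = cong [ RG.rank , suc ∘ RH.rank ]′ (split-L i)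
    rank-R : ∀ j → rank (ιR j) ≡ suc (RH.rank j)
    rank-R j = cong [ RG.rank , suc ∘ RH.rank ]′ (split-R j)
    above : ∀ v → T (adj J (ιL zero) v) → 0 < rank v
    above v e with side (suc a) v
    ... | left i  = subst (0 <_) (sym (rank-L i)) (RG.above-root i (subst T (adj-LL zero i) e))
    ... | right j = subst (0 <_) (sym (rank-R j)) (s≤s z≤n)
    lower-L : ∀ i x → T (adj J (ιL i) x) → rank x ≤ rank (ιL i) → ∃ λ x′ → x ≡ ιL x′ × T
        (adj G i x′) × RG.rank x′ ≤ RG.rank i
    lower-L i x e le with side (suc a) x
    ... | left x′  = x′ , refl , subst T (adj-LL i x′) e , subst₂ _≤_ (rank-L x′) (rank-L i) le
    ... | right x′ with refl , refl ← adj-cross⁻ i x′ (subst T (adj-LR i x′) e) =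
      contradiction (subst₂ _≤_ (rank-R zero) RG.rank-root le) λ ()
    lower-R : ∀ j x → T (adj J (ιR j) x) → rank x ≤ rank (ιR j) →
      (j ≡ zero × x ≡ ιL zero) ⊎ (∃ λ x′ → x ≡ ιR x′ × T (adj H j x′) × RH.rank x′ ≤ RH.rank j)
    lower-R j x e le with side (suc a) x
    ... | left x′  with refl , refl ← adj-cross⁻ x′ j (subst T (trans (adj-RL j x′) (∧-comm (isZero j) (isZero x′))) e) = inj₁ (refl , refl)
    ... | right x′ = inj₂ (x′ , refl , subst T (adj-RR j x′) e , ≤-pred (subst₂ _≤_ (rank-R x′) (rank-R j) le))
    clash : ∀ {x} → T (adj H zero x) → RH.rank x ≤ RH.rank zero → ⊥
    clash {x} e le = <⇒≱ (RH.above-root x e) (subst (RH.rank x ≤_) RH.rank-root le)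
    uniq : ∀ v {x y} → T (adj J v x) → T (adj J v y) → rank x ≤ rank v → rank y ≤ rank v → x ≡ y
    uniq v {x} {y} ex ey lx ly with side (suc a) v
    uniq v {x} {y} ex ey lx ly | left i
      with x′ , refl , ex′ , lx′ ← lower-L i x ex lx | y′ , refl , ey′ , ly′ ← lower-L i y ey ly = cong ιL
          (RG.unique i ex′ ey′ lx′ ly′)
    uniq v {x} {y} ex ey lx ly | right j with lower-R j x ex lx | lower-R j y ey ly
    ... | inj₁ (_ , refl)                | inj₁ (_ , refl)                = refl
    ... | inj₁ (refl , _)                | inj₂ (_ , _ , ey′ , ly′)       = ⊥-elim (clash ey′ ly′)
    ... | inj₂ (_ , _ , ex′ , lx′)       | inj₁ (refl , _)                = ⊥-elim (clash ex′ lx′)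
    ... | inj₂ (x′ , refl , ex′ , lx′)   | inj₂ (y′ , refl , ey′ , ly′)   = cong ιR (RH.unique j ex′ ey′ lx′ ly′)

  join-connected : Connected G → Connected H → Connected J
  join-connected cG cH x y = to-root x ◅◅ reverse (λ {u} {v} → subst T (Graph.sym J u v)) (to-root y)
    where
    to-root : ∀ x → Star (λ i j → T (adj J i j)) x (ιL zero)
    to-root x with side (suc a) x
    ... | left i  = gmap ιL (λ {u} {v} → subst T (sym (adj-LL u v))) (cG i zero)
    ... | right j = gmap ιR (λ {u} {v} → subst T (sym (adj-RR u v))) (cH j zero) ◅◅ subst T (sym (adj-RL zero zero)) tt ◅ ε

  indicator : Bool → ℕ
  indicator c = if c then 1 else 0

  degree-L : ∀ i → degree J (ιL i) ≡ degree G i + indicator (isZero i)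
  degree-L i = trans (sumℕ-↑ (suc a) (λ y → indicator (adj J (ιL i) y))) (cong₂ _+_
    (sumℕ-cong λ j → cong indicator (adj-LL i j))
    (trans (sumℕ-cong λ j → cong indicator (adj-LR i j)) (col i)))
    where
    col : ∀ i → sumℕ (λ j → indicator (isZero {suc a} i ∧ isZero {suc b} j)) ≡ indicator (isZero i)
    col zero    = sumℕ-head {b} (indicator ∘ isZero) λ _ → refl
    col (suc i) = sumℕ-zero (suc b)

  degree-R : ∀ j → degree J (ιR j) ≡ indicator (isZero j) + degree H j
  degree-R j = trans (sumℕ-↑ (suc a) (λ y → indicator (adj J (ιR j) y))) (cong₂ _+_
    (trans (sumℕ-cong λ i → cong indicator (adj-RL j i)) (row j))
    (sumℕ-cong λ i → cong indicator (adj-RR j i)))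
    where
    row : ∀ j → sumℕ (λ i → indicator (isZero {suc b} j ∧ isZero {suc a} i)) ≡ indicator (isZero j)
    row zero    = sumℕ-head {a} (indicator ∘ isZero) λ _ → refl
    row (suc j) = sumℕ-zero (suc a)

-- Counting signs across a join

countSub : ∀ {n} → (Sign → ℕ) → Graph n → Weighing n → EdgeSet n → ℕ
countSub φ G w S = sumEdges G S λ i j → φ (w i j)

posBit : Sign → ℕ
posBit Sign.+ = 1
posBit Sign.- = 0

sumEdges-cong : ∀ {n} (G : Graph n) S {h h′} → (∀ i j → h i j ≡ h′ i j) → sumEdges G S h ≡ sumEdges G S h′
sumEdges-cong G S eq = sumℕ-cong λ i → sumℕ-cong λ j → cong (λ x → if inE G S i j then x else 0) (eq i j)

sumEdges-empty : ∀ {n} (G : Graph n) S h → (∀ i j → ¬ T (inE G S i j)) → sumEdges G S h ≡ 0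
sumEdges-empty {n} G S h empty = trans (sumℕ-cong λ i → trans (sumℕ-cong λ j → entry i j) (sumℕ-zero n)) (sumℕ-zero n)
  where
  entry : ∀ i j → (if inE G S i j then h i j else 0) ≡ 0
  entry i j with inE G S i j | empty i j
  ... | false | _  = refl
  ... | true  | absent = ⊥-elim (absent tt)

numEdgesSub-pos-neg : ∀ {n} (G : Graph n) w S → numEdgesSub G S ≡ countSub posBit G w S + negSub G w S
numEdgesSub-pos-neg G w S = trans (sumℕ-cong λ i → trans (sumℕ-cong λ j → bit (inE G S i j) (w i j))
    (sumℕ-+ (λ j → if inE G S i j then posBit (w i j) else 0) _))
  (sumℕ-+ (λ i → sumℕ λ j → if inE G S i j then posBit (w i j) else 0) _)
  where
  bit : ∀ e s → (if e then 1 else 0) ≡ (if e then posBit s else 0) + (if e then negBit s else 0)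
  bit false s      = refl
  bit true  Sign.+ = refl
  bit true  Sign.- = refl

module _ {a b : ℕ} {G : Graph (suc a)} {H : Graph (suc b)} (σ : Sign) (w : Weighing (suc a)) (v : Weighing (suc b)) where
  open Join G H

  count-join : ∀ φ S → countSub φ J (joinWeighing σ w v) S ≡
    countSub φ G w (SL S) + countSub φ H v (SR S) + (if bridge S then φ σ else 0)
  count-join φ S = trans (sumEdges-join S (λ i j → φ (joinWeighing σ w v i j))) (cong₂ _+_ (cong₂ _+_
    (sumEdges-cong G (SL S) λ i j → cong φ (cong₂ (joinSign σ w v) (split-L i) (split-L j)))
    (sumEdges-cong H (SR S) λ i j → cong φ (cong₂ (joinSign σ w v) (split-R i) (split-R j))))
    (cong (λ x → if bridge S then φ x else 0) (cong (joinSign σ w v (inj₁ zero)) (split-R zero))))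

  count-bridge : ∀ φ S → T (bridge S) → countSub φ J (joinWeighing σ w v) S ≡
    countSub φ G w (SL S) + countSub φ H v (SR S) + φ σ
  count-bridge φ S t with bridge S | count-join φ S
  ... | true | eq = eq

  count-no-bridge : ∀ φ S → ¬ T (bridge S) → countSub φ J (joinWeighing σ w v) S ≡
    countSub φ G w (SL S) + countSub φ H v (SR S)
  count-no-bridge φ S f with bridge S | count-join φ S
  ... | false | eq = trans eq (+-identityʳ _)
  ... | true  | _  = ⊥-elim (f tt)

-- Graphs of shapes

data Shape : Set where
  tip  : Shape
  node : Sign → Shape → Shape → Shape

-- The sum is arranged so that `suc (edgeCount (node σ S R))` computes to the number of vertices of
-- the join.
edgeCount : Shape → ℕ
edgeCount tip          = 0
edgeCount (node _ S R) = edgeCount R + suc (edgeCount S)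

-- node σ S R hangs S from the root of R by an edge of sign σ.
graph : ∀ sh → Graph (suc (edgeCount sh))
graph tip          = record { adj = λ _ _ → false ; sym = λ _ _ → refl ; irr = λ _ → refl }
graph (node _ S R) = join (graph R) (graph S)

signs : ∀ sh → Weighing (suc (edgeCount sh))
signs tip          = λ _ _ → Sign.+
signs (node σ S R) = joinWeighing σ (signs R) (signs S)

total : (Sign → ℕ) → Shape → ℕ
total φ tip          = 0
total φ (node σ S R) = total φ R + total φ S + φ σ

count-all : ∀ φ sh → countSub φ (graph sh) (signs sh) allEdges ≡ total φ sh
count-all φ tip          = refl
count-all φ (node σ S R) = trans (count-join σ (signs R) (signs S) φ allEdges)
  (cong (_+ φ σ) (cong₂ _+_ (count-all φ R) (count-all φ S)))

graph-connected : ∀ sh → Connected (graph sh)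
graph-connected tip zero zero = ε
graph-connected (node _ S R)  = join-connected (graph-connected R) (graph-connected S)

graph-ranking : ∀ sh → Ranking (graph sh)
graph-ranking tip          = record { rank = λ _ → 0 ; rank-root = refl ; above-root = λ _ () ; unique = λ _ () }
graph-ranking (node _ S R) = join-ranking (graph-ranking R) (graph-ranking S)

graph-tree : ∀ sh → IsTree (graph sh)
graph-tree sh = graph-connected sh , Ranking⇒acyclic (graph-ranking sh)

arity : Shape → ℕ
arity tip          = 0
arity (node _ _ R) = suc (arity R)

-- `node` adds a branch at the root of `R`, so `arity R ≤ 1` allows at most two branches at each
-- vertex; with the edge towards the root this means degree at most three.
Binary : Shape → Set
Binary tip          = ⊤
Binary (node _ S R) = arity R ≤ 1 × Binary S × Binary R

degree-root : ∀ sh → degree (graph sh) zero ≡ arity sh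
degree-root tip          = refl
degree-root (node _ S R) = trans (degree-L {G = graph R} {H = graph S} zero)
    (trans (cong (_+ 1) (degree-root R)) (+-comm (arity R) 1))

arity≤2 : ∀ sh → Binary sh → arity sh ≤ 2
arity≤2 tip          _       = z≤n
arity≤2 (node _ _ R) (le , _) = s≤s le

Binary⇒MaxDeg3 : ∀ sh → Binary sh → MaxDegAtMost 3 (graph sh)
Binary⇒MaxDeg3 tip          _ zero = z≤n
Binary⇒MaxDeg3 (node _ S R) (le , binS , binR) v with side (suc (edgeCount R)) v
... | left zero    = ≤-trans (≤-reflexive (degree-root (node Sign.+ S R))) (s≤s (≤-trans le (s≤s z≤n)))
... | left (suc i) = ≤-trans (≤-reflexive (trans (degree-L {G = graph R} {H = graph S} (suc i)) (+-identityʳ _)))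
    (Binary⇒MaxDeg3 R binR (suc i))
... | right zero   = ≤-trans (≤-reflexive (trans (degree-R {G = graph R} {H = graph S} zero)
    (cong suc (degree-root S)))) (s≤s (arity≤2 S binS))
... | right (suc j) = ≤-trans (≤-reflexive (degree-R {G = graph R} {H = graph S} (suc j))) (Binary⇒MaxDeg3 S binS (suc j))

-- Connected subgraphs of shapes

data Rooted : Shape → ℕ → ℕ → Set where
  none : Rooted tip 0 0
  skip : ∀ {σ S R p n} → Rooted R p n → Rooted (node σ S R) p n
  take : ∀ {σ S R p n p′ n′} → Rooted R p n → Rooted S p′ n′ →
    Rooted (node σ S R) (p + p′ + posBit σ) (n + n′ + negBit σ)

-- Numbers of positive and negative edges of a connected subgraph; Rooted: of one that is empty or contains the root.
data Piece : Shape → ℕ → ℕ → Set where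
  rooted : ∀ {sh p n} → Rooted sh p n → Piece sh p n
  beside : ∀ {σ S R p n} → Piece R p n → Piece (node σ S R) p n
  below  : ∀ {σ S R p n} → Piece S p n → Piece (node σ S R) p n

ReachesRoot : ∀ {n} → Graph (suc n) → EdgeSet (suc n) → Set
ReachesRoot G S = ∀ v → inVSub G S v → Star (adjSub G S) v zero

module _ {a b : ℕ} (G : Graph (suc a)) (H : Graph (suc b)) where
  open Join G H

  ReachesRoot-L : ∀ S → ReachesRoot J S → ReachesRoot G (SL S)
  ReachesRoot-L S reach v v∈ = Star-≡ S (sym (πL-L S v)) refl (project-L S (reach (ιL v) (inV-L S v∈)))

  ReachesRoot-R : ∀ S → ReachesRoot J S → ReachesRoot H (SR S)
  ReachesRoot-R S reach v v∈ = Star-≡ S (sym (πR-R S v)) refl (project-R S (reach (ιR v) (inV-R S v∈)))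

  ConnectedSub-L : ∀ S → ConnectedSub J S → ConnectedSub G (SL S)
  ConnectedSub-L S conn u v u∈ v∈ = Star-≡ S (sym (πL-L S u)) (sym (πL-L S v))
    (project-L S (conn (ιL u) (ιL v) (inV-L S u∈) (inV-L S v∈)))

  ConnectedSub-R : ∀ S → ConnectedSub J S → ConnectedSub H (SR S)
  ConnectedSub-R S conn u v u∈ v∈ = Star-≡ S (sym (πR-R S u)) (sym (πR-R S v))
    (project-R S (conn (ιR u) (ιR v) (inV-R S u∈) (inV-R S v∈)))

  bridge⇒ReachesRoot : ∀ S → T (bridge S) → ConnectedSub J S → ReachesRoot J S
  bridge⇒ReachesRoot S t conn v v∈ = conn v (ιL zero) v∈
    (ιR zero , subst T (∨-comm (inE J S (ιL zero) (ιR zero)) (inE J S (ιR zero) (ιL zero))) (bridge⇒adjSub S t))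

inE⇒inV : ∀ {n} (G : Graph n) S i j → T (inE G S i j) → inVSub G S j
inE⇒inV G S i j t with inE G S i j in eq
... | true = i , subst (λ p → T (p ∨ inE G S j i)) (sym eq) tt

-- Without the bridge no edge of the right part can reach the root, so that part contributes
-- nothing. With it, the projections show that both parts reach their own roots.
rooted-piece : ∀ sh S → ReachesRoot (graph sh) S →
  Rooted sh (countSub posBit (graph sh) (signs sh) S) (countSub negBit (graph sh) (signs sh) S)
rooted-piece tip          E reach = none
rooted-piece (node σ S R) E reach with T? (Join.bridge (graph R) (graph S) E)
... | yes t = subst₂ (Rooted _) (sym (count-bridge σ (signs R) (signs S) posBit E t))
    (sym (count-bridge σ (signs R) (signs S) negBit E t))
  (take (rooted-piece R _ (ReachesRoot-L (graph R) (graph S) E reach)) (rooted-piece S _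
      (ReachesRoot-R (graph R) (graph S) E reach)))
... | no f = subst₂ (Rooted _) (sym (count posBit)) (sym (count negBit))
  (skip (rooted-piece R _ (ReachesRoot-L (graph R) (graph S) E reach)))
  where
  open Join (graph R) (graph S)
  empty : ∀ i j → ¬ T (inE (graph S) (SR E) i j)
  empty i j t = f (R-L-bridge E zero j (reach _ (inV-R E (inE⇒inV (graph S) (SR E) i j t))))
  count : ∀ φ → countSub φ J (signs (node σ S R)) E ≡ countSub φ (graph R) (signs R) (SL E)
  count φ = trans (count-no-bridge σ (signs R) (signs S) φ E f)
    (trans (cong (λ x → countSub φ (graph R) (signs R) (SL E) + x) (sumEdges-empty (graph S) (SR E)
        (λ i j → φ (signs S i j)) empty)) (+-identityʳ _))

-- A connected subgraph containing the bridge contains the root. One without the bridge lies on a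
-- single side, because a path between the sides would use the bridge.
connected-piece : ∀ sh S → ConnectedSub (graph sh) S →
  Piece sh (countSub posBit (graph sh) (signs sh) S) (countSub negBit (graph sh) (signs sh) S)
connected-piece tip          E conn = rooted none
connected-piece (node σ S R) E conn = by-bridge (T? (bridge E))
  where
  open Join (graph R) (graph S)
  by-right : ¬ T (bridge E) → Dec (∃₂ λ i j → T (inE (graph S) (SR E) i j)) → Piece (node σ S R)
      (countSub posBit J (signs (node σ S R)) E) (countSub negBit J (signs (node σ S R)) E)
  by-right f (yes (i , j , t)) = subst₂ (Piece _) (sym (count posBit)) (sym (count negBit))
    (below (connected-piece S _ (ConnectedSub-R (graph R) (graph S) E conn)))
    where
    empty : ∀ x y → ¬ T (inE (graph R) (SL E) x y)
    empty x y t′ = f (L-R-bridge E y j (conn _ _ (inV-L E (inE⇒inV (graph R) (SL E) x y t′))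
        (inV-R E (inE⇒inV (graph S) (SR E) i j t))))
    count : ∀ φ → countSub φ J (signs (node σ S R)) E ≡ countSub φ (graph S) (signs S) (SR E)
    count φ = trans (count-no-bridge σ (signs R) (signs S) φ E f)
      (cong (λ x → x + countSub φ (graph S) (signs S) (SR E)) (sumEdges-empty (graph R) (SL E)
          (λ i j → φ (signs R i j)) empty))
  by-right f (no none-right) = subst₂ (Piece _) (sym (count posBit)) (sym (count negBit))
    (beside (connected-piece R _ (ConnectedSub-L (graph R) (graph S) E conn)))
    where
    count : ∀ φ → countSub φ J (signs (node σ S R)) E ≡ countSub φ (graph R) (signs R) (SL E)
    count φ = trans (count-no-bridge σ (signs R) (signs S) φ E f)
      (trans (cong (λ x → countSub φ (graph R) (signs R) (SL E) + x) (sumEdges-empty (graph S) (SR E)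
          (λ i j → φ (signs S i j)) λ i j t → none-right (i , j , t))) (+-identityʳ _))
  by-bridge : Dec (T (bridge E)) → Piece (node σ S R) (countSub posBit J (signs (node σ S R)) E)
      (countSub negBit J (signs (node σ S R)) E)
  by-bridge (yes t) = rooted (rooted-piece (node σ S R) E (bridge⇒ReachesRoot (graph R) (graph S) E t conn))
  by-bridge (no f)  = by-right f (Finₚ.any? λ i → Finₚ.any? λ j → T? (inE (graph S) (SR E) i j))

-- Among exactly `q + r` edges, at least `q` positive ones leave at most `r` negative ones, so both
-- alternatives give `n ≤ r`. The disjunction, unlike `n ≤ r` alone, can hold for pieces of every
-- size and is therefore suited to induction on the shape.
Piece⇒LocalPositive : ∀ sh {k} q r → k ≡ q + r → r < q → (∀ {p n} → Piece sh p n → n ≤ r ⊎ q ≤ p) →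
  LocalPositive k (graph sh) (signs sh)
Piece⇒LocalPositive sh q r refl r<q few E size≡ conn = weightSub-pos⇐ (graph sh) (signs sh) E
    (subst (2 * N <_) (sym size≡) (begin-strict
  2 * N      ≤⟨ *-monoʳ-≤ 2 N≤r ⟩
  2 * r      ≡⟨ cong (λ z → r + z) (+-identityʳ r) ⟩
  r + r      <⟨ +-monoˡ-< r r<q ⟩
  q + r      ∎))
  where
  open ≤-Reasoning
  P = countSub posBit (graph sh) (signs sh) E
  N = countSub negBit (graph sh) (signs sh) E
  P+N : P + N ≡ q + r
  P+N = trans (sym (numEdgesSub-pos-neg (graph sh) (signs sh) E)) size≡
  N≤r : N ≤ r
  N≤r with few (connected-piece sh E conn)
  ... | inj₁ le = le
  ... | inj₂ q≤P = +-cancelˡ-≤ q N r (≤-trans (+-monoˡ-≤ N q≤P) (≤-reflexive P+N))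

-- The spine with legs

negPath : ℕ → Shape
negPath zero    = tip
negPath (suc r) = node Sign.- (negPath r) tip

leg : ℕ → ℕ → Shape
leg zero    r = negPath r
leg (suc a) r = node Sign.+ (leg a r) tip

-- A positive spine whose vertices carry legs with positive stems of lengths a, a′, a, a′, …, a, each ending in r negative edges.
spine : ℕ → ℕ → ℕ → ℕ → Shape
spine a a′ r zero    = leg a r
spine a a′ r (suc t) = node Sign.+ (node Sign.+ (spine a a′ r t) (leg a′ r)) (leg a r)

negPath-rooted : ∀ r {p n} → Rooted (negPath r) p n → n ≤ r
negPath-rooted zero    none          = z≤n
negPath-rooted (suc r) (skip none)   = z≤n
negPath-rooted (suc r) (take {n′ = n} none c) = ≤-trans (≤-reflexive (+-comm n 1)) (s≤s (negPath-rooted r c))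

-- All negative edges of a leg lie beyond its stem, so reaching one from the root takes the whole
-- stem.
leg-rooted : ∀ a r {p n} → Rooted (leg a r) p n → n ≤ r × (0 < n → a ≤ p)
leg-rooted zero    r c           = negPath-rooted r c , λ _ → z≤n
leg-rooted (suc a) r (skip none) = z≤n , λ ()
leg-rooted (suc a) r (take {p′ = p} {n′ = n} none c) with leg-rooted a r c
... | n≤r , stem = ≤-trans (≤-reflexive (+-identityʳ n)) n≤r ,
  λ 0<n → ≤-trans (s≤s (stem (subst (0 <_) (+-identityʳ n) 0<n))) (≤-reflexive (+-comm 1 p))

tip-piece : ∀ {p n} → Piece tip p n → n ≡ 0
tip-piece (rooted none) = refl

negPath-piece : ∀ r {p n} → Piece (negPath r) p n → n ≤ r
negPath-piece zero    c          = ≤-trans (≤-reflexive (tip-piece c)) z≤n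
negPath-piece (suc r) (rooted c) = negPath-rooted (suc r) c
negPath-piece (suc r) (beside c) = ≤-trans (≤-reflexive (tip-piece c)) z≤n
negPath-piece (suc r) (below c)  = m≤n⇒m≤1+n (negPath-piece r c)

leg-piece : ∀ a r {p n} → Piece (leg a r) p n → n ≤ r
leg-piece zero    r c          = negPath-piece r c
leg-piece (suc a) r (rooted c) = proj₁ (leg-rooted (suc a) r c)
leg-piece (suc a) r (beside c) = ≤-trans (≤-reflexive (tip-piece c)) z≤n
leg-piece (suc a) r (below c)  = leg-piece a r c

module _ (q r : ℕ) where

  -- d bounds from below the distance from the root to the nearest negative edge.
  Guarded : ℕ → Shape → Set
  Guarded d X = ∀ {p n} → Rooted X p n → (n ≤ r ⊎ q ≤ p) × (0 < n → d ≤ p)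

  guarded-leg : ∀ d → Guarded d (leg d r)
  guarded-leg d c with leg-rooted d r c
  ... | n≤r , stem = inj₁ n≤r , stem

  -- A rooted subgraph with negative edges both in the leg and in `X` contains the stem, the joining
  -- edge and at least `d` positive edges of `X`; together these are at least `q` by `far`. With
  -- negative edges in `X` only, it has at least `suc d` positive edges, which `near` compares with
  -- the new guard `e`.
  guarded-node : ∀ {d e X} → Guarded d X → q ≤ suc (d + e) → e ≤ suc d → Guarded e (node Sign.+ X (leg e r))
  guarded-node {e = e} guard far near (skip c) = guarded-leg e c
  guarded-node {d} {e} guard far near (take {p = p} {n = n} {p′ = p′} {n′ = n′} c c′) = cases n n′ (leg-rooted e r c)
      (guard c′)
    where
    open ≤-Reasoning
    p≤ : p ≤ p + p′ + 1
    p≤ = ≤-trans (m≤m+n p p′) (m≤m+n _ 1)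
    p′≤ : suc p′ ≤ p + p′ + 1
    p′≤ = ≤-trans (s≤s (m≤n+m p′ p)) (≤-reflexive (+-comm 1 _))
    cases : ∀ n n′ → n ≤ r × (0 < n → e ≤ p) → (n′ ≤ r ⊎ q ≤ p′) × (0 < n′ → d ≤ p′) →
      (n + n′ + 0 ≤ r ⊎ q ≤ p + p′ + 1) × (0 < n + n′ + 0 → e ≤ p + p′ + 1)
    cases n zero (n≤r , stem) _ = inj₁ (≤-trans (≤-reflexive (trans (+-identityʳ (n + 0)) (+-identityʳ n))) n≤r) ,
      λ 0<n → ≤-trans (stem (subst (0 <_) (trans (+-identityʳ (n + 0)) (+-identityʳ n)) 0<n)) p≤
    cases zero (suc n′) _ (few , stem′) =
      Sum.map (≤-trans (≤-reflexive (+-identityʳ (suc n′)))) (λ q≤ → ≤-trans q≤ (≤-trans (n≤1+n p′) p′≤)) few ,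
      λ _ → ≤-trans near (≤-trans (s≤s (stem′ (s≤s z≤n))) p′≤)
    cases (suc n) (suc n′) (_ , stem) (_ , stem′) = inj₂ (begin
      q              ≤⟨ far ⟩
      suc (d + e)    ≤⟨ s≤s (+-mono-≤ (stem′ (s≤s z≤n)) (stem (s≤s z≤n))) ⟩
      suc (p′ + p)   ≡⟨ rearrange p′ p ⟩
      p + p′ + 1     ∎) , λ _ → ≤-trans (stem (s≤s z≤n)) p≤
      where
      rearrange : ∀ x y → suc (x + y) ≡ y + x + 1
      rearrange = solve-∀

  piece-node : ∀ {e X} → Guarded e (node Sign.+ X (leg e r)) → (∀ {p n} → Piece X p n → n ≤ r ⊎ q ≤ p) →
    ∀ {p n} → Piece (node Sign.+ X (leg e r)) p n → n ≤ r ⊎ q ≤ p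
  piece-node     guard few (rooted c) = proj₁ (guard c)
  piece-node {e} guard few (beside c) = inj₁ (leg-piece e r c)
  piece-node     guard few (below c)  = few c

  -- `far` concerns two consecutive legs. Since the stem lengths differ by at most one, no other leg
  -- has negative edges closer to a spine vertex than its own leg has; so the guard is again the
  -- stem length, and legs further apart need no separate condition.
  spine-guarded : ∀ {a a′} → a ≤ a′ → a′ ≤ suc a → q ≤ suc (a + a′) → ∀ t →
    Guarded a (spine a a′ r t) × (∀ {p n} → Piece (spine a a′ r t) p n → n ≤ r ⊎ q ≤ p)
  spine-guarded {a} a≤ a′≤ far zero    = guarded-leg a , λ c → inj₁ (leg-piece a r c)
  spine-guarded {a} {a′} a≤ a′≤ far (suc t) with spine-guarded a≤ a′≤ far t
  ... | guard , few = outer , piece-node outer (piece-node inner few)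
    where
    inner : Guarded a′ (node Sign.+ (spine a a′ r t) (leg a′ r))
    inner = guarded-node guard far a′≤
    outer : Guarded a (spine a a′ r (suc t))
    outer = guarded-node inner (subst (q ≤_) (cong suc (+-comm a a′)) far) (m≤n⇒m≤1+n a≤)

negPath-arity : ∀ r → arity (negPath r) ≤ 1
negPath-arity zero    = z≤n
negPath-arity (suc r) = s≤s z≤n

leg-arity : ∀ a r → arity (leg a r) ≤ 1
leg-arity zero    r = negPath-arity r
leg-arity (suc a) r = s≤s z≤n

negPath-binary : ∀ r → Binary (negPath r)
negPath-binary zero    = tt
negPath-binary (suc r) = z≤n , negPath-binary r , tt

leg-binary : ∀ a r → Binary (leg a r)
leg-binary zero    r = negPath-binary r
leg-binary (suc a) r = z≤n , leg-binary a r , tt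

spine-binary : ∀ a a′ r t → Binary (spine a a′ r t)
spine-binary a a′ r zero    = leg-binary a r
spine-binary a a′ r (suc t) = leg-arity a r , (leg-arity a′ r , spine-binary a a′ r t , leg-binary a′ r) , leg-binary a r

negPath-total : ∀ φ r → total φ (negPath r) ≡ r * φ Sign.-
negPath-total φ zero    = refl
negPath-total φ (suc r) = trans (+-comm _ (φ Sign.-)) (cong (λ x → φ Sign.- + x) (negPath-total φ r))

leg-total : ∀ φ a r → total φ (leg a r) ≡ a * φ Sign.+ + r * φ Sign.-
leg-total φ zero    r = negPath-total φ r
leg-total φ (suc a) r = trans (+-comm _ (φ Sign.+)) (trans (cong (λ x → φ Sign.+ + x) (leg-total φ a r))
    (sym (+-assoc (φ Sign.+) _ _)))

spine-total : ∀ φ a a′ r t → total φ (spine a a′ r t) ≡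
  t * ((a + a′ + 2) * φ Sign.+ + 2 * r * φ Sign.-) + (a * φ Sign.+ + r * φ Sign.-)
spine-total φ a a′ r zero    = leg-total φ a r
spine-total φ a a′ r (suc t) rewrite leg-total φ a r | leg-total φ a′ r | spine-total φ a a′ r t =
  rearrange a a′ r t (φ Sign.+) (φ Sign.-)
  where
  rearrange : ∀ a a′ r t x y →
    a * x + r * y + (a′ * x + r * y + (t * ((a + a′ + 2) * x + 2 * r * y) + (a * x + r * y)) + x) + x ≡
    (a + a′ + 2) * x + 2 * r * y + t * ((a + a′ + 2) * x + 2 * r * y) + (a * x + r * y)
  rearrange = solve-∀

total-edgeCount : ∀ sh → total (const 1) sh ≡ edgeCount sh
total-edgeCount tip          = refl
total-edgeCount (node _ S R) = trans (cong (_+ 1) (cong₂ _+_ (total-edgeCount R) (total-edgeCount S)))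
  (trans (+-assoc (edgeCount R) _ 1) (cong (λ x → edgeCount R + x) (+-comm (edgeCount S) 1)))

module Spine {Δ : ℕ} (Δ≥3 : 3 ≤ Δ) {𝒢 : Family} (sandwiched : Sandwiched Δ 𝒢) {k : ℕ} (q r a a′ : ℕ)
  (k≡ : k ≡ q + r) (r<q : r < q) (a≤ : a ≤ a′) (a′≤ : a′ ≤ suc a) (far : q ≤ suc (a + a′)) (t : ℕ) where

  shape = spine a a′ r t
  G = graph shape
  w = signs shape

  member : 𝒢 _ G
  member = proj₁ sandwiched _ G (graph-tree shape)
    λ v → ≤-trans (Binary⇒MaxDeg3 shape (spine-binary a a′ r t) v) Δ≥3

  local-positive : LocalPositive k G w
  local-positive = Piece⇒LocalPositive shape q r k≡ r<q (proj₂ (spine-guarded q r a≤ a′≤ far t))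

  edges : numEdges G ≡ t * (a + a′ + 2 + 2 * r) + (a + r)
  edges = trans (count-all (const 1) shape) (trans (spine-total (const 1) a a′ r t) (rearrange a a′ r t))
    where
    rearrange : ∀ a a′ r t → t * ((a + a′ + 2) * 1 + 2 * r * 1) + (a * 1 + r * 1) ≡ t * (a + a′ + 2 + 2 * r) + (a + r)
    rearrange = solve-∀

  negatives : negSub G w allEdges ≡ t * (2 * r) + r
  negatives = trans (count-all negBit shape) (trans (spine-total negBit a a′ r t) (rearrange a a′ r t))
    where
    rearrange : ∀ a a′ r t → t * ((a + a′ + 2) * 0 + 2 * r * 1) + (a * 0 + r * 1) ≡ t * (2 * r) + r
    rearrange = solve-∀

  t≤edges : t ≤ numEdges G
  t≤edges = ≤-trans (≤-trans (≤-reflexive (sym (*-identityʳ t))) (*-monoʳ-≤ t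
      (≤-trans (s≤s z≤n) (≤-reflexive (rearrange a a′ r)))))
    (≤-trans (m≤m+n _ (a + r)) (≤-reflexive (sym edges)))
    where
    rearrange : ∀ a a′ r → suc (a + a′ + 1 + 2 * r) ≡ a + a′ + 2 + 2 * r
    rearrange = solve-∀

  t≤order : t ≤ suc (edgeCount shape)
  t≤order = m≤n⇒m≤1+n (≤-trans t≤edges (≤-reflexive (trans (count-all (const 1) shape) (total-edgeCount shape))))

module _ {Δ : ℕ} (Δ≥3 : 3 ≤ Δ) {𝒢 : Family} (sandwiched : Sandwiched Δ 𝒢) where

  -- The numbers of edges and of negative edges are affine in `t`, so the ratio has to be checked
  -- only for one block of two legs and for the last leg.
  upper-ratio : ∀ {k} q r a a′ → k ≡ q + r → r < q → a ≤ a′ → a′ ≤ suc a → q ≤ suc (a + a′) → ∀ P Q →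
    (P + Q) * (a + a′ + 2 + 2 * r) ≤ 2 * Q * (2 * r) → (P + Q) * (a + r) ≤ 2 * Q * r → UpperRatio k 𝒢 P Q
  upper-ratio q r a a′ k≡ r<q a≤ a′≤ far P Q per-block last t =
    _ , G , member , w , local-positive , t≤order , t≤edges , (begin
      (P + Q) * numEdges G                                       ≡⟨ cong ((P + Q) *_) edges ⟩
      (P + Q) * (t * (a + a′ + 2 + 2 * r) + (a + r))
        ≡⟨ rearrange (P + Q) t (a + a′ + 2 + 2 * r) (a + r) ⟩
      t * ((P + Q) * (a + a′ + 2 + 2 * r)) + (P + Q) * (a + r)           ≤⟨ +-mono-≤ (*-monoʳ-≤ t per-block) last ⟩
      t * (2 * Q * (2 * r)) + 2 * Q * r                          ≡⟨ rearrange (2 * Q) t (2 * r) r ⟨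
      2 * Q * (t * (2 * r) + r)                                  ≡⟨ cong (2 * Q *_) negatives ⟨
      2 * Q * negSub G w allEdges                                ∎)
    where
    open Spine Δ≥3 sandwiched q r a a′ k≡ r<q a≤ a′≤ far t
    open ≤-Reasoning
    rearrange : ∀ x t y z → x * (t * y + z) ≡ t * (x * y) + x * z
    rearrange = solve-∀

  -- With both stems of length `a = r - 1`, a block has `2 * a + 2` positive and `2 * r` negative
  -- edges and hence weight 0. The last leg contributes `a - r`, which is -1.
  weight-attained : ∀ {k} q r a → k ≡ q + r → r < q → q ≤ suc (a + a) → r ≡ suc a → WeightAttained k 𝒢
  weight-attained q r a k≡ r<q far refl t =
    _ , G , member , w , local-positive , t≤order , ∙-cancelʳ (+ (2 * negSub G w allEdges)) _ _ (trans
      (weightSub-negSub G w allEdges) (cong (λ x → ℤ.- + 1 ℤ.+ + x) twice))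
    where
    open Spine Δ≥3 sandwiched q r a a k≡ r<q ≤-refl (n≤1+n a) far t
    rearrange : ∀ a t → suc (t * (a + a + 2 + 2 * suc a) + (a + suc a)) ≡ 2 * (t * (2 * suc a) + suc a)
    rearrange = solve-∀
    twice : suc (numEdges G) ≡ 2 * negSub G w allEdges
    twice = trans (cong suc edges) (trans (rearrange a t) (cong (2 *_) (sym negatives)))

-- Residues of k modulo 4

pos-∸ : ∀ x a b → x ≡ a + b → + x ℤ.- + b ≡ + a
pos-∸ x a b refl = trans (ℤₚ.+-assoc (+ a) (+ b) (ℤ.- + b)) (trans (cong (λ x → + a ℤ.+ x) (ℤₚ.+-inverseʳ (+ b)))
    (ℤₚ.+-identityʳ (+ a)))

between : ∀ {k 𝒢} P₁ Q₁ P₂ Q₂ K {p₁ p₂} → UpperRatio k 𝒢 P₁ Q₁ → LowerRatio k 𝒢 P₂ Q₂ K →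
  1 ≤ Q₁ → 1 ≤ Q₂ → p₁ ≡ + P₁ → p₂ ≡ + P₂ → CollapseValueBetween k 𝒢 (ℚ.- (p₁ // Q₁)) (ℚ.- (p₂ // Q₂))
between {k} {𝒢} P₁ (suc d₁) P₂ (suc d₂) K upper lower _ _ refl refl =
  UpperRatio⇒CollapseValueAtMost {k} {𝒢} P₁ d₁ upper , LowerRatio⇒CollapseValueAtLeast {k} {𝒢} P₂ d₂ K lower

module _ {Δ : ℕ} (Δ≥3 : Δ ≥ 3) {𝒢 : Family} (sw : Sandwiched Δ 𝒢) where

  -- In all four residue classes `r` is half of `k`, rounded up, minus 1, `q = k - r`, and `a`, `a′`
  -- are the halves of `q - 1` rounded down and up; they differ for residues 3 and 2. A block then
  -- has `k + r + 1` edges, and its ratio is exactly the claimed one: slack 0.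
  upper-3 : ∀ j → UpperRatio (4 * (suc j) + 3) 𝒢 (suc (2 * j)) (6 * (suc j) + 5)
  upper-3 j = upper-ratio Δ≥3 sw {k = 4 * (suc j) + 3} (2 * (suc j) + 2) (2 * (suc j) + 1) (suc j) (suc (suc j))
    (solve List.[ j ]) (≤-by 0 (solve List.[ j ])) (n≤1+n _) ≤-refl (≤-by 0 (solve List.[ j ]))
    (suc (2 * j)) (6 * (suc j) + 5) (≤-by 0 (solve List.[ j ])) (≤-by (12 * (suc j) + 6) (solve List.[ j ]))

  -- For residues 3 and 2 the smallest pieces decide: `r` negative edges among `suc s` give exactly
  -- the claimed ratio, while the largest pieces have slack.
  lower-3 : ∀ j → LowerRatio (4 * (suc j) + 3) 𝒢 (suc j) (3 * (suc j) + 2) (3 * (suc j) + 1 + (4 * (suc j) + 3))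
  lower-3 j = lower-ratio {k = 4 * (suc j) + 3} (2 * (suc j) + 1) (3 * (suc j) + 1) (suc j) (2 * (suc j) + 2)
      {3 * (suc j) + 2} (solve List.[ j ]) (≤-by 1 (solve List.[ j ])) (s≤s z≤n)
    (≤-by 0 (solve List.[ j ])) (≤-by (4 * (suc j) + 4) (solve List.[ j ])) sw

  upper-2 : ∀ j → UpperRatio (4 * (2 + j) + 2) 𝒢 (suc (2 * j)) (6 * (2 + j) + 3)
  upper-2 j = upper-ratio Δ≥3 sw {k = 4 * (2 + j) + 2} (2 * (2 + j) + 2) (2 * (2 + j)) (2 + j) (suc (2 + j))
    (solve List.[ j ]) (≤-by 1 (solve List.[ j ])) (n≤1+n _) ≤-refl (≤-by 0 (solve List.[ j ]))
    (suc (2 * j)) (6 * (2 + j) + 3) (≤-by 0 (solve List.[ j ])) (≤-by (12 * (2 + j)) (solve List.[ j ]))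

  lower-2 : ∀ j → LowerRatio (4 * (2 + j) + 2) 𝒢 (suc j) (3 * (2 + j) + 1) (3 * (2 + j) + (4 * (2 + j) + 2))
  lower-2 j = lower-ratio {k = 4 * (2 + j) + 2} (2 * (2 + j)) (3 * (2 + j)) (suc j) (2 * (2 + j) + 2) {3 * (2 + j) + 1}
      (solve List.[ j ]) (≤-by 0 (solve List.[ j ])) (s≤s z≤n)
    (≤-by 0 (solve List.[ j ])) (≤-by (4 * (2 + j) + 4) (solve List.[ j ])) sw

  upper-1 : ∀ j → UpperRatio (4 * (2 + j) + 1) 𝒢 (suc j) (3 * (2 + j) + 1)
  upper-1 j = upper-ratio Δ≥3 sw {k = 4 * (2 + j) + 1} (2 * (2 + j) + 1) (2 * (2 + j)) (2 + j) (2 + j)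
    (solve List.[ j ]) (≤-by 0 (solve List.[ j ])) ≤-refl (n≤1+n _) (≤-by 0 (solve List.[ j ]))
    (suc j) (3 * (2 + j) + 1) (≤-by 0 (solve List.[ j ])) (≤-by (4 * (2 + j)) (solve List.[ j ]))

  -- For residues 1 and 0 the inequalities for the smallest and for the largest pieces both hold
  -- with slack.
  lower-1 : ∀ j → LowerRatio (4 * (2 + j) + 1) 𝒢 (2 * j + 3) (6 * (2 + j) + 1) (3 * (2 + j) + (4 * (2 + j) + 1))
  lower-1 j = lower-ratio {k = 4 * (2 + j) + 1} (2 * (2 + j)) (3 * (2 + j)) (2 * j + 3) (4 * (2 + j) + 2)
      {6 * (2 + j) + 1} (solve List.[ j ]) (≤-by 1 (solve List.[ j ])) (s≤s z≤n)
    (≤-by (4 * (2 + j)) (solve List.[ j ])) (≤-by (4 * (2 + j) + 2) (solve List.[ j ])) sw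

  upper-0 : ∀ j → UpperRatio (4 * (3 + j)) 𝒢 (suc j) (3 * (3 + j))
  upper-0 j = upper-ratio Δ≥3 sw {k = 4 * (3 + j)} (2 * (3 + j) + 1) (2 * j + 5) (3 + j) (3 + j)
    (solve List.[ j ]) (≤-by 1 (solve List.[ j ])) ≤-refl (n≤1+n _) (≤-by 0 (solve List.[ j ]))
    (suc j) (3 * (3 + j)) (≤-by 0 (solve List.[ j ])) (≤-by (4 * j + 10) (solve List.[ j ]))

  lower-0 : ∀ j → LowerRatio (4 * (3 + j)) 𝒢 (2 * j + 3) (6 * j + 17) (3 * j + 8 + (4 * (3 + j)))
  lower-0 j = lower-ratio {k = 4 * (3 + j)} (2 * j + 5) (3 * j + 8) (2 * j + 3) (4 * j + 14) {6 * j + 17}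
      (solve List.[ j ]) (≤-by 0 (solve List.[ j ])) (≤-trans (s≤s z≤n) (m≤n+m 8 (3 * j)))
    (≤-by (4 * j + 10) (solve List.[ j ])) (≤-by (4 * j + 14) (solve List.[ j ])) sw

  between-3 : ∀ j → let m = suc j in CollapseValueBetween (4 * m + 3) 𝒢
    (ℚ.- ((+ (2 * m) ℤ.- + 1) // (6 * m + 5))) (ℚ.- ((+ m) // (3 * m + 2)))
  between-3 j = between (suc (2 * j)) _ (suc j) _ _ (upper-3 j) (lower-3 j)
    (s≤s z≤n) (s≤s z≤n) (pos-∸ (2 * suc j) (suc (2 * j)) 1 (solve List.[ j ])) refl

  between-2 : ∀ j → let m = 2 + j in CollapseValueBetween (4 * m + 2) 𝒢
    (ℚ.- ((+ (2 * m) ℤ.- + 3) // (6 * m + 3))) (ℚ.- ((+ m ℤ.- + 1) // (3 * m + 1)))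
  between-2 j = between (suc (2 * j)) _ (suc j) _ (3 * (2 + j) + (4 * (2 + j) + 2)) (upper-2 j) (lower-2 j)
    (s≤s z≤n) (s≤s z≤n) (pos-∸ (2 * (2 + j)) (suc (2 * j)) 3 (solve List.[ j ])) (pos-∸ (2 + j) (suc j) 1 (solve List.[ j ]))

  between-1 : ∀ j → let m = 2 + j in CollapseValueBetween (4 * m + 1) 𝒢
    (ℚ.- ((+ m ℤ.- + 1) // (3 * m + 1))) (ℚ.- ((+ (2 * m) ℤ.- + 1) // (6 * m + 1)))
  between-1 j = between (suc j) _ (2 * j + 3) _ (3 * (2 + j) + (4 * (2 + j) + 1)) (upper-1 j) (lower-1 j)
    (s≤s z≤n) (s≤s z≤n) (pos-∸ (2 + j) (suc j) 1 (solve List.[ j ])) (pos-∸ (2 * (2 + j)) (2 * j + 3) 1 (solve List.[ j ]))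

  between-0 : ∀ j → let m = 3 + j in CollapseValueBetween (4 * m) 𝒢
    (ℚ.- ((+ m ℤ.- + 2) // (3 * m))) (ℚ.- ((+ (2 * m) ℤ.- + 3) // (6 * m ∸ 1)))
  between-0 j = between (suc j) _ (2 * j + 3) _ (3 * j + 8 + 4 * (3 + j)) (upper-0 j)
    (subst (λ Q → LowerRatio (4 * (3 + j)) 𝒢 (2 * j + 3) Q (3 * j + 8 + 4 * (3 + j))) (sym denominator) (lower-0 j))
    (s≤s z≤n) (s≤s z≤n) (pos-∸ (3 + j) (suc j) 2 (solve List.[ j ])) (pos-∸ (2 * (3 + j)) (2 * j + 3) 3 (solve List.[ j ]))
    where
    expand : ∀ j → 6 * (3 + j) ≡ suc (6 * j + 17)
    expand = solve-∀
    denominator : 6 * (3 + j) ∸ 1 ≡ 6 * j + 17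
    denominator = cong (_∸ 1) (expand j)

data Residue : ℕ → Set where
  r0 : ∀ m → Residue (4 * m)
  r1 : ∀ m → Residue (4 * m + 1)
  r2 : ∀ m → Residue (4 * m + 2)
  r3 : ∀ m → Residue (4 * m + 3)

residue : ∀ k → Residue k
residue zero = r0 0
residue (suc k) with residue k
... | r0 m = subst Residue (+-comm (4 * m) 1) (r1 m)
... | r1 m = subst Residue (+-suc (4 * m) 1) (r2 m)
... | r2 m = subst Residue (+-suc (4 * m) 2) (r3 m)
... | r3 m = subst Residue (next m) (r0 (suc m))
  where
  next : ∀ m → 4 * suc m ≡ suc (4 * m + 3)
  next = solve-∀

Collapsing : ℕ → Set
Collapsing k = k ≡ 7 ⊎ k ≥ 9

excluded : ∀ {A : Set} k → {False ((k ℕ.≟ 7) ⊎-dec (9 ≤? k))} → Collapsing k → A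
excluded k {no-k} c = contradiction c (toWitnessFalse no-k)

module _ {Δ : ℕ} (Δ≥3 : Δ ≥ 3) {𝒢 : Family} (sw : Sandwiched Δ 𝒢) where

  collapses : ∀ k → Collapsing k → Collapses k 𝒢
  collapses k c with residue k
  ... | r3 zero          = excluded 3 c
  ... | r3 (suc j)       = UpperRatio⇒Collapses (2 * j) _ (upper-3 Δ≥3 sw j)
  ... | r2 zero          = excluded 2 c
  ... | r2 (suc zero)    = excluded 6 c
  ... | r2 (suc (suc j)) = UpperRatio⇒Collapses (2 * j) _ (upper-2 Δ≥3 sw j)
  ... | r1 zero          = excluded 1 c
  ... | r1 (suc zero)    = excluded 5 c
  ... | r1 (suc (suc j)) = UpperRatio⇒Collapses j _ (upper-1 Δ≥3 sw j)
  ... | r0 zero          = excluded 0 c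
  ... | r0 (suc zero)    = excluded 4 c
  ... | r0 (suc (suc zero))    = excluded 8 c
  ... | r0 (suc (suc (suc j))) = UpperRatio⇒Collapses j _ (upper-0 Δ≥3 sw j)

  collapse-3 : ∀ {k} → Collapsing k → ∀ m → k ≡ 4 * m + 3 → CollapseValueBetween k 𝒢
    (ℚ.- ((+ (2 * m) ℤ.- + 1) // (6 * m + 5))) (ℚ.- ((+ m) // (3 * m + 2)))
  collapse-3 c zero    refl = excluded 3 c
  collapse-3 c (suc j) refl = between-3 Δ≥3 sw j

  collapse-2 : ∀ {k} → Collapsing k → ∀ m → k ≡ 4 * m + 2 → CollapseValueBetween k 𝒢
    (ℚ.- ((+ (2 * m) ℤ.- + 3) // (6 * m + 3))) (ℚ.- ((+ m ℤ.- + 1) // (3 * m + 1)))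
  collapse-2 c zero          refl = excluded 2 c
  collapse-2 c (suc zero)    refl = excluded 6 c
  collapse-2 c (suc (suc j)) refl = between-2 Δ≥3 sw j

  collapse-1 : ∀ {k} → Collapsing k → ∀ m → k ≡ 4 * m + 1 → CollapseValueBetween k 𝒢
    (ℚ.- ((+ m ℤ.- + 1) // (3 * m + 1))) (ℚ.- ((+ (2 * m) ℤ.- + 1) // (6 * m + 1)))
  collapse-1 c zero          refl = excluded 1 c
  collapse-1 c (suc zero)    refl = excluded 5 c
  collapse-1 c (suc (suc j)) refl = between-1 Δ≥3 sw j

  collapse-0 : ∀ {k} → Collapsing k → ∀ m → k ≡ 4 * m → CollapseValueBetween k 𝒢
    (ℚ.- ((+ m ℤ.- + 2) // (3 * m))) (ℚ.- ((+ (2 * m) ℤ.- + 3) // (6 * m ∸ 1)))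
  collapse-0 c zero                refl = excluded 0 c
  collapse-0 c (suc zero)          refl = excluded 4 c
  collapse-0 c (suc (suc zero))    refl = excluded 8 c
  collapse-0 c (suc (suc (suc j))) refl = between-0 Δ≥3 sw j

theorem1p2 : (∀ (𝒢 : Family) → Sandwiched 2 𝒢 → ∀ (k : ℕ) → 1 ≤ k → Forcing k 𝒢) ×
    (∀ (Δ : ℕ) → Δ ≥ 3 → ∀ (𝒢 : Family) → Sandwiched Δ 𝒢 →
    (Forcing 1 𝒢 × Forcing 2 𝒢 × Forcing 3 𝒢 × Forcing 4 𝒢 × Forcing 6 𝒢) ×
    (WeaklyForcingWithValue 5 𝒢 (ℚ.- ℚ.1ℚ) × WeaklyForcingWithValue 8 𝒢 (ℚ.- ℚ.1ℚ)) ×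
    (∀ (k : ℕ) → k ≡ 7 ⊎ k ≥ 9 →
    Collapses k 𝒢 ×
    (∀ (m : ℕ) → k ≡ 4 ℕ.* m ℕ.+ 3 →
    CollapseValueBetween k 𝒢
    (ℚ.- ((+ (2 ℕ.* m) ℤ.- + 1) // (6 ℕ.* m ℕ.+ 5)))
    (ℚ.- ((+ m) // (3 ℕ.* m ℕ.+ 2)))) ×
    (∀ (m : ℕ) → k ≡ 4 ℕ.* m ℕ.+ 2 →
    CollapseValueBetween k 𝒢
    (ℚ.- ((+ (2 ℕ.* m) ℤ.- + 3) // (6 ℕ.* m ℕ.+ 3)))
    (ℚ.- ((+ m ℤ.- + 1) // (3 ℕ.* m ℕ.+ 1)))) ×
    (∀ (m : ℕ) → k ≡ 4 ℕ.* m ℕ.+ 1 →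
    CollapseValueBetween k 𝒢
    (ℚ.- ((+ m ℤ.- + 1) // (3 ℕ.* m ℕ.+ 1)))
    (ℚ.- ((+ (2 ℕ.* m) ℤ.- + 1) // (6 ℕ.* m ℕ.+ 1)))) ×
    (∀ (m : ℕ) → k ≡ 4 ℕ.* m →
    CollapseValueBetween k 𝒢
    (ℚ.- ((+ m ℤ.- + 2) // (3 ℕ.* m)))
    (ℚ.- ((+ (2 ℕ.* m) ℤ.- + 3) // (6 ℕ.* m ℕ.∸ 1))))))
theorem1p2 = (λ 𝒢 sw k 1≤k → forcing-2-path sw k 1≤k) , λ Δ Δ≥3 𝒢 sw →
  ( forcing-all-positive ≤-refl (s≤s z≤n) sw
  , forcing-all-positive (s≤s z≤n) ≤-refl sw
  -- Here and in the later uses of `balanced`, `suc s` and `lo` both equal `2 * r`, the least size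
  -- at which `r` negative edges cannot outweigh the others. The two underscores stand for the
  -- tables, which hold by evaluation.
  , forcing-balanced 2 (λ w conn lp → balanced w 1 3 1 1 0 2 _ _ conn lp (n≤1+n 3)) sw
  , forcing-balanced 2 (λ w conn lp → balanced w 1 4 1 1 0 2 _ _ conn lp ≤-refl) sw
  , forcing-balanced 4 (λ w conn lp → balanced w 2 6 3 2 0 4 _ _ conn lp ≤-refl) sw ) ,
  ( WeightAttained⇒WeaklyForcing (weight-attained Δ≥3 sw 3 2 1 refl ≤-refl ≤-refl refl)
      (weak-bound-balanced 4 (λ w conn lp → balanced w 2 5 3 2 1 4 _ _ conn lp (n≤1+n 5)) sw)
  , WeightAttained⇒WeaklyForcing (weight-attained Δ≥3 sw 5 3 2 refl (n≤1+n 4) ≤-refl refl)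
      (weak-bound-balanced 6 (λ w conn lp → balanced w 3 8 5 4 1 6 _ _ conn lp ≤-refl) sw) ) ,
  λ k c → collapses Δ≥3 sw k c , collapse-3 Δ≥3 sw c , collapse-2 Δ≥3 sw c , collapse-1 Δ≥3 sw c , collapse-0 Δ≥3 sw c
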